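{- Let $n_1<n_2<\cdots$ be positive integers and let $A_j\subseteq[n_j]$ be sets with $|A_j+A_j|=(1+o(1))\binom{|A_j|}{2}$ as $j\to\infty$ (i.e. the sets $A_j$ are quasi-Sidon). Then $$|A_j|\le\left(\left(\frac14+\frac1{(\pi+2)^2}\right)^{ -1/2}+o(1)\right)n_j^{1/2}=(1.863\ldots+o(1))\,n_j^{1/2}\qquad (j\to\infty).$$
   Context: Write $[n]=\{1,\dots,n\}$. For a set $A$ of integers, $A+A=\{a+b: a,b\in A\}$. -}

module Defs where

open import Data.Nat as ℕ using (ℕ; zero; suc)
open import Data.Nat.Combinatorics using (_C_)
open import Data.Integer using (+_)
open import Data.List using (List; []; _∷_; length; map; concatMap; deduplicate)
open import Data.List.Relation.Unary.All using (All)
open import Data.List.Relation.Unary.Unique.Propositional using (Unique)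
open import Data.Rational using (ℚ; _/_; _+_; _-_; _*_; _≤_; _<_; ∣_∣; 0ℚ; 1ℚ; -_)
open import Data.Product using (_×_; ∃)

toℚ : ℕ → ℚ
toℚ m = (+ m) / 1

IsSubsetOfRange : ℕ → List ℕ → Set
IsSubsetOfRange n A = Unique A × All (λ a → 1 ℕ.≤ a × a ℕ.≤ n) A

sumset : List ℕ → List ℕ
sumset A = deduplicate ℕ._≟_ (concatMap (λ a → map (a ℕ.+_) A) A)

sumsetCard : List ℕ → ℕ
sumsetCard A = length (sumset A)

-- Leibniz partial sums with an odd number of terms:
--   leibnizUpper k = 4 · Σ_{i=0}^{2k} (-1)^i / (2i+1),
-- a strictly decreasing sequence of rationals converging to π from above.
leibnizTerm : ℕ → ℚ
leibnizTerm i = (+ 4) / suc (2 ℕ.* i)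

leibnizSum : ℕ → ℚ
leibnizSum zero = 0ℚ
leibnizSum (suc m) = leibnizSum m + sign m * leibnizTerm m
  where
  sign : ℕ → ℚ
  sign zero = 1ℚ
  sign (suc zero) = - 1ℚ
  sign (suc (suc k)) = sign k

leibnizUpper : ℕ → ℚ
leibnizUpper k = leibnizSum (suc (2 ℕ.* k))

-- For rational q > 0, "q > c" where c = (1/4 + 1/(π+2)^2)^{-1/2}.
-- Since c is an increasing continuous function of π and leibnizUpper k ↓ π,
-- q > c  iff  for some k, with u = leibnizUpper k,
--   q^2 (1/4 + 1/(u+2)^2) > 1,
-- i.e. (multiplying by 4(u+2)^2 > 0)  4(u+2)^2 < q^2((u+2)^2 + 4).
AboveConstant : ℚ → Set
AboveConstant q = ∃ λ k →
  let w = leibnizUpper k + toℚ 2 in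
  toℚ 4 * (w * w) < (q * q) * (w * w + toℚ 4)

QuasiSidon : (ℕ → List ℕ) → Set
QuasiSidon A = ∀ (ε : ℚ) → 0ℚ < ε → ∃ λ J → ∀ j → J ℕ.≤ j →
  ∣ toℚ (sumsetCard (A j)) - toℚ (length (A j) C 2) ∣
    ≤ ε * toℚ (length (A j) C 2)

module Submission where

-- Put k = ∣A∣. Almost all sums a + b with a ≤ b are distinct and they lie in [2n], so for every character
-- χ of frequency j/(2n), 0 < j = O(1), we have (Σ_{a∈A} χ(a))² ≈ 2 Σ_{s∈A+A} χ(s) ≈ −2 Σ_{s∈[2n]∖(A+A)} χ(s), and hence
-- ∣Σ_{a∈A} χ(a)∣² ≤ 4n − k² + o(n). On the other hand, with θ = πa/n ∈ [0, π] the Fourier series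
--   (π/2) sin θ + Σ_{j≥1} 2 cos(2jθ)/(4j² − 1) = 1
-- has coefficients of total weight π/2 + 1, so one of these sums is at least 2k/(π + 2). Together,
-- 4k²/(π + 2)² ≤ 4n − k² + o(n).
--
-- To stay within ℚ, the angle π/n is replaced by that of a Gaussian rational z of norm 1 and small argument,
-- [n] is cut into 2M + 1 blocks, where M is the number of rotations by z in a quarter turn, and a is replaced
-- by the index of its block. The Fourier series is truncated, with π replaced by a Leibniz partial sum; this is the
-- right comparison because at θ = π/2 the truncated square wave Σ sin((2j+1)θ)/(2j+1) is itself a Leibniz sum.

-- With no limits in ℚ, the Fourier identity becomes a one-sided inequality with explicit error. By
-- summation by parts the even part cut off at J is 1 - cos(2Jθ)/(2J+1) - 2 sin θ · G(θ), with G the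
-- truncated square wave, so it suffices to bound sin θ · G(θ) by sin θ · G(π/2) up to a small
-- error. The derivative of a single G is sin(2Jθ)/(2 sin θ), whose absolute value is too large to
-- integrate. Summed over P consecutive cutoffs the derivative is at most 1/(2 sin²θ); its integral
-- from π/2 is half a tangent, which the factor sin θ makes bounded. The total error is thus O(1)
-- against a main term of size P. The integral is a finite sum along the powers of z, and its
-- second-order error is removed by choosing z after P. The order of choice is: a Leibniz index k₀
-- with upper sum u from q > c, then P, then z, then a threshold for n. If q²n ≤ k² beyond that
-- threshold, every relevant character sum is at most 2k(P - 4)/(P(u + 2)), whereas the test
-- function rules out any common bound below 2k(P - 3)/(P(u + 2)).

open import Algebra.Bundles using (CommutativeRing)
import Algebra.Properties.CommutativeSemiring.Exp as Exp
open import Algebra.Structures using (IsCommutativeRing)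
open import Data.Empty using (⊥)
open import Data.Integer as ℤ using (ℤ)
import Data.Integer.Properties as ℤ
open import Data.Integer.Tactic.RingSolver using () renaming (solve-∀ to ℤ-solve-∀)
open import Data.List using (List; []; _∷_; _++_; map; length; concatMap; downFrom)
open import Data.List.Membership.Propositional using (_∈_; find)
open import Data.List.Membership.Propositional.Properties using (∈-∃++; ∈-map⁺; ∈-map⁻; ∈-++⁺ˡ; ∈-++⁺ʳ; ∈-concatMap⁻; ∈-deduplicate⁻; ∈-downFrom⁺)
open import Data.List.Properties using (length-++; length-map; length-downFrom)
open import Data.List.Relation.Binary.Permutation.Propositional as Perm using (_↭_; ↭-refl; ↭-trans; prep)
open import Data.List.Relation.Binary.Permutation.Propositional.Properties using (shift; ∈-resp-↭; ↭-length)
open import Data.List.Relation.Binary.Subset.Propositional using (_⊆_)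
open import Data.List.Relation.Unary.All as All using (All; []; _∷_)
import Data.List.Relation.Unary.AllPairs as AllPairs
open import Data.List.Relation.Unary.Any using (here; there)
open import Data.Nat as ℕ using (ℕ; zero; suc)
open import Data.Nat.Combinatorics using (_C_; nC1≡n; nCk+nC[k+1]≡[n+1]C[k+1])
open import Data.Nat.Divisibility using (n∣m*n)
open import Data.Nat.DivMod using (m≡m%n+[m/n]*n; m%n<n; m<n⇒m/n≡0; m*n/n≡m; +-distrib-/-∣ʳ; m<n*o⇒m/o<n; m/n*n≤m)
import Data.Nat.Properties as ℕ
open import Data.Nat.Tactic.RingSolver using () renaming (solve-∀ to ℕ-solve-∀)
open import Data.List.Relation.Unary.Unique.DecPropositional.Properties ℕ._≟_ using (deduplicate-!)
open import Data.List.Relation.Unary.Unique.Propositional using (Unique)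
open import Data.Product using (_×_; _,_; proj₁; proj₂; ∃; ∃₂)
open import Data.Rational
open import Data.Rational.Properties
import Data.Rational.Unnormalised as ℚᵘ
import Data.Rational.Unnormalised.Properties as ℚᵘ
open import Data.Sum using (_⊎_; inj₁; inj₂; [_,_]′)
open import Function using (id; _∘_)
open import Level using (0ℓ)
open import Relation.Binary.Definitions using (DecidableEquality)
open import Relation.Binary.PropositionalEquality
open import Relation.Nullary using (Dec; yes; no; contradiction; ¬_)
open import Relation.Nullary.Decidable using (dec⇒maybe; map′; _×-dec_)
open import Tactic.RingSolver using (solve-∀)
open import Tactic.RingSolver.Core.AlmostCommutativeRing using (AlmostCommutativeRing; fromCommutativeRing)
open import Defs

-- Inequalities between rationals

ℚ-ring : AlmostCommutativeRing 0ℓ 0ℓ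
ℚ-ring = fromCommutativeRing +-*-commutativeRing (λ x → dec⇒maybe (0ℚ ≟ x))

diff : ∀ {p q} → p ≤ q → 0ℚ ≤ q - p
diff {p} {q} p≤q = subst (_≤ q - p) (+-inverseʳ p) (+-monoˡ-≤ (- p) p≤q)

-- An inequality is proved by writing q − p as a visibly nonnegative e, which leaves a ring identity.
cert : ∀ {e p q} → 0ℚ ≤ e → e ≡ q - p → p ≤ q
cert {e} {p} {q} 0≤e e≡ = subst₂ _≤_ (+-identityʳ p) (trans (cong (p +_) e≡) (lemma p q)) (+-monoʳ-≤ p 0≤e)
  where
  lemma : ∀ p q → p + (q - p) ≡ q
  lemma = solve-∀ ℚ-ring

0≤+ : ∀ {p q} → 0ℚ ≤ p → 0ℚ ≤ q → 0ℚ ≤ p + q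
0≤+ = +-mono-≤

0≤* : ∀ {p q} → 0ℚ ≤ p → 0ℚ ≤ q → 0ℚ ≤ p * q
0≤* {p} {q} 0≤p 0≤q = nonNegative⁻¹ (p * q) {{nonNeg*nonNeg⇒nonNeg p {{nonNegative 0≤p}} q {{nonNegative 0≤q}}}}

0≤sq : ∀ p → 0ℚ ≤ p * p
0≤sq p with ≤-total 0ℚ p
... | inj₁ 0≤p = 0≤* 0≤p 0≤p
... | inj₂ p≤0 = subst (0ℚ ≤_) (lemma p) (0≤* (diff p≤0) (diff p≤0))
  where
  lemma : ∀ p → (0ℚ - p) * (0ℚ - p) ≡ p * p
  lemma = solve-∀ ℚ-ring

0<* : ∀ {p q} → 0ℚ < p → 0ℚ < q → 0ℚ < p * q
0<* {p} {q} 0<p 0<q = positive⁻¹ (p * q) {{pos*pos⇒pos p {{positive 0<p}} q {{positive 0<q}}}}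

*-mono-≤ : ∀ {p q r s} → 0ℚ ≤ p → 0ℚ ≤ s → p ≤ q → r ≤ s → p * r ≤ q * s
*-mono-≤ {p} {q} {r} {s} 0≤p 0≤s p≤q r≤s =
  cert (0≤+ (0≤* 0≤p (diff r≤s)) (0≤* (diff p≤q) 0≤s)) (lemma p q r s)
  where
  lemma : ∀ p q r s → p * (s - r) + (q - p) * s ≡ q * s - p * r
  lemma = solve-∀ ℚ-ring

*-cancelˡ-≤ : ∀ {p q r} → 0ℚ < r → r * p ≤ r * q → p ≤ q
*-cancelˡ-≤ {r = r} 0<r = *-cancelˡ-≤-pos r {{positive 0<r}}

sq-cancel-≤ : ∀ {p q} → 0ℚ ≤ q → p * p ≤ q * q → p ≤ q
sq-cancel-≤ {p} {q} 0≤q p²≤q² with p ≤? q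
... | yes p≤q = p≤q
... | no  p≰q = contradiction refl (<⇒≢ (begin-strict
  p * p ≤⟨ p²≤q² ⟩
  q * q ≤⟨ *-monoˡ-≤-nonNeg q {{nonNegative 0≤q}} (<⇒≤ q<p) ⟩
  q * p <⟨ *-monoˡ-<-pos p {{positive (≤-<-trans 0≤q q<p)}} q<p ⟩
  p * p ∎))
  where
  open ≤-Reasoning
  q<p : q < p
  q<p = ≰⇒> p≰q

toℚᵘ-toℚ : ∀ m → toℚᵘ (toℚ m) ℚᵘ.≃ ℚᵘ.mkℚᵘ (ℤ.+ m) 0
toℚᵘ-toℚ m = toℚᵘ-fromℚᵘ (ℚᵘ.mkℚᵘ (ℤ.+ m) 0)

toℚ-+ : ∀ m n → toℚ (m ℕ.+ n) ≡ toℚ m + toℚ n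
toℚ-+ m n = toℚᵘ-injective (begin
  toℚᵘ (toℚ (m ℕ.+ n))                        ≈⟨ toℚᵘ-toℚ (m ℕ.+ n) ⟩
  ℚᵘ.mkℚᵘ (ℤ.+ (m ℕ.+ n)) 0                     ≈⟨ ℚᵘ.*≡* (lemma (ℤ.+ m) (ℤ.+ n)) ⟩
  ℚᵘ.mkℚᵘ (ℤ.+ m) 0 ℚᵘ.+ ℚᵘ.mkℚᵘ (ℤ.+ n) 0        ≈⟨ ℚᵘ.+-cong (toℚᵘ-toℚ m) (toℚᵘ-toℚ n) ⟨
  toℚᵘ (toℚ m) ℚᵘ.+ toℚᵘ (toℚ n)              ≈⟨ toℚᵘ-homo-+ (toℚ m) (toℚ n) ⟨
  toℚᵘ (toℚ m + toℚ n)                        ∎)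
  where
  open ℚᵘ.≃-Reasoning
  lemma : ∀ i j → (i ℤ.+ j) ℤ.* (ℤ.1ℤ) ≡ (i ℤ.* ℤ.1ℤ ℤ.+ j ℤ.* ℤ.1ℤ) ℤ.* ℤ.1ℤ
  lemma = ℤ-solve-∀

toℚ-* : ∀ m n → toℚ (m ℕ.* n) ≡ toℚ m * toℚ n
toℚ-* m n = toℚᵘ-injective (begin
  toℚᵘ (toℚ (m ℕ.* n))                        ≈⟨ toℚᵘ-toℚ (m ℕ.* n) ⟩
  ℚᵘ.mkℚᵘ (ℤ.+ (m ℕ.* n)) 0                     ≈⟨ ℚᵘ.*≡* (cong (ℤ._* ℤ.1ℤ) (ℤ.pos-* m n)) ⟩
  ℚᵘ.mkℚᵘ (ℤ.+ m) 0 ℚᵘ.* ℚᵘ.mkℚᵘ (ℤ.+ n) 0        ≈⟨ ℚᵘ.*-cong (toℚᵘ-toℚ m) (toℚᵘ-toℚ n) ⟨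
  toℚᵘ (toℚ m) ℚᵘ.* toℚᵘ (toℚ n)              ≈⟨ toℚᵘ-homo-* (toℚ m) (toℚ n) ⟨
  toℚᵘ (toℚ m * toℚ n)                        ∎)
  where open ℚᵘ.≃-Reasoning

toℚ-suc : ∀ m → toℚ (suc m) ≡ 1ℚ + toℚ m
toℚ-suc = toℚ-+ 1

0≤toℚ : ∀ m → 0ℚ ≤ toℚ m
0≤toℚ m = nonNegative⁻¹ (toℚ m) {{normalize-nonNeg m 1}}

toℚ-mono-≤ : ∀ {m n} → m ℕ.≤ n → toℚ m ≤ toℚ n
toℚ-mono-≤ {m} {n} m≤n = begin
  toℚ m                       ≡⟨ +-identityʳ (toℚ m) ⟨
  toℚ m + 0ℚ                  ≤⟨ +-monoʳ-≤ (toℚ m) (0≤toℚ (n ℕ.∸ m)) ⟩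
  toℚ m + toℚ (n ℕ.∸ m)       ≡⟨ toℚ-+ m (n ℕ.∸ m) ⟨
  toℚ (m ℕ.+ (n ℕ.∸ m))       ≡⟨ cong toℚ (ℕ.m+[n∸m]≡n m≤n) ⟩
  toℚ n                       ∎
  where open ≤-Reasoning

0<toℚ : ∀ m → 0ℚ < toℚ (suc m)
0<toℚ m = positive⁻¹ (toℚ (suc m)) {{normalize-pos (suc m) 1}}

≤-toℚ : ∀ p → ∃ λ n → p ≤ toℚ n
≤-toℚ p@(mkℚ i d _) = ℤ.∣ i ∣ , toℚᵘ-cancel-≤ (ℚᵘ.≤-respʳ-≃ (ℚᵘ.≃-sym (toℚᵘ-toℚ ℤ.∣ i ∣)) (ℚᵘ.*≤* (begin
  i ℤ.* ℤ.1ℤ                     ≡⟨ ℤ.*-identityʳ i ⟩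
  i                              ≤⟨ i≤∣i∣ i ⟩
  ℤ.+ ℤ.∣ i ∣                      ≤⟨ ℤ.+≤+ (ℕ.m≤m*n ℤ.∣ i ∣ (suc d)) ⟩
  ℤ.+ (ℤ.∣ i ∣ ℕ.* suc d)          ≡⟨ ℤ.pos-* ℤ.∣ i ∣ (suc d) ⟩
  ℤ.+ ℤ.∣ i ∣ ℤ.* ℤ.+ suc d          ∎)))
  where
  open ℤ.≤-Reasoning
  i≤∣i∣ : ∀ i → i ℤ.≤ ℤ.+ ℤ.∣ i ∣
  i≤∣i∣ (ℤ.+ _)      = ℤ.≤-refl
  i≤∣i∣ (ℤ.-[1+ _ ]) = ℤ.-≤+

archimedean : ∀ a {s} → 0ℚ < s → ∃ λ n → a ≤ toℚ n * s
archimedean a {s} 0<s with n , a/s≤n ← ≤-toℚ (a * (1/ s) {{>-nonZero 0<s}}) = n , (begin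
  a                       ≡⟨ *-identityʳ a ⟨
  a * 1ℚ                  ≡⟨ cong (a *_) (*-inverseˡ s) ⟨
  a * (1/ s * s)          ≡⟨ *-assoc a (1/ s) s ⟨
  a * 1/ s * s            ≤⟨ *-monoʳ-≤-nonNeg s {{nonNegative (<⇒≤ 0<s)}} a/s≤n ⟩
  toℚ n * s               ∎)
  where
  open ≤-Reasoning
  instance
    s-nonZero : NonZero s
    s-nonZero = >-nonZero 0<s

0<½ : 0ℚ < ½
0<½ = *<* (ℤ.+<+ (ℕ.s≤s ℕ.z≤n))

0≤½ : 0ℚ ≤ ½
0≤½ = <⇒≤ 0<½

-- Gaussian rationals

record 𝔾 : Set where
  constructor _+i_
  field
    re im : ℚ

open 𝔾 public

infixl 6 _⊕_ _⊖_
infixl 7 _⊗_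
infix  8 ⊝_
infix  4 _≟ᵍ_

_⊕_ _⊗_ _⊖_ : 𝔾 → 𝔾 → 𝔾
(a +i b) ⊕ (c +i d) = (a + c) +i (b + d)
(a +i b) ⊗ (c +i d) = (a * c - b * d) +i (a * d + b * c)

⊝_ : 𝔾 → 𝔾
⊝ (a +i b) = (- a) +i (- b)

v ⊖ w = v ⊕ (⊝ w)

real : ℚ → 𝔾
real r = r +i 0ℚ

0𝔾 1𝔾 𝕚 : 𝔾
0𝔾 = real 0ℚ
1𝔾 = real 1ℚ
𝕚  = 0ℚ +i 1ℚ

conj : 𝔾 → 𝔾
conj (a +i b) = a +i (- b)

_≟ᵍ_ : DecidableEquality 𝔾
(a +i b) ≟ᵍ (c +i d) = map′ (λ (p , q) → cong₂ _+i_ p q) (λ e → cong re e , cong im e) (a ≟ c ×-dec b ≟ d)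

𝔾-isCommutativeRing : IsCommutativeRing _≡_ _⊕_ _⊗_ ⊝_ 0𝔾 1𝔾
𝔾-isCommutativeRing = record
  { isRing = record
    { +-isAbelianGroup = record
      { isGroup = record
        { isMonoid = record
          { isSemigroup = record
            { isMagma = record { isEquivalence = isEquivalence ; ∙-cong = cong₂ _⊕_ }
            ; assoc = λ u v w → cong₂ _+i_ (+-assoc (re u) (re v) (re w)) (+-assoc (im u) (im v) (im w))
            }
          ; identity = (λ w → cong₂ _+i_ (+-identityˡ (re w)) (+-identityˡ (im w)))
                     , (λ w → cong₂ _+i_ (+-identityʳ (re w)) (+-identityʳ (im w)))
          }
        ; inverse = (λ w → cong₂ _+i_ (+-inverseˡ (re w)) (+-inverseˡ (im w)))
                  , (λ w → cong₂ _+i_ (+-inverseʳ (re w)) (+-inverseʳ (im w)))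
        ; ⁻¹-cong = cong ⊝_
        }
      ; comm = λ v w → cong₂ _+i_ (+-comm (re v) (re w)) (+-comm (im v) (im w))
      }
    ; *-cong = cong₂ _⊗_
    ; *-assoc = λ u v w → cong₂ _+i_
        (assoc-re (re u) (im u) (re v) (im v) (re w) (im w))
        (assoc-im (re u) (im u) (re v) (im v) (re w) (im w))
    ; *-identity = (λ w → cong₂ _+i_ (1*-re (re w) (im w)) (1*-im (re w) (im w)))
                 , (λ w → cong₂ _+i_ (*1-re (re w) (im w)) (*1-im (re w) (im w)))
    ; distrib = (λ u v w → cong₂ _+i_
                   (distribˡ-re (re u) (im u) (re v) (im v) (re w) (im w))
                   (distribˡ-im (re u) (im u) (re v) (im v) (re w) (im w)))
              , (λ u v w → cong₂ _+i_
                   (distribʳ-re (re u) (im u) (re v) (im v) (re w) (im w))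
                   (distribʳ-im (re u) (im u) (re v) (im v) (re w) (im w)))
    }
  ; *-comm = λ v w → cong₂ _+i_ (comm-re (re v) (im v) (re w) (im w)) (comm-im (re v) (im v) (re w) (im w))
  }
  where
  assoc-re : ∀ a b c d e f → (a * c - b * d) * e - (a * d + b * c) * f ≡ a * (c * e - d * f) - b * (c * f + d * e)
  assoc-re = solve-∀ ℚ-ring
  assoc-im : ∀ a b c d e f → (a * c - b * d) * f + (a * d + b * c) * e ≡ a * (c * f + d * e) + b * (c * e - d * f)
  assoc-im = solve-∀ ℚ-ring
  1*-re : ∀ a b → 1ℚ * a - 0ℚ * b ≡ a
  1*-re = solve-∀ ℚ-ring
  1*-im : ∀ a b → 1ℚ * b + 0ℚ * a ≡ b
  1*-im = solve-∀ ℚ-ring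
  *1-re : ∀ a b → a * 1ℚ - b * 0ℚ ≡ a
  *1-re = solve-∀ ℚ-ring
  *1-im : ∀ a b → a * 0ℚ + b * 1ℚ ≡ b
  *1-im = solve-∀ ℚ-ring
  distribˡ-re : ∀ a b c d e f → a * (c + e) - b * (d + f) ≡ (a * c - b * d) + (a * e - b * f)
  distribˡ-re = solve-∀ ℚ-ring
  distribˡ-im : ∀ a b c d e f → a * (d + f) + b * (c + e) ≡ (a * d + b * c) + (a * f + b * e)
  distribˡ-im = solve-∀ ℚ-ring
  distribʳ-re : ∀ a b c d e f → (c + e) * a - (d + f) * b ≡ (c * a - d * b) + (e * a - f * b)
  distribʳ-re = solve-∀ ℚ-ring
  distribʳ-im : ∀ a b c d e f → (c + e) * b + (d + f) * a ≡ (c * b + d * a) + (e * b + f * a)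
  distribʳ-im = solve-∀ ℚ-ring
  comm-re : ∀ a b c d → a * c - b * d ≡ c * a - d * b
  comm-re = solve-∀ ℚ-ring
  comm-im : ∀ a b c d → a * d + b * c ≡ c * b + d * a
  comm-im = solve-∀ ℚ-ring

𝔾-commutativeRing : CommutativeRing 0ℓ 0ℓ
𝔾-commutativeRing = record { isCommutativeRing = 𝔾-isCommutativeRing }

𝔾-ring : AlmostCommutativeRing 0ℓ 0ℓ
𝔾-ring = fromCommutativeRing 𝔾-commutativeRing (λ x → dec⇒maybe (0𝔾 ≟ᵍ x))

open Exp (CommutativeRing.commutativeSemiring 𝔾-commutativeRing) public
  using (_^_; ^-homo-*; ^-assocʳ; ^-distrib-*)

∥_∥² : 𝔾 → ℚ
∥ w ∥² = re w * re w + im w * im w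

-- w ≼ b stands for ∣w∣ ≤ b; it spares the square root.
infix 4 _≼_
record _≼_ (w : 𝔾) (b : ℚ) : Set where
  constructor bounded
  field
    0≤bound : 0ℚ ≤ b
    norm≤   : ∥ w ∥² ≤ b * b

open _≼_ public

∥∥²-⊗ : ∀ v w → ∥ v ⊗ w ∥² ≡ ∥ v ∥² * ∥ w ∥²
∥∥²-⊗ (a +i b) (c +i d) = lemma a b c d
  where
  lemma : ∀ a b c d → (a * c - b * d) * (a * c - b * d) + (a * d + b * c) * (a * d + b * c) ≡ (a * a + b * b) * (c * c + d * d)
  lemma = solve-∀ ℚ-ring

0≤∥∥² : ∀ w → 0ℚ ≤ ∥ w ∥²
0≤∥∥² w = 0≤+ (0≤sq (re w)) (0≤sq (im w))

≼-⊗ : ∀ {v w p q} → v ≼ p → w ≼ q → v ⊗ w ≼ p * q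
≼-⊗ {v} {w} {p} {q} v≼p w≼q = bounded (0≤* (0≤bound v≼p) (0≤bound w≼q)) (begin
  ∥ v ⊗ w ∥²            ≡⟨ ∥∥²-⊗ v w ⟩
  ∥ v ∥² * ∥ w ∥²       ≤⟨ *-mono-≤ (0≤∥∥² v) (0≤sq q) (norm≤ v≼p) (norm≤ w≼q) ⟩
  p * p * (q * q)       ≡⟨ lemma p q ⟩
  p * q * (p * q)       ∎)
  where
  open ≤-Reasoning
  lemma : ∀ p q → p * p * (q * q) ≡ p * q * (p * q)
  lemma = solve-∀ ℚ-ring

-- Cauchy-Schwarz through Lagrange's identity: the defect is the square (ad - bc)². It supplies the
-- cross term of the triangle inequality `≼-⊕`.
dot-≤ : ∀ {v w p q} → v ≼ p → w ≼ q → re v * re w + im v * im w ≤ p * q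
dot-≤ {a +i b} {c +i d} v≼p w≼q =
  sq-cancel-≤ (0≤bound (≼-⊗ v≼p w≼q)) (≤-trans cauchy (norm≤ (≼-⊗ v≼p w≼q)))
  where
  cauchy : (a * c + b * d) * (a * c + b * d) ≤ ∥ (a +i b) ⊗ (c +i d) ∥²
  cauchy = cert (0≤sq (a * d - b * c)) (lemma a b c d)
    where
    lemma : ∀ a b c d → (a * d - b * c) * (a * d - b * c)
          ≡ (a * c - b * d) * (a * c - b * d) + (a * d + b * c) * (a * d + b * c) - (a * c + b * d) * (a * c + b * d)
    lemma = solve-∀ ℚ-ring

≼-⊕ : ∀ {v w p q} → v ≼ p → w ≼ q → v ⊕ w ≼ p + q
≼-⊕ {v} {w} {p} {q} v≼p w≼q = bounded (0≤+ (0≤bound v≼p) (0≤bound w≼q))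
  (cert (0≤+ (0≤+ (diff (norm≤ v≼p)) (diff (norm≤ w≼q))) (0≤+ (diff (dot-≤ v≼p w≼q)) (diff (dot-≤ v≼p w≼q))))
        (lemma (re v) (im v) (re w) (im w) p q))
  where
  lemma : ∀ a b c d p q →
    p * p - (a * a + b * b) + (q * q - (c * c + d * d)) + (p * q - (a * c + b * d) + (p * q - (a * c + b * d)))
    ≡ (p + q) * (p + q) - ((a + c) * (a + c) + (b + d) * (b + d))
  lemma = solve-∀ ℚ-ring

≼-weaken : ∀ {w p q} → w ≼ p → p ≤ q → w ≼ q
≼-weaken w≼p p≤q = bounded (≤-trans (0≤bound w≼p) p≤q)
  (≤-trans (norm≤ w≼p) (*-mono-≤ (0≤bound w≼p) (≤-trans (0≤bound w≼p) p≤q) p≤q p≤q))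

≼-⊝ : ∀ {w p} → w ≼ p → ⊝ w ≼ p
≼-⊝ {w} {p} w≼p = bounded (0≤bound w≼p) (subst (_≤ p * p) (lemma (re w) (im w)) (norm≤ w≼p))
  where
  lemma : ∀ a b → a * a + b * b ≡ - a * - a + - b * - b
  lemma = solve-∀ ℚ-ring

≼-⊖ : ∀ {v w p q} → v ≼ p → w ≼ q → v ⊖ w ≼ p + q
≼-⊖ v≼p w≼q = ≼-⊕ v≼p (≼-⊝ w≼q)

≼-real : ∀ {r} → 0ℚ ≤ r → real r ≼ r
≼-real {r} 0≤r = bounded 0≤r (≤-reflexive (lemma r))
  where
  lemma : ∀ r → r * r + 0ℚ * 0ℚ ≡ r * r
  lemma = solve-∀ ℚ-ring

0𝔾≼0 : 0𝔾 ≼ 0ℚ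
0𝔾≼0 = ≼-real ≤-refl

re≤ : ∀ {w p} → w ≼ p → re w ≤ p
re≤ {w} {p} w≼p = sq-cancel-≤ (0≤bound w≼p)
  (≤-trans (cert (0≤sq (im w)) (lemma (re w) (im w))) (norm≤ w≼p))
  where
  lemma : ∀ a b → b * b ≡ a * a + b * b - a * a
  lemma = solve-∀ ℚ-ring

𝕚≼1 : 𝕚 ≼ 1ℚ
𝕚≼1 = bounded (0≤toℚ 1) ≤-refl

im≤ : ∀ {w p} → w ≼ p → im w ≤ p
im≤ {w} {p} w≼p = sq-cancel-≤ (0≤bound w≼p)
  (≤-trans (cert (0≤sq (re w)) (lemma (re w) (im w))) (norm≤ w≼p))
  where
  lemma : ∀ a b → a * a ≡ a * a + b * b - b * b
  lemma = solve-∀ ℚ-ring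

-im≤ : ∀ {w p} → w ≼ p → - im w ≤ p
-im≤ w≼p = im≤ (≼-⊝ w≼p)

-re≤ : ∀ {w p} → w ≼ p → - re w ≤ p
-re≤ w≼p = re≤ (≼-⊝ w≼p)

record Unit (w : 𝔾) : Set where
  constructor unit
  field
    norm≡1 : ∥ w ∥² ≡ 1ℚ

open Unit public

unit-≼ : ∀ {w} → Unit w → w ≼ 1ℚ
unit-≼ u = bounded (0≤toℚ 1) (≤-reflexive (norm≡1 u))

unit-⊗ : ∀ {v w} → Unit v → Unit w → Unit (v ⊗ w)
unit-⊗ {v} {w} u₁ u₂ = unit (trans (∥∥²-⊗ v w) (cong₂ _*_ (norm≡1 u₁) (norm≡1 u₂)))

unit-^ : ∀ {w} → Unit w → ∀ n → Unit (w ^ n)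
unit-^ u zero    = unit refl
unit-^ u (suc n) = unit-⊗ u (unit-^ u n)

unit-conj : ∀ {w} → Unit w → Unit (conj w)
unit-conj {w} u = unit (trans (lemma (re w) (im w)) (norm≡1 u))
  where
  lemma : ∀ a b → a * a + - b * - b ≡ a * a + b * b
  lemma = solve-∀ ℚ-ring

conj-inverse : ∀ {w} → Unit w → conj w ⊗ w ≡ 1𝔾
conj-inverse {w} u = cong₂ _+i_ (trans (lemma₁ (re w) (im w)) (norm≡1 u)) (lemma₂ (re w) (im w))
  where
  lemma₁ : ∀ a b → a * a - (- b) * b ≡ a * a + b * b
  lemma₁ = solve-∀ ℚ-ring
  lemma₂ : ∀ a b → a * b + (- b) * a ≡ 0ℚ
  lemma₂ = solve-∀ ℚ-ring

conj-⊗ : ∀ v w → conj (v ⊗ w) ≡ conj v ⊗ conj w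
conj-⊗ (a +i b) (c +i d) = cong₂ _+i_ (lemma₁ a b c d) (lemma₂ a b c d)
  where
  lemma₁ : ∀ a b c d → a * c - b * d ≡ a * c - - b * - d
  lemma₁ = solve-∀ ℚ-ring
  lemma₂ : ∀ a b c d → - (a * d + b * c) ≡ a * - d + - b * c
  lemma₂ = solve-∀ ℚ-ring

conj-^ : ∀ w n → conj (w ^ n) ≡ conj w ^ n
conj-^ w zero    = refl
conj-^ w (suc n) = trans (conj-⊗ w (w ^ n)) (cong (conj w ⊗_) (conj-^ w n))

1^ : ∀ n → 1𝔾 ^ n ≡ 1𝔾
1^ zero    = refl
1^ (suc n) = cong (1𝔾 ⊗_) (1^ n)

-- Telescoping: w^(n+1) - 1 = w(w^n - 1) + (w - 1).
^-near-1 : ∀ {w d} → w ≼ 1ℚ → w ⊖ 1𝔾 ≼ d → ∀ n → w ^ n ⊖ 1𝔾 ≼ toℚ n * d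
^-near-1 {w} {d} w≼1 w-1≼d zero    = subst (0𝔾 ≼_) (sym (*-zeroˡ d)) 0𝔾≼0
^-near-1 {w} {d} w≼1 w-1≼d (suc n) = subst₂ _≼_ (lemma₁ w (w ^ n)) (trans (lemma₂ d (toℚ n)) (cong (_* d) (sym (toℚ-suc n))))
  (≼-⊕ (≼-⊗ w≼1 (^-near-1 w≼1 w-1≼d n)) w-1≼d)
  where
  lemma₁ : ∀ w u → w ⊗ (u ⊖ 1𝔾) ⊕ (w ⊖ 1𝔾) ≡ w ⊗ u ⊖ 1𝔾
  lemma₁ = solve-∀ 𝔾-ring
  lemma₂ : ∀ d n → 1ℚ * (n * d) + d ≡ (1ℚ + n) * d
  lemma₂ = solve-∀ ℚ-ring

-- Finite sums and sumsets

private variable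
  X Y : Set

∑ : (X → 𝔾) → List X → 𝔾
∑ f []       = 0𝔾
∑ f (x ∷ xs) = f x ⊕ ∑ f xs

∑-cong : ∀ {f g : X → 𝔾} → (∀ x → f x ≡ g x) → ∀ xs → ∑ f xs ≡ ∑ g xs
∑-cong f≗g []       = refl
∑-cong f≗g (x ∷ xs) = cong₂ _⊕_ (f≗g x) (∑-cong f≗g xs)

∑-++ : ∀ (f : X → 𝔾) xs ys → ∑ f (xs ++ ys) ≡ ∑ f xs ⊕ ∑ f ys
∑-++ f []       ys = sym (lemma (∑ f ys))
  where
  lemma : ∀ w → 0𝔾 ⊕ w ≡ w
  lemma = solve-∀ 𝔾-ring
∑-++ f (x ∷ xs) ys = trans (cong (f x ⊕_) (∑-++ f xs ys)) (lemma (f x) (∑ f xs) (∑ f ys))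
  where
  lemma : ∀ u v w → u ⊕ (v ⊕ w) ≡ u ⊕ v ⊕ w
  lemma = solve-∀ 𝔾-ring

∑-map : ∀ (f : Y → 𝔾) (g : X → Y) xs → ∑ f (map g xs) ≡ ∑ (λ x → f (g x)) xs
∑-map f g []       = refl
∑-map f g (x ∷ xs) = cong (f (g x) ⊕_) (∑-map f g xs)

∑-⊕ : ∀ (f g : X → 𝔾) xs → ∑ (λ x → f x ⊕ g x) xs ≡ ∑ f xs ⊕ ∑ g xs
∑-⊕ f g []       = refl
∑-⊕ f g (x ∷ xs) = trans (cong (f x ⊕ g x ⊕_) (∑-⊕ f g xs)) (lemma (f x) (g x) (∑ f xs) (∑ g xs))
  where
  lemma : ∀ a b c d → a ⊕ b ⊕ (c ⊕ d) ≡ a ⊕ c ⊕ (b ⊕ d)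
  lemma = solve-∀ 𝔾-ring

∑-⊗ˡ : ∀ w (f : X → 𝔾) xs → ∑ (λ x → w ⊗ f x) xs ≡ w ⊗ ∑ f xs
∑-⊗ˡ w f []       = sym (lemma w)
  where
  lemma : ∀ w → w ⊗ 0𝔾 ≡ 0𝔾
  lemma = solve-∀ 𝔾-ring
∑-⊗ˡ w f (x ∷ xs) = trans (cong (w ⊗ f x ⊕_) (∑-⊗ˡ w f xs)) (lemma w (f x) (∑ f xs))
  where
  lemma : ∀ a b c → a ⊗ b ⊕ a ⊗ c ≡ a ⊗ (b ⊕ c)
  lemma = solve-∀ 𝔾-ring

∑-↭ : ∀ (f : X → 𝔾) {xs ys} → xs ↭ ys → ∑ f xs ≡ ∑ f ys
∑-↭ f Perm.refl          = refl
∑-↭ f (Perm.prep x p)    = cong (f x ⊕_) (∑-↭ f p)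
∑-↭ f (Perm.swap {xs} {ys} x y p) =
  trans (cong (λ w → f x ⊕ (f y ⊕ w)) (∑-↭ f p)) (lemma (f x) (f y) (∑ f ys))
  where
  lemma : ∀ u v w → u ⊕ (v ⊕ w) ≡ v ⊕ (u ⊕ w)
  lemma = solve-∀ 𝔾-ring
∑-↭ f (Perm.trans p q)   = trans (∑-↭ f p) (∑-↭ f q)

∑-≼ : ∀ {f : X → 𝔾} {b} → (∀ x → f x ≼ b) → ∀ xs → ∑ f xs ≼ toℚ (length xs) * b
∑-≼ {f = f} {b} f≼b []       = subst (0𝔾 ≼_) (sym (*-zeroˡ b)) 0𝔾≼0
∑-≼ {f = f} {b} f≼b (x ∷ xs) = subst (f x ⊕ ∑ f xs ≼_)
  (trans (lemma b (toℚ (length xs))) (cong (_* b) (sym (toℚ-suc (length xs)))))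
  (≼-⊕ (f≼b x) (∑-≼ f≼b xs))
  where
  lemma : ∀ b n → b + n * b ≡ (1ℚ + n) * b
  lemma = solve-∀ ℚ-ring

∑-≼-length : ∀ {f : X → 𝔾} → (∀ x → f x ≼ 1ℚ) → ∀ xs → ∑ f xs ≼ toℚ (length xs)
∑-≼-length f≼1 xs = subst (∑ _ xs ≼_) (*-identityʳ (toℚ (length xs))) (∑-≼ f≼1 xs)

∈-drop-mid : ∀ {v y : X} as {bs} → y ≢ v → v ∈ as ++ y ∷ bs → v ∈ as ++ bs
∈-drop-mid {y = y} as {bs} y≢v v∈ with ∈-resp-↭ (shift y as bs) v∈
... | here refl = contradiction refl y≢v
... | there v∈′ = v∈′

-- Gives a complement `zs` as a multiset, so that sums over `xs` and `ys` differ by a sum whose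
-- length is known.
⊆⇒↭-++ : ∀ {xs ys : List X} → Unique ys → ys ⊆ xs → ∃ λ zs → xs ↭ ys ++ zs
⊆⇒↭-++ {xs = xs} {[]}     _ _ = xs , ↭-refl
⊆⇒↭-++ {xs = xs} {y ∷ ys} (y∉ys AllPairs.∷ ys!) y∷ys⊆xs
  with as , bs , refl ← ∈-∃++ (y∷ys⊆xs (here refl))
  with zs , p ← ⊆⇒↭-++ {xs = as ++ bs} ys! (λ v∈ → ∈-drop-mid as (All.lookup y∉ys v∈) (y∷ys⊆xs (there v∈)))
  = zs , ↭-trans (shift y as bs) (prep y p)

-- One entry for each pair of positions i ≤ j, repetitions kept: the excess over `sumset` measures
-- the failure to be Sidon.
pairSums : List ℕ → List ℕ
pairSums []       = []
pairSums (x ∷ xs) = map (x ℕ.+_) (x ∷ xs) ++ pairSums xs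

∈-pairSums : ∀ {a b} xs → a ∈ xs → b ∈ xs → a ℕ.+ b ∈ pairSums xs
∈-pairSums         (x ∷ xs) (here refl) b∈          = ∈-++⁺ˡ (∈-map⁺ (x ℕ.+_) b∈)
∈-pairSums {a}     (x ∷ xs) a∈          (here refl) =
  subst (_∈ pairSums (x ∷ xs)) (ℕ.+-comm x a) (∈-++⁺ˡ (∈-map⁺ (x ℕ.+_) a∈))
∈-pairSums         (x ∷ xs) (there a∈)  (there b∈)  = ∈-++⁺ʳ (map (x ℕ.+_) (x ∷ xs)) (∈-pairSums xs a∈ b∈)

length-pairSums : ∀ xs → toℚ 2 * toℚ (length (pairSums xs)) ≡ toℚ (length xs) * toℚ (length xs) + toℚ (length xs)
length-pairSums []       = refl
length-pairSums (x ∷ xs) = begin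
  toℚ 2 * toℚ (length (map (x ℕ.+_) (x ∷ xs) ++ pairSums xs))
    ≡⟨ cong (λ l → toℚ 2 * toℚ l) (trans (length-++ (map (x ℕ.+_) (x ∷ xs))) (cong (ℕ._+ length (pairSums xs)) (length-map (x ℕ.+_) (x ∷ xs)))) ⟩
  toℚ 2 * toℚ (suc n ℕ.+ length (pairSums xs))
    ≡⟨ cong (toℚ 2 *_) (trans (toℚ-+ (suc n) (length (pairSums xs))) (cong (_+ toℚ (length (pairSums xs))) (toℚ-suc n))) ⟩
  toℚ 2 * (1ℚ + toℚ n + toℚ (length (pairSums xs)))
    ≡⟨ *-distribˡ-+ (toℚ 2) (1ℚ + toℚ n) (toℚ (length (pairSums xs))) ⟩
  toℚ 2 * (1ℚ + toℚ n) + toℚ 2 * toℚ (length (pairSums xs))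
    ≡⟨ cong (toℚ 2 * (1ℚ + toℚ n) +_) (length-pairSums xs) ⟩
  toℚ 2 * (1ℚ + toℚ n) + (toℚ n * toℚ n + toℚ n)
    ≡⟨ lemma (toℚ n) ⟩
  (1ℚ + toℚ n) * (1ℚ + toℚ n) + (1ℚ + toℚ n)
    ≡⟨ cong (λ s → s * s + s) (toℚ-suc n) ⟨
  toℚ (suc n) * toℚ (suc n) + toℚ (suc n)
    ∎
  where
  open ≡-Reasoning
  n = length xs
  lemma : ∀ n → toℚ 2 * (1ℚ + n) + (n * n + n) ≡ (1ℚ + n) * (1ℚ + n) + (1ℚ + n)
  lemma = solve-∀ ℚ-ring

-- Ordered pairs count each off-diagonal sum twice and each diagonal sum once, whereas doubling
-- `pairSums` counts the diagonal twice.
∑-pairSums : ∀ (f : ℕ → 𝔾) xs →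
  ∑ (λ a → ∑ (λ b → f (a ℕ.+ b)) xs) xs ≡ real (toℚ 2) ⊗ ∑ f (pairSums xs) ⊖ ∑ (λ a → f (a ℕ.+ a)) xs
∑-pairSums f []       = refl
∑-pairSums f (x ∷ xs) = begin
  f (x ℕ.+ x) ⊕ r ⊕ ∑ (λ a → f (a ℕ.+ x) ⊕ ∑ (λ b → f (a ℕ.+ b)) xs) xs
    ≡⟨ cong (f (x ℕ.+ x) ⊕ r ⊕_) (∑-⊕ (λ a → f (a ℕ.+ x)) (λ a → ∑ (λ b → f (a ℕ.+ b)) xs) xs) ⟩
  f (x ℕ.+ x) ⊕ r ⊕ (∑ (λ a → f (a ℕ.+ x)) xs ⊕ ∑ (λ a → ∑ (λ b → f (a ℕ.+ b)) xs) xs)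
    ≡⟨ cong₂ (λ u v → f (x ℕ.+ x) ⊕ r ⊕ (u ⊕ v)) (∑-cong (λ a → cong f (ℕ.+-comm a x)) xs) (∑-pairSums f xs) ⟩
  f (x ℕ.+ x) ⊕ r ⊕ (r ⊕ (real (toℚ 2) ⊗ ∑ f (pairSums xs) ⊖ ∑ (λ a → f (a ℕ.+ a)) xs))
    ≡⟨ lemma (f (x ℕ.+ x)) r (∑ f (pairSums xs)) (∑ (λ a → f (a ℕ.+ a)) xs) ⟩
  real (toℚ 2) ⊗ (f (x ℕ.+ x) ⊕ r ⊕ ∑ f (pairSums xs)) ⊖ (f (x ℕ.+ x) ⊕ ∑ (λ a → f (a ℕ.+ a)) xs)
    ≡⟨ cong (λ u → real (toℚ 2) ⊗ u ⊖ (f (x ℕ.+ x) ⊕ ∑ (λ a → f (a ℕ.+ a)) xs)) row ⟨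
  real (toℚ 2) ⊗ ∑ f (pairSums (x ∷ xs)) ⊖ (f (x ℕ.+ x) ⊕ ∑ (λ a → f (a ℕ.+ a)) xs)
    ∎
  where
  open ≡-Reasoning
  r = ∑ (λ b → f (x ℕ.+ b)) xs
  row : ∑ f (pairSums (x ∷ xs)) ≡ f (x ℕ.+ x) ⊕ r ⊕ ∑ f (pairSums xs)
  row = trans (∑-++ f (map (x ℕ.+_) (x ∷ xs)) (pairSums xs)) (cong (_⊕ ∑ f (pairSums xs)) (∑-map f (x ℕ.+_) (x ∷ xs)))
  lemma : ∀ d r p e → d ⊕ r ⊕ (r ⊕ (real (toℚ 2) ⊗ p ⊖ e)) ≡ real (toℚ 2) ⊗ (d ⊕ r ⊕ p) ⊖ (d ⊕ e)
  lemma = solve-∀ 𝔾-ring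

∈-sumset⁻ : ∀ A {s} → s ∈ sumset A → ∃₂ λ a b → a ∈ A × b ∈ A × s ≡ a ℕ.+ b
∈-sumset⁻ A s∈
  with a , a∈ , s∈a ← find (∈-concatMap⁻ (λ a → map (a ℕ.+_) A) {xs = A} (∈-deduplicate⁻ ℕ._≟_ (concatMap (λ a → map (a ℕ.+_) A) A) s∈))
  with b , b∈ , refl ← ∈-map⁻ (a ℕ.+_) s∈a = a , b , a∈ , b∈ , refl

sumset-⊆-pairSums : ∀ A → sumset A ⊆ pairSums A
sumset-⊆-pairSums A s∈ with a , b , a∈ , b∈ , refl ← ∈-sumset⁻ A s∈ = ∈-pairSums A a∈ b∈

sumset-⊆-downFrom : ∀ A {R} → (∀ {a b} → a ∈ A → b ∈ A → a ℕ.+ b ℕ.< R) → sumset A ⊆ downFrom R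
sumset-⊆-downFrom A <R s∈ with a , b , a∈ , b∈ , refl ← ∈-sumset⁻ A s∈ = ∈-downFrom⁺ (<R a∈ b∈)

toℚ-length-++ : ∀ {xs ys zs : List X} → xs ↭ ys ++ zs → toℚ (length xs) ≡ toℚ (length ys) + toℚ (length zs)
toℚ-length-++ {ys = ys} {zs} p = trans (cong toℚ (trans (↭-length p) (length-++ ys))) (toℚ-+ (length ys) (length zs))

-- Both the pair sums and [0, R) are the sumset plus a remainder, and only the remainders contribute to the error.
double-sum-≼ : ∀ (f : ℕ → 𝔾) → (∀ s → f s ≼ 1ℚ) → ∀ A R → (∀ {a b} → a ∈ A → b ∈ A → a ℕ.+ b ℕ.< R) →
  ∑ (λ a → ∑ (λ b → f (a ℕ.+ b)) A) A ⊖ real (toℚ 2) ⊗ ∑ f (downFrom R)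
    ≼ toℚ 2 * toℚ R - toℚ 4 * toℚ (sumsetCard A) + toℚ (length A) * toℚ (length A) + toℚ 2 * toℚ (length A)
double-sum-≼ f f≼1 A R <R
  with W , p ← ⊆⇒↭-++ (deduplicate-! _) (sumset-⊆-pairSums A)
  with Z , q ← ⊆⇒↭-++ (deduplicate-! _) (sumset-⊆-downFrom A <R) =
  subst₂ _≼_ (sym main) bound
    (≼-⊖ (≼-⊖ (≼-⊗ (≼-real (0≤toℚ 2)) (∑-≼-length f≼1 W)) (∑-≼-length (λ a → f≼1 (a ℕ.+ a)) A))
         (≼-⊗ (≼-real (0≤toℚ 2)) (∑-≼-length f≼1 Z)))
  where
  open ≡-Reasoning
  D = ∑ (λ a → f (a ℕ.+ a)) A
  main : ∑ (λ a → ∑ (λ b → f (a ℕ.+ b)) A) A ⊖ real (toℚ 2) ⊗ ∑ f (downFrom R) ≡ real (toℚ 2) ⊗ ∑ f W ⊖ D ⊖ real (toℚ 2) ⊗ ∑ f Z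
  main = begin
    ∑ (λ a → ∑ (λ b → f (a ℕ.+ b)) A) A ⊖ real (toℚ 2) ⊗ ∑ f (downFrom R)
      ≡⟨ cong₂ (λ u v → u ⊖ real (toℚ 2) ⊗ v) (∑-pairSums f A) (trans (∑-↭ f q) (∑-++ f (sumset A) Z)) ⟩
    real (toℚ 2) ⊗ ∑ f (pairSums A) ⊖ D ⊖ real (toℚ 2) ⊗ (∑ f (sumset A) ⊕ ∑ f Z)
      ≡⟨ cong (λ u → real (toℚ 2) ⊗ u ⊖ D ⊖ real (toℚ 2) ⊗ (∑ f (sumset A) ⊕ ∑ f Z)) (trans (∑-↭ f p) (∑-++ f (sumset A) W)) ⟩
    real (toℚ 2) ⊗ (∑ f (sumset A) ⊕ ∑ f W) ⊖ D ⊖ real (toℚ 2) ⊗ (∑ f (sumset A) ⊕ ∑ f Z)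
      ≡⟨ lemma (∑ f (sumset A)) (∑ f W) (∑ f Z) D ⟩
    real (toℚ 2) ⊗ ∑ f W ⊖ D ⊖ real (toℚ 2) ⊗ ∑ f Z
      ∎
    where
    lemma : ∀ s w z d → real (toℚ 2) ⊗ (s ⊕ w) ⊖ d ⊖ real (toℚ 2) ⊗ (s ⊕ z) ≡ real (toℚ 2) ⊗ w ⊖ d ⊖ real (toℚ 2) ⊗ z
    lemma = solve-∀ 𝔾-ring
  -- With σ = ∣A+A∣, `W` has (k² + k)/2 - σ entries and `Z` has R - σ. For σ ≈ k²/2 and R ≈ 2n the
  -- total is about 4n - k².
  bound : toℚ 2 * toℚ (length W) + toℚ (length A) + toℚ 2 * toℚ (length Z)
        ≡ toℚ 2 * toℚ R - toℚ 4 * toℚ (sumsetCard A) + toℚ (length A) * toℚ (length A) + toℚ 2 * toℚ (length A)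
  bound = begin
    toℚ 2 * w + k + toℚ 2 * z
      ≡⟨ lemma₁ w z k σ ⟩
    toℚ 2 * (σ + z) - toℚ 4 * σ + toℚ 2 * (σ + w) + k
      ≡⟨ cong₂ (λ r u → toℚ 2 * r - toℚ 4 * σ + toℚ 2 * u + k) (trans (cong toℚ (sym (length-downFrom R))) (toℚ-length-++ {ys = sumset A} q)) (toℚ-length-++ {ys = sumset A} p) ⟨
    toℚ 2 * toℚ R - toℚ 4 * σ + toℚ 2 * toℚ (length (pairSums A)) + k
      ≡⟨ cong (λ u → toℚ 2 * toℚ R - toℚ 4 * σ + u + k) (length-pairSums A) ⟩
    toℚ 2 * toℚ R - toℚ 4 * σ + (k * k + k) + k
      ≡⟨ lemma₂ (toℚ R) σ k ⟩
    toℚ 2 * toℚ R - toℚ 4 * σ + k * k + toℚ 2 * k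
      ∎
    where
    w = toℚ (length W)
    z = toℚ (length Z)
    k = toℚ (length A)
    σ = toℚ (sumsetCard A)
    lemma₁ : ∀ w z k σ → toℚ 2 * w + k + toℚ 2 * z ≡ toℚ 2 * (σ + z) - toℚ 4 * σ + toℚ 2 * (σ + w) + k
    lemma₁ = solve-∀ ℚ-ring
    lemma₂ : ∀ R σ k → toℚ 2 * R - toℚ 4 * σ + (k * k + k) + k ≡ toℚ 2 * R - toℚ 4 * σ + k * k + toℚ 2 * k
    lemma₂ = solve-∀ ℚ-ring

∑-cong-< : ∀ {f g : ℕ → 𝔾} n → (∀ {i} → i ℕ.< n → f i ≡ g i) → ∑ f (downFrom n) ≡ ∑ g (downFrom n)
∑-cong-< zero    f≗g = refl
∑-cong-< (suc n) f≗g = cong₂ _⊕_ (f≗g ℕ.≤-refl) (∑-cong-< n (λ i<n → f≗g (ℕ.m<n⇒m<1+n i<n)))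

∑-const : ∀ w (xs : List X) → ∑ (λ _ → w) xs ≡ real (toℚ (length xs)) ⊗ w
∑-const w []       = sym (lemma w)
  where
  lemma : ∀ w → 0𝔾 ⊗ w ≡ 0𝔾
  lemma = solve-∀ 𝔾-ring
∑-const w (x ∷ xs) = trans (cong (w ⊕_) (∑-const w xs))
  (trans (lemma w (real (toℚ (length xs)))) (cong (λ r → real r ⊗ w) (sym (toℚ-suc (length xs)))))
  where
  lemma : ∀ w r → w ⊕ r ⊗ w ≡ (1𝔾 ⊕ r) ⊗ w
  lemma = solve-∀ 𝔾-ring

∑-downFrom-+ : ∀ (f : ℕ → 𝔾) p q → ∑ f (downFrom (p ℕ.+ q)) ≡ ∑ (λ i → f (i ℕ.+ q)) (downFrom p) ⊕ ∑ f (downFrom q)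
∑-downFrom-+ f zero    q = sym (lemma (∑ f (downFrom q)))
  where
  lemma : ∀ w → 0𝔾 ⊕ w ≡ w
  lemma = solve-∀ 𝔾-ring
∑-downFrom-+ f (suc p) q = trans (cong (f (p ℕ.+ q) ⊕_) (∑-downFrom-+ f p q))
  (lemma (f (p ℕ.+ q)) (∑ (λ i → f (i ℕ.+ q)) (downFrom p)) (∑ f (downFrom q)))
  where
  lemma : ∀ u v w → u ⊕ (v ⊕ w) ≡ u ⊕ v ⊕ w
  lemma = solve-∀ 𝔾-ring

∑-⊗-∑ : ∀ (f g : X → 𝔾) xs ys → ∑ f xs ⊗ ∑ g ys ≡ ∑ (λ x → ∑ (λ y → f x ⊗ g y) ys) xs
∑-⊗-∑ f g []       ys = lemma (∑ g ys)
  where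
  lemma : ∀ w → 0𝔾 ⊗ w ≡ 0𝔾
  lemma = solve-∀ 𝔾-ring
∑-⊗-∑ f g (x ∷ xs) ys = trans (lemma (f x) (∑ f xs) (∑ g ys))
  (cong₂ _⊕_ (sym (∑-⊗ˡ (f x) g ys)) (∑-⊗-∑ f g xs ys))
  where
  lemma : ∀ u v w → (u ⊕ v) ⊗ w ≡ u ⊗ w ⊕ v ⊗ w
  lemma = solve-∀ 𝔾-ring

∑-⊖-≼ : ∀ {f g : X → 𝔾} {b} → (∀ x → f x ⊖ g x ≼ b) → ∀ xs → ∑ f xs ⊖ ∑ g xs ≼ toℚ (length xs) * b
∑-⊖-≼ {f = f} {g} {b} f-g≼b xs = subst (_≼ toℚ (length xs) * b) eq (∑-≼ f-g≼b xs)
  where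
  open ≡-Reasoning
  lemma₁ : ∀ w → ⊝ w ≡ ⊝ 1𝔾 ⊗ w
  lemma₁ = solve-∀ 𝔾-ring
  lemma₂ : ∀ v w → v ⊕ ⊝ 1𝔾 ⊗ w ≡ v ⊖ w
  lemma₂ = solve-∀ 𝔾-ring
  eq : ∑ (λ x → f x ⊖ g x) xs ≡ ∑ f xs ⊖ ∑ g xs
  eq = begin
    ∑ (λ x → f x ⊖ g x) xs              ≡⟨ ∑-cong (λ x → cong (f x ⊕_) (lemma₁ (g x))) xs ⟩
    ∑ (λ x → f x ⊕ ⊝ 1𝔾 ⊗ g x) xs       ≡⟨ ∑-⊕ f (λ x → ⊝ 1𝔾 ⊗ g x) xs ⟩
    ∑ f xs ⊕ ∑ (λ x → ⊝ 1𝔾 ⊗ g x) xs    ≡⟨ cong (∑ f xs ⊕_) (∑-⊗ˡ (⊝ 1𝔾) g xs) ⟩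
    ∑ f xs ⊕ ⊝ 1𝔾 ⊗ ∑ g xs              ≡⟨ lemma₂ (∑ f xs) (∑ g xs) ⟩
    ∑ f xs ⊖ ∑ g xs                     ∎

-- Character sums over blocks of length m

module Blocks (m : ℕ) .{{_ : ℕ.NonZero m}} where

  block : ℕ → ℕ
  block a = a ℕ./ m

  block-shift : ∀ {r} → r ℕ.< m → ∀ q → block (r ℕ.+ q ℕ.* m) ≡ q
  block-shift {r} r<m q = begin
    block (r ℕ.+ q ℕ.* m)            ≡⟨ +-distrib-/-∣ʳ r (n∣m*n q) ⟩
    block r ℕ.+ block (q ℕ.* m)      ≡⟨ cong₂ ℕ._+_ (m<n⇒m/n≡0 r<m) (m*n/n≡m q m) ⟩
    q                                ∎
    where open ≡-Reasoning

  -- A carry moves a sum into the next block, so blocks are additive only up to one step.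
  block-+ : ∀ a b → block (a ℕ.+ b) ≡ block a ℕ.+ block b ⊎ block (a ℕ.+ b) ≡ suc (block a ℕ.+ block b)
  block-+ a b = [ (λ r<m → inj₁ (begin
      block (a ℕ.+ b)             ≡⟨ cong block split ⟩
      block (r ℕ.+ q ℕ.* m)       ≡⟨ block-shift r<m q ⟩
      q                           ∎))
    , (λ m≤r → inj₂ (begin
      block (a ℕ.+ b)                        ≡⟨ cong block (trans split (carry m≤r)) ⟩
      block ((r ℕ.∸ m) ℕ.+ suc q ℕ.* m)      ≡⟨ block-shift (r-m<m m≤r) (suc q) ⟩
      suc q                                  ∎)) ]′ (ℕ.<-≤-connex r m)
    where
    open ≡-Reasoning
    r = a ℕ.% m ℕ.+ b ℕ.% m
    q = block a ℕ.+ block b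
    rearrange : ∀ r₁ r₂ q₁ q₂ m → (r₁ ℕ.+ q₁ ℕ.* m) ℕ.+ (r₂ ℕ.+ q₂ ℕ.* m) ≡ (r₁ ℕ.+ r₂) ℕ.+ (q₁ ℕ.+ q₂) ℕ.* m
    rearrange = ℕ-solve-∀
    split : a ℕ.+ b ≡ r ℕ.+ q ℕ.* m
    split = trans (cong₂ ℕ._+_ (m≡m%n+[m/n]*n a m) (m≡m%n+[m/n]*n b m)) (rearrange (a ℕ.% m) (b ℕ.% m) (block a) (block b) m)
    carry : m ℕ.≤ r → r ℕ.+ q ℕ.* m ≡ (r ℕ.∸ m) ℕ.+ suc q ℕ.* m
    carry m≤r = trans (cong (ℕ._+ q ℕ.* m) (sym (ℕ.m∸n+n≡m m≤r))) (ℕ.+-assoc (r ℕ.∸ m) m (q ℕ.* m))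
    r-m<m : m ℕ.≤ r → r ℕ.∸ m ℕ.< m
    r-m<m m≤r = ℕ.+-cancelʳ-< m (r ℕ.∸ m) m
      (subst (ℕ._< m ℕ.+ m) (sym (ℕ.m∸n+n≡m m≤r)) (ℕ.+-mono-< (m%n<n a m) (m%n<n b m)))

  ∑-blocks : ∀ (f : ℕ → 𝔾) L → ∑ (λ s → f (block s)) (downFrom (L ℕ.* m)) ≡ real (toℚ m) ⊗ ∑ f (downFrom L)
  ∑-blocks f zero    = sym (lemma (real (toℚ m)))
    where
    lemma : ∀ w → w ⊗ 0𝔾 ≡ 0𝔾
    lemma = solve-∀ 𝔾-ring
  ∑-blocks f (suc L) = begin
    ∑ (λ s → f (block s)) (downFrom (m ℕ.+ L ℕ.* m))
      ≡⟨ ∑-downFrom-+ (λ s → f (block s)) m (L ℕ.* m) ⟩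
    ∑ (λ i → f (block (i ℕ.+ L ℕ.* m))) (downFrom m) ⊕ ∑ (λ s → f (block s)) (downFrom (L ℕ.* m))
      ≡⟨ cong₂ _⊕_ (∑-cong-< m (λ i<m → cong f (block-shift i<m L))) (∑-blocks f L) ⟩
    ∑ (λ _ → f L) (downFrom m) ⊕ real (toℚ m) ⊗ ∑ f (downFrom L)
      ≡⟨ cong (_⊕ real (toℚ m) ⊗ ∑ f (downFrom L)) (trans (∑-const (f L) (downFrom m)) (cong (λ l → real (toℚ l) ⊗ f L) (length-downFrom m))) ⟩
    real (toℚ m) ⊗ f L ⊕ real (toℚ m) ⊗ ∑ f (downFrom L)
      ≡⟨ lemma (real (toℚ m)) (f L) (∑ f (downFrom L)) ⟩
    real (toℚ m) ⊗ (f L ⊕ ∑ f (downFrom L))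
      ∎
    where
    open ≡-Reasoning
    lemma : ∀ u v w → u ⊗ v ⊕ u ⊗ w ≡ u ⊗ (v ⊕ w)
    lemma = solve-∀ 𝔾-ring

  -- Without a carry the difference vanishes; with one it is -v^q (v - 1), where q is the sum of the
  -- two block indices.
  block-character : ∀ {v δ} → Unit v → v ⊖ 1𝔾 ≼ δ → ∀ a b → v ^ block a ⊗ v ^ block b ⊖ v ^ block (a ℕ.+ b) ≼ δ
  block-character {v} {δ} u v-1≼δ a b with block-+ a b
  ... | inj₁ eq = subst (_≼ δ) (sym (trans (cong₂ _⊖_ (sym (^-homo-* v (block a) (block b))) (cong (v ^_) eq)) (lemma (v ^ (block a ℕ.+ block b)))))
                    (≼-weaken 0𝔾≼0 (0≤bound v-1≼δ))
    where
    lemma : ∀ w → w ⊖ w ≡ 0𝔾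
    lemma = solve-∀ 𝔾-ring
  ... | inj₂ eq = subst₂ _≼_ (trans (lemma v w) (sym (cong₂ _⊖_ (sym (^-homo-* v (block a) (block b))) (cong (v ^_) eq)))) (*-identityˡ δ)
                    (≼-⊗ (≼-⊝ (unit-≼ (unit-^ u (block a ℕ.+ block b)))) v-1≼δ)
    where
    w = v ^ (block a ℕ.+ block b)
    lemma : ∀ v w → ⊝ w ⊗ (v ⊖ 1𝔾) ≡ w ⊖ v ⊗ w
    lemma = solve-∀ 𝔾-ring

  -- Three errors add up: carries over the k² pairs, the multiset remainders of `double-sum-≼`, and
  -- the nearly vanishing sum of the character over the whole interval, which is m times a geometric
  -- sum.
  square-sum-≼ : ∀ {v δ τ} → Unit v → v ⊖ 1𝔾 ≼ δ → ∀ L → ∑ (v ^_) (downFrom L) ≼ τ →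
    ∀ A → (∀ {a b} → a ∈ A → b ∈ A → a ℕ.+ b ℕ.< L ℕ.* m) →
    ∑ (λ a → v ^ block a) A ⊗ ∑ (λ a → v ^ block a) A
      ≼ toℚ (length A) * (toℚ (length A) * δ)
        + (toℚ 2 * toℚ (L ℕ.* m) - toℚ 4 * toℚ (sumsetCard A) + toℚ (length A) * toℚ (length A) + toℚ 2 * toℚ (length A))
        + toℚ 2 * (toℚ m * τ)
  square-sum-≼ {v} {δ} {τ} u v-1≼δ L T≼τ A <R = subst (_≼ _) eq
    (≼-⊕ (≼-⊕ (∑-⊖-≼ (λ a → ∑-⊖-≼ (block-character u v-1≼δ a) A) A)
              (double-sum-≼ ζ (λ s → unit-≼ (unit-^ u (block s))) A (L ℕ.* m) <R))
         (≼-⊗ (≼-real (0≤toℚ 2)) (subst (_≼ _) (sym (∑-blocks (v ^_) L)) (≼-⊗ (≼-real (0≤toℚ m)) T≼τ))))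
    where
    ζ : ℕ → 𝔾
    ζ s = v ^ block s
    lemma : ∀ p q r → p ⊖ q ⊕ (q ⊖ real (toℚ 2) ⊗ r) ⊕ real (toℚ 2) ⊗ r ≡ p
    lemma = solve-∀ 𝔾-ring
    eq : ∑ (λ a → ∑ (λ b → ζ a ⊗ ζ b) A) A ⊖ ∑ (λ a → ∑ (λ b → ζ (a ℕ.+ b)) A) A
         ⊕ (∑ (λ a → ∑ (λ b → ζ (a ℕ.+ b)) A) A ⊖ real (toℚ 2) ⊗ ∑ ζ (downFrom (L ℕ.* m)))
         ⊕ real (toℚ 2) ⊗ ∑ ζ (downFrom (L ℕ.* m))
       ≡ ∑ ζ A ⊗ ∑ ζ A
    eq = trans (lemma (∑ (λ a → ∑ (λ b → ζ a ⊗ ζ b) A) A) (∑ (λ a → ∑ (λ b → ζ (a ℕ.+ b)) A) A) (∑ ζ (downFrom (L ℕ.* m))))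
               (sym (∑-⊗-∑ ζ ζ A A))

-- Rotations by a small rational angle

geometric-sum : ∀ v n → (v ⊖ 1𝔾) ⊗ ∑ (v ^_) (downFrom n) ≡ v ^ n ⊖ 1𝔾
geometric-sum v zero    = lemma v
  where
  lemma : ∀ v → (v ⊖ 1𝔾) ⊗ 0𝔾 ≡ 1𝔾 ⊖ 1𝔾
  lemma = solve-∀ 𝔾-ring
geometric-sum v (suc n) = begin
  (v ⊖ 1𝔾) ⊗ (v ^ n ⊕ T)               ≡⟨ lemma₁ v (v ^ n) T ⟩
  (v ⊖ 1𝔾) ⊗ v ^ n ⊕ (v ⊖ 1𝔾) ⊗ T      ≡⟨ cong ((v ⊖ 1𝔾) ⊗ v ^ n ⊕_) (geometric-sum v n) ⟩
  (v ⊖ 1𝔾) ⊗ v ^ n ⊕ (v ^ n ⊖ 1𝔾)      ≡⟨ lemma₂ v (v ^ n) ⟩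
  v ⊗ v ^ n ⊖ 1𝔾                       ∎
  where
  open ≡-Reasoning
  T = ∑ (v ^_) (downFrom n)
  lemma₁ : ∀ v w t → (v ⊖ 1𝔾) ⊗ (w ⊕ t) ≡ (v ⊖ 1𝔾) ⊗ w ⊕ (v ⊖ 1𝔾) ⊗ t
  lemma₁ = solve-∀ 𝔾-ring
  lemma₂ : ∀ v w → (v ⊖ 1𝔾) ⊗ w ⊕ (w ⊖ 1𝔾) ≡ v ⊗ w ⊖ 1𝔾
  lemma₂ = solve-∀ 𝔾-ring

-- Division by v: ∣v∣ ≥ im v ≥ a. A lower bound on the imaginary part is what `S-lower` provides.
≼-cancel : ∀ {v w a b} → 0ℚ < a → 0ℚ ≤ b → a ≤ im v → v ⊗ w ≼ a * b → w ≼ b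
≼-cancel {v} {w} {a} {b} 0<a 0≤b a≤im v⊗w≼ab = bounded 0≤b (*-cancelˡ-≤ (0<* 0<a 0<a) (begin
  a * a * ∥ w ∥²               ≤⟨ *-monoʳ-≤-nonNeg ∥ w ∥² {{nonNegative (0≤∥∥² w)}} a²≤ ⟩
  ∥ v ∥² * ∥ w ∥²              ≡⟨ ∥∥²-⊗ v w ⟨
  ∥ v ⊗ w ∥²                   ≤⟨ norm≤ v⊗w≼ab ⟩
  a * b * (a * b)              ≡⟨ lemma₁ a b ⟩
  a * a * (b * b)              ∎))
  where
  open ≤-Reasoning
  lemma₁ : ∀ a b → a * b * (a * b) ≡ a * a * (b * b)
  lemma₁ = solve-∀ ℚ-ring
  lemma₂ : ∀ x y a → x * x + ((y - a) * a + y * (y - a)) ≡ x * x + y * y - a * a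
  lemma₂ = solve-∀ ℚ-ring
  0≤a = <⇒≤ 0<a
  a²≤ : a * a ≤ ∥ v ∥²
  a²≤ = cert (0≤+ (0≤sq (re v)) (0≤+ (0≤* (diff a≤im) 0≤a) (0≤* (≤-trans 0≤a a≤im) (diff a≤im)))) (lemma₂ (re v) (im v) a)

infix 20 _·≤_
_·≤_ : ∀ n {p} → 0ℚ ≤ p → 0ℚ ≤ toℚ n * p
n ·≤ 0≤p = 0≤* (0≤toℚ n) 0≤p

module Rotation (z : 𝔾) (z-unit : Unit z) (0≤c : 0ℚ ≤ re z) (0<s : 0ℚ < im z) (8s≤1 : toℚ 8 * im z ≤ 1ℚ) where

  c s : ℚ
  c = re z
  s = im z

  C S : ℕ → ℚ
  C l = re (z ^ l)
  S l = im (z ^ l)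

  z^-unit : ∀ l → Unit (z ^ l)
  z^-unit = unit-^ z-unit

  0≤s : 0ℚ ≤ s
  0≤s = <⇒≤ 0<s

  c≤1 : c ≤ 1ℚ
  c≤1 = re≤ (unit-≼ z-unit)

  unit-≤ : ∀ {w} → Unit w → 0ℚ ≤ re w * re w + im w * im w - 1ℚ
  unit-≤ u = diff (≤-reflexive (sym (norm≡1 u)))

  unit-≥ : ∀ {w} → Unit w → 0ℚ ≤ 1ℚ - (re w * re w + im w * im w)
  unit-≥ u = diff (≤-reflexive (norm≡1 u))

  -- s² = (1 - c)(1 + c) and 1 + c ≥ 1.
  1-c≤s² : 1ℚ - c ≤ s * s
  1-c≤s² = cert (0≤+ (0≤* 0≤c (diff c≤1)) (unit-≤ z-unit)) (lemma c s)
    where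
    lemma : ∀ c s → c * (1ℚ - c) + (c * c + s * s - 1ℚ) ≡ s * s - (1ℚ - c)
    lemma = solve-∀ ℚ-ring

  8s²≤s : toℚ 8 * (s * s) ≤ s
  8s²≤s = cert (0≤* 0≤s (diff 8s≤1)) (lemma s)
    where
    lemma : ∀ s → s * (1ℚ - toℚ 8 * s) ≡ s - toℚ 8 * (s * s)
    lemma = solve-∀ ℚ-ring

  1≤2c : 1ℚ ≤ toℚ 2 * c
  1≤2c = *-cancelˡ-≤ (0<toℚ 31) (cert
    (0≤+ (0≤+ (0≤+ (64 ·≤ diff 1-c≤s²) (8 ·≤ diff 8s²≤s)) (diff 8s≤1)) (0≤toℚ 31)) (lemma c s))
    where
    lemma : ∀ c s → toℚ 64 * (s * s - (1ℚ - c)) + toℚ 8 * (s - toℚ 8 * (s * s)) + (1ℚ - toℚ 8 * s) + toℚ 31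
          ≡ toℚ 32 * (toℚ 2 * c) - toℚ 32 * 1ℚ
    lemma = solve-∀ ℚ-ring

  z-1≼2s : z ⊖ 1𝔾 ≼ toℚ 2 * s
  z-1≼2s = bounded (0≤* (0≤toℚ 2) 0≤s) (cert (0≤+ (0≤+ (2 ·≤ diff 1-c≤s²) (2 ·≤ 0≤sq s)) (unit-≥ z-unit)) (lemma c s))
    where
    lemma : ∀ c s → toℚ 2 * (s * s - (1ℚ - c)) + toℚ 2 * (s * s) + (1ℚ - (c * c + s * s))
          ≡ toℚ 2 * s * (toℚ 2 * s) - ((c + - 1ℚ) * (c + - 1ℚ) + (s + - 0ℚ) * (s + - 0ℚ))
    lemma = solve-∀ ℚ-ring

  z^-near-1 : ∀ m → z ^ m ⊖ 1𝔾 ≼ toℚ m * (toℚ 2 * s)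
  z^-near-1 = ^-near-1 (unit-≼ z-unit) z-1≼2s

  -- 1 + ims, the first-order approximation of z^m
  tangent : ℕ → 𝔾
  tangent m = 1ℚ +i (toℚ m * s)

  tangent-form : ∀ r → 1ℚ +i (r * s) ≡ 1𝔾 ⊕ 𝕚 ⊗ (real r ⊗ real s)
  tangent-form r = cong₂ _+i_ (re-eq r s) (im-eq r s)
    where
    re-eq : ∀ r s → 1ℚ ≡ 1ℚ + (0ℚ * (r * s - 0ℚ * 0ℚ) - 1ℚ * (r * 0ℚ + 0ℚ * s))
    re-eq = solve-∀ ℚ-ring
    im-eq : ∀ r s → r * s ≡ 0ℚ + (0ℚ * (r * 0ℚ + 0ℚ * s) + 1ℚ * (r * s - 0ℚ * 0ℚ))
    im-eq = solve-∀ ℚ-ring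

  tangent-suc : ∀ m → tangent (suc m) ≡ 1𝔾 ⊕ 𝕚 ⊗ (real (1ℚ + toℚ m) ⊗ real s)
  tangent-suc m = trans (cong (λ r → 1ℚ +i (r * s)) (toℚ-suc m)) (tangent-form (1ℚ + toℚ m))

  z-tangent : z ⊖ (1𝔾 ⊕ 𝕚 ⊗ real s) ≼ s * s
  z-tangent = ≼-weaken (subst (_≼ 1ℚ - c) (cong₂ _+i_ (re-eq c s) (im-eq c s)) (≼-⊝ (≼-real (diff c≤1)))) 1-c≤s²
    where
    re-eq : ∀ c s → - (1ℚ - c) ≡ c - (1ℚ + (0ℚ * s - 1ℚ * 0ℚ))
    re-eq = solve-∀ ℚ-ring
    im-eq : ∀ c s → - 0ℚ ≡ s - (0ℚ + (0ℚ * 0ℚ + 1ℚ * s))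
    im-eq = solve-∀ ℚ-ring

  -- The error obeys e(m+1) ≤ e(m) + s² + ms · 2s, the last term coming from ims(z - 1); these
  -- increments sum to m²s².
  z^-tangent : ∀ m → z ^ m ⊖ tangent m ≼ toℚ m * toℚ m * (s * s)
  z^-tangent zero    = subst₂ _≼_ (cong₂ _+i_ refl (im-eq s)) (bound s) 0𝔾≼0
    where
    im-eq : ∀ s → 0ℚ ≡ 0ℚ - 0ℚ * s
    im-eq = solve-∀ ℚ-ring
    bound : ∀ s → 0ℚ ≡ 0ℚ * 0ℚ * (s * s)
    bound = solve-∀ ℚ-ring
  z^-tangent (suc m) = subst₂ _≼_
    (trans (cong (λ w → z ⊗ (z ^ m ⊖ w) ⊕ (z ⊖ (1𝔾 ⊕ 𝕚 ⊗ real s)) ⊕ 𝕚 ⊗ (real (toℚ m) ⊗ real s) ⊗ (z ⊖ 1𝔾)) (tangent-form (toℚ m)))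
      (trans (lemma z (z ^ m) 𝕚 (real (toℚ m)) (real s)) (cong (z ⊗ z ^ m ⊖_) (sym (tangent-suc m)))))
    (trans (bound (toℚ m) s) (cong (λ r → r * r * (s * s)) (sym (toℚ-suc m))))
    (≼-⊕ (≼-⊕ (≼-⊗ (unit-≼ z-unit) (z^-tangent m)) z-tangent)
         (≼-⊗ (≼-⊗ 𝕚≼1 (≼-⊗ (≼-real (0≤toℚ m)) (≼-real 0≤s))) z-1≼2s))
    where
    lemma : ∀ z w i m s → z ⊗ (w ⊖ (1𝔾 ⊕ i ⊗ (m ⊗ s))) ⊕ (z ⊖ (1𝔾 ⊕ i ⊗ s)) ⊕ i ⊗ (m ⊗ s) ⊗ (z ⊖ 1𝔾)
          ≡ z ⊗ w ⊖ (1𝔾 ⊕ i ⊗ ((1𝔾 ⊕ m) ⊗ s))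
    lemma = solve-∀ 𝔾-ring
    bound : ∀ m s → 1ℚ * (m * m * (s * s)) + s * s + 1ℚ * (m * s) * (toℚ 2 * s) ≡ (1ℚ + m) * (1ℚ + m) * (s * s)
    bound = solve-∀ ℚ-ring

  -- The second-order error m²s² is at most half of ms under the hypothesis.
  S-lower : ∀ m → toℚ 2 * (toℚ m * s) ≤ 1ℚ → toℚ m * s ≤ toℚ 2 * S m
  S-lower m 2ms≤1 = cert (0≤+ (2 ·≤ diff (-im≤ (z^-tangent m))) (0≤* (0≤* (0≤toℚ m) 0≤s) (diff 2ms≤1)))
    (lemma (S m) (toℚ m) s)
    where
    lemma : ∀ S m s → toℚ 2 * (m * m * (s * s) - - (S + - (m * s))) + m * s * (1ℚ - toℚ 2 * (m * s)) ≡ toℚ 2 * S - m * s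
    lemma = solve-∀ ℚ-ring

-- The powers of z in the first quadrant

module Quadrant (z : 𝔾) (z-unit : Unit z) (0≤c : 0ℚ ≤ re z) (0<s : 0ℚ < im z) (8s≤1 : toℚ 8 * im z ≤ 1ℚ) where
  open Rotation z z-unit 0≤c 0<s 8s≤1 public

  Positive-upto : ℕ → Set
  Positive-upto n = ∀ i → i ℕ.≤ n → 0ℚ < C i

  C≤1 : ∀ l → C l ≤ 1ℚ
  C≤1 l = re≤ (unit-≼ (z^-unit l))

  S≤1 : ∀ l → S l ≤ 1ℚ
  S≤1 l = im≤ (unit-≼ (z^-unit l))

  0≤S-suc : ∀ l → (∀ i → i ℕ.≤ l → 0ℚ ≤ C i) → 0ℚ ≤ S (suc l)
  0≤S : ∀ l → (∀ i → i ℕ.< l → 0ℚ ≤ C i) → 0ℚ ≤ S l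
  0≤S zero    _   = ≤-refl
  0≤S (suc l) 0≤C = 0≤S-suc l (λ i i≤l → 0≤C i (ℕ.s≤s i≤l))
  0≤S-suc l 0≤C = 0≤+ (0≤* 0≤c (0≤S l (λ i i<l → 0≤C i (ℕ.<⇒≤ i<l)))) (0≤* 0≤s (0≤C l ℕ.≤-refl))

  S-upper : ∀ l → (∀ i → i ℕ.< l → 0ℚ ≤ C i) → S l ≤ toℚ l * s
  S-upper zero    _   = ≤-reflexive (sym (*-zeroˡ s))
  S-upper (suc l) 0≤C = cert
    (0≤+ (0≤+ (diff (S-upper l 0≤C′)) (0≤* (diff c≤1) (0≤S l 0≤C′))) (0≤* 0≤s (diff (C≤1 l))))
    (trans (lemma (toℚ l) s c (C l) (S l)) (cong (λ r → r * s - S (suc l)) (sym (toℚ-suc l))))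
    where
    0≤C′ : ∀ i → i ℕ.< l → 0ℚ ≤ C i
    0≤C′ i i<l = 0≤C i (ℕ.m<n⇒m<1+n i<l)
    lemma : ∀ l s c C S → l * s - S + (1ℚ - c) * S + s * (1ℚ - C) ≡ (1ℚ + l) * s - (c * S + s * C)
    lemma = solve-∀ ℚ-ring

  1≤C+S : ∀ l → 0ℚ ≤ C l → 0ℚ ≤ S l → 1ℚ ≤ C l + S l
  1≤C+S l 0≤C 0≤S = sq-cancel-≤ (0≤+ 0≤C 0≤S)
    (cert (0≤+ (2 ·≤ 0≤* 0≤C 0≤S) (unit-≤ (z^-unit l))) (lemma (C l) (S l)))
    where
    lemma : ∀ C S → toℚ 2 * (C * S) + (C * C + S * S - 1ℚ) ≡ (C + S) * (C + S) - 1ℚ * 1ℚ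
    lemma = solve-∀ ℚ-ring

  -- S − C grows by at least s/2 per step in the first quadrant, where it stays within [−1, 1].
  S-C-grows : ∀ l → (∀ i → i ℕ.≤ l → 0ℚ ≤ C i) → toℚ l * s ≤ toℚ 2 * (S l - C l + 1ℚ)
  S-C-grows zero    _   = ≤-reflexive (lemma s)
    where
    lemma : ∀ s → 0ℚ * s ≡ toℚ 2 * (0ℚ - 1ℚ + 1ℚ)
    lemma = solve-∀ ℚ-ring
  S-C-grows (suc l) 0≤C = cert
    (0≤+ (0≤+ (diff (S-C-grows l 0≤C′))
              (2 ·≤ 0≤+ (0≤* (diff c≤1) (0≤+ (diff (S≤1 l)) 0≤Cl))
                        (0≤* 0≤s (diff (1≤C+S l 0≤Cl (0≤S l (λ i i<l → 0≤C i (ℕ.m≤n⇒m≤1+n (ℕ.<⇒≤ i<l)))))))))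
         (2 ·≤ diff s/2≤))
    (trans (lemma (toℚ l) s c (C l) (S l)) (cong (λ r → toℚ 2 * (S (suc l) - C (suc l) + 1ℚ) - r * s) (sym (toℚ-suc l))))
    where
    0≤C′ : ∀ i → i ℕ.≤ l → 0ℚ ≤ C i
    0≤C′ i i≤l = 0≤C i (ℕ.m≤n⇒m≤1+n i≤l)
    0≤Cl : 0ℚ ≤ C l
    0≤Cl = 0≤C′ l ℕ.≤-refl
    -- One step changes S - C by s(C + S) - (1 - c)(S - C), which is at least s - (1 - c) because C
    -- + S ≥ 1 and S - C ≤ 1.
    s/2≤ : ½ * s ≤ s - (1ℚ - c)
    s/2≤ = *-cancelˡ-≤ (0<toℚ 7) (cert (0≤+ (0≤+ (8 ·≤ diff 1-c≤s²) (diff 8s²≤s)) (3 ·≤ 0≤s)) (lemma₁ c s))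
      where
      lemma₁ : ∀ c s → toℚ 8 * (s * s - (1ℚ - c)) + (s - toℚ 8 * (s * s)) + toℚ 3 * s ≡ toℚ 8 * (s - (1ℚ - c)) - toℚ 8 * (½ * s)
      lemma₁ = solve-∀ ℚ-ring
    lemma : ∀ l s c C S →
      toℚ 2 * (S - C + 1ℚ) - l * s + toℚ 2 * ((1ℚ - c) * (1ℚ - S + C) + s * (C + S - 1ℚ)) + toℚ 2 * (s - (1ℚ - c) - ½ * s)
      ≡ toℚ 2 * ((c * S + s * C) - (c * C - s * S) + 1ℚ) - (1ℚ + l) * s
    lemma = solve-∀ ℚ-ring

  -- Since S - C cannot exceed 1, its steady growth must stop within 4/s steps. This makes the
  -- search for the exit from the quadrant terminate.
  quadrant-length : ∀ l → (∀ i → i ℕ.≤ l → 0ℚ ≤ C i) → toℚ l * s ≤ toℚ 4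
  quadrant-length l 0≤C = ≤-trans (S-C-grows l 0≤C)
    (cert (0≤+ (2 ·≤ diff (S≤1 l)) (2 ·≤ 0≤C l ℕ.≤-refl)) (lemma (C l) (S l)))
    where
    lemma : ∀ C S → toℚ 2 * (1ℚ - S) + toℚ 2 * C ≡ toℚ 4 - toℚ 2 * (S - C + 1ℚ)
    lemma = solve-∀ ℚ-ring

  -- M is the last index with Re z^M > 0, so z^M is within O(s) of i, and a full turn takes L = 4M + 2 steps.
  first-exit : ∀ n → Positive-upto n ⊎ ∃ λ M → Positive-upto M × C (suc M) ≤ 0ℚ
  first-exit zero    = inj₁ λ { zero ℕ.z≤n → 0<toℚ 0 }
  first-exit (suc n) = [ (λ pos → extend pos (0ℚ <? C (suc n))) , inj₂ ]′ (first-exit n)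
    where
    extend : Positive-upto n → Dec (0ℚ < C (suc n)) → Positive-upto (suc n) ⊎ ∃ λ M → Positive-upto M × C (suc M) ≤ 0ℚ
    extend pos (no  C≯0) = inj₂ (n , pos , ≮⇒≥ C≯0)
    extend pos (yes 0<C) = inj₁ λ i i≤1+n → [ (λ i<1+n → pos i (ℕ.s≤s⁻¹ i<1+n)) , (λ { refl → 0<C }) ]′ (ℕ.m≤n⇒m<n∨m≡n i≤1+n)

  5≰4 : ¬ toℚ 5 ≤ toℚ 4
  5≰4 (*≤* (ℤ.+≤+ (ℕ.s≤s (ℕ.s≤s (ℕ.s≤s (ℕ.s≤s ()))))))

  exit-before : ∀ n → toℚ 5 ≤ toℚ n * s → ∃ λ M → Positive-upto M × C (suc M) ≤ 0ℚ
  exit-before n 5≤ns =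
    [ (λ pos → contradiction (≤-trans 5≤ns (quadrant-length n (λ i i≤n → <⇒≤ (pos i i≤n)))) 5≰4) , id ]′ (first-exit n)

  abstract
    exit : ∃ λ M → Positive-upto M × C (suc M) ≤ 0ℚ
    exit = exit-before (proj₁ (archimedean (toℚ 5) 0<s)) (proj₂ (archimedean (toℚ 5) 0<s))

  M : ℕ
  M = proj₁ exit

  0<C : ∀ {l} → l ℕ.≤ M → 0ℚ < C l
  0<C = proj₁ (proj₂ exit) _

  0≤C : ∀ {l} → l ℕ.≤ M → 0ℚ ≤ C l
  0≤C l≤M = <⇒≤ (0<C l≤M)

  0≤S-M : ∀ {l} → l ℕ.≤ M → 0ℚ ≤ S l
  0≤S-M l≤M = 0≤S _ (λ i i<l → 0≤C (ℕ.≤-trans (ℕ.<⇒≤ i<l) l≤M))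

  Ms≤4 : toℚ M * s ≤ toℚ 4
  Ms≤4 = quadrant-length M (λ i → 0≤C)

  -- The next power has left the quadrant: cC - sS ≤ 0, so cC ≤ s, and c ≥ ½.
  C-M≤2s : C M ≤ toℚ 2 * s
  C-M≤2s = cert
    (0≤+ (0≤+ (0≤* (0≤C ℕ.≤-refl) (diff 1≤2c)) (2 ·≤ diff (proj₂ (proj₂ exit)))) (2 ·≤ 0≤* 0≤s (diff (S≤1 M))))
    (lemma c s (C M) (S M))
    where
    lemma : ∀ c s C S → C * (toℚ 2 * c - 1ℚ) + toℚ 2 * (0ℚ - (c * C - s * S)) + toℚ 2 * (s * (1ℚ - S)) ≡ toℚ 2 * s - C
    lemma = solve-∀ ℚ-ring

  1-S≤C² : 1ℚ - S M ≤ C M * C M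
  1-S≤C² = cert (0≤+ (0≤* (0≤S-M ℕ.≤-refl) (diff (S≤1 M))) (unit-≤ (z^-unit M))) (lemma (C M) (S M))
    where
    lemma : ∀ C S → S * (1ℚ - S) + (C * C + S * S - 1ℚ) ≡ C * C - (1ℚ - S)
    lemma = solve-∀ ℚ-ring

  C²≤4s² : C M * C M ≤ toℚ 2 * s * (toℚ 2 * s)
  C²≤4s² = *-mono-≤ (0≤C ℕ.≤-refl) (2 ·≤ 0≤s) C-M≤2s C-M≤2s

  -- Ms ≥ S ≥ 1 - C² ≥ 1 - 4s² at index M. Hence the number of blocks is at least of order 1/s.
  1≤2Ms : 1ℚ ≤ toℚ 2 * (toℚ M * s)
  1≤2Ms = cert
    (0≤+ (0≤+ (0≤+ (2 ·≤ diff (S-upper M (λ i i<M → 0≤C (ℕ.<⇒≤ i<M)))) (2 ·≤ diff 1-S≤C²)) (2 ·≤ diff C²≤4s²)) (0≤+ (diff 8s²≤s) (0≤+ (diff 8s≤1) (7 ·≤ 0≤s))))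
    (lemma (toℚ M) s (C M) (S M))
    where
    lemma : ∀ M s C S → toℚ 2 * (M * s - S) + toℚ 2 * (C * C - (1ℚ - S)) + toℚ 2 * (toℚ 2 * s * (toℚ 2 * s) - C * C)
                        + (s - toℚ 8 * (s * s) + (1ℚ - toℚ 8 * s + toℚ 7 * s))
          ≡ toℚ 2 * (M * s) - 1ℚ
    lemma = solve-∀ ℚ-ring

  z^M-near-𝕚 : z ^ M ⊖ 𝕚 ≼ toℚ 3 * s
  z^M-near-𝕚 = bounded (3 ·≤ 0≤s)
    (cert (0≤+ (0≤+ (2 ·≤ diff 1-S≤C²) (2 ·≤ diff C²≤4s²)) (0≤+ (0≤sq s) (unit-≥ (z^-unit M)))) (lemma s (C M) (S M)))
    where
    lemma : ∀ s C S → toℚ 2 * (C * C - (1ℚ - S)) + toℚ 2 * (toℚ 2 * s * (toℚ 2 * s) - C * C) + (s * s + (1ℚ - (C * C + S * S)))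
          ≡ toℚ 3 * s * (toℚ 3 * s) - ((C + - 0ℚ) * (C + - 0ℚ) + (S + - 1ℚ) * (S + - 1ℚ))
    lemma = solve-∀ ℚ-ring

  -- Twice the number 2M + 1 of blocks of [n], so that these steps also cover all sums of two
  -- elements.
  L : ℕ
  L = 2 ℕ.+ M ℕ.* 4

  -- -i z^M is within 3s of 1, so its fourth power z^(4M) is within 12s; the two remaining steps
  -- cost 2s each.
  z^L-near-1 : z ^ L ⊖ 1𝔾 ≼ toℚ 16 * s
  z^L-near-1 = subst₂ _≼_ eq (bound s)
    (≼-⊕ (≼-⊗ (unit-≼ (z^-unit 2)) (^-near-1 (unit-≼ (unit-⊗ {⊝ 𝕚} {z ^ M} (unit refl) (z^-unit M))) w-1≼3s 4)) (z^-near-1 2))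
    where
    w = ⊝ 𝕚 ⊗ z ^ M
    w-1≼3s : w ⊖ 1𝔾 ≼ 1ℚ * (toℚ 3 * s)
    w-1≼3s = subst (_≼ 1ℚ * (toℚ 3 * s)) (lemma (z ^ M) (⊝ 𝕚) 𝕚) (≼-⊗ (≼-⊝ 𝕚≼1) z^M-near-𝕚)
      where
      lemma : ∀ w j i → j ⊗ (w ⊖ i) ≡ j ⊗ w ⊖ j ⊗ i
      lemma = solve-∀ 𝔾-ring
    bound : ∀ s → 1ℚ * (toℚ 4 * (1ℚ * (toℚ 3 * s))) + toℚ 2 * (toℚ 2 * s) ≡ toℚ 16 * s
    bound = solve-∀ ℚ-ring
    lemma : ∀ u w → u ⊗ (w ⊖ 1𝔾) ⊕ (u ⊖ 1𝔾) ≡ u ⊗ w ⊖ 1𝔾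
    lemma = solve-∀ 𝔾-ring
    w⁴ : w ^ 4 ≡ z ^ (M ℕ.* 4)
    w⁴ = trans (^-distrib-* (⊝ 𝕚) (z ^ M) 4) (trans (1*w ((z ^ M) ^ 4)) (^-assocʳ z M 4))
      where
      1*w : ∀ w → 1𝔾 ⊗ w ≡ w
      1*w = solve-∀ 𝔾-ring
    eq : z ^ 2 ⊗ (w ^ 4 ⊖ 1𝔾) ⊕ (z ^ 2 ⊖ 1𝔾) ≡ z ^ L ⊖ 1𝔾
    eq = trans (lemma (z ^ 2) (w ^ 4)) (cong (_⊖ 1𝔾) (trans (cong (z ^ 2 ⊗_) w⁴) (sym (^-homo-* z 2 (M ℕ.* 4)))))

  -- In the geometric sum the numerator is at most 16js, as z^L is within 16s of 1, and the
  -- denominator has modulus at least js/2; hence 32.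
  character-sum-≼ : ∀ j → 0ℚ < toℚ j → toℚ 2 * (toℚ j * s) ≤ 1ℚ → ∑ ((z ^ j) ^_) (downFrom L) ≼ toℚ 32
  character-sum-≼ j 0<j 2js≤1 = ≼-cancel {z ^ j ⊖ 1𝔾} {∑ ((z ^ j) ^_) (downFrom L)} {½ * (toℚ j * s)} (0<* {½} 0<½ (0<* 0<j 0<s)) (0≤toℚ 32)
    (cert (0≤* {½} 0≤½ (diff (S-lower j 2js≤1))) (lemma₁ (S j) (toℚ j * s)))
    (subst₂ _≼_ eq (lemma₂ (toℚ j) s) (^-near-1 (unit-≼ (z^-unit L)) z^L-near-1 j))
    where
    lemma₁ : ∀ S js → ½ * (toℚ 2 * S - js) ≡ S + - 0ℚ - ½ * js
    lemma₁ = solve-∀ ℚ-ring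
    lemma₂ : ∀ j s → j * (toℚ 16 * s) ≡ ½ * (j * s) * toℚ 32
    lemma₂ = solve-∀ ℚ-ring
    open ≡-Reasoning
    eq : (z ^ L) ^ j ⊖ 1𝔾 ≡ (z ^ j ⊖ 1𝔾) ⊗ ∑ ((z ^ j) ^_) (downFrom L)
    eq = begin
      (z ^ L) ^ j ⊖ 1𝔾                                      ≡⟨ cong (_⊖ 1𝔾) (^-assocʳ z L j) ⟩
      z ^ (L ℕ.* j) ⊖ 1𝔾                                    ≡⟨ cong (λ n → z ^ n ⊖ 1𝔾) (ℕ.*-comm L j) ⟩
      z ^ (j ℕ.* L) ⊖ 1𝔾                                    ≡⟨ cong (_⊖ 1𝔾) (sym (^-assocʳ z j L)) ⟩
      (z ^ j) ^ L ⊖ 1𝔾                                      ≡⟨ sym (geometric-sum (z ^ j) L) ⟩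
      (z ^ j ⊖ 1𝔾) ⊗ ∑ ((z ^ j) ^_) (downFrom L)            ∎

-- Leibniz sums

sign : ℕ → ℚ
sign zero          = 1ℚ
sign (suc zero)    = - 1ℚ
sign (suc (suc n)) = sign n

sign-unique : ∀ (f : ℕ → ℚ) → f 0 ≡ 1ℚ → f 1 ≡ - 1ℚ → (∀ n → f (suc (suc n)) ≡ f n) → ∀ n → f n ≡ sign n
sign-unique f f0 f1 f2 zero          = f0
sign-unique f f0 f1 f2 (suc zero)    = f1
sign-unique f f0 f1 f2 (suc (suc n)) = trans (f2 n) (sign-unique f f0 f1 f2 n)

-- The sign function local to leibnizSum cannot be named, and the index is also one of its hidden arguments.
-- Abstracting that argument (and the field operations, which block unification) lets Agda infer the function.
mutual
  local-sign : ℕ → ℕ → ℚ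
  local-sign = _

  leibnizSum-suc : ∀ n → leibnizSum (suc n) ≡ leibnizSum n + sign n * leibnizTerm n
  leibnizSum-suc zero          = refl
  leibnizSum-suc (suc zero)    = refl
  leibnizSum-suc (suc (suc n)) with _+_ | _*_ | suc (suc n)
  ... | _⊹_ | _·_ | m = cong (λ σ → _ ⊹ (σ · _)) (sign-unique (local-sign m) refl refl (λ _ → refl) n)

sign-suc : ∀ n → sign (suc n) ≡ - sign n
sign-suc zero          = refl
sign-suc (suc zero)    = refl
sign-suc (suc (suc n)) = sign-suc n

sign≤1 : ∀ n → sign n ≤ 1ℚ
sign≤1 zero          = ≤-refl
sign≤1 (suc zero)    = *≤* ℤ.-≤+
sign≤1 (suc (suc n)) = sign≤1 n

sign-odd : ∀ k → sign (suc (2 ℕ.* k)) ≡ - 1ℚ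
sign-odd zero    = refl
sign-odd (suc k) = trans (cong (sign ∘ suc) (ℕ.*-suc 2 k)) (sign-odd k)

1/suc-* : ∀ n → ℤ.1ℤ / suc n * toℚ (suc n) ≡ 1ℚ
1/suc-* n = toℚᵘ-injective (begin
  toℚᵘ (ℤ.1ℤ / suc n * toℚ (suc n))                     ≈⟨ toℚᵘ-homo-* (ℤ.1ℤ / suc n) (toℚ (suc n)) ⟩
  toℚᵘ (ℤ.1ℤ / suc n) ℚᵘ.* toℚᵘ (toℚ (suc n))           ≈⟨ ℚᵘ.*-cong (toℚᵘ-fromℚᵘ (ℚᵘ.mkℚᵘ ℤ.1ℤ n)) (toℚᵘ-toℚ (suc n)) ⟩
  ℚᵘ.mkℚᵘ ℤ.1ℤ n ℚᵘ.* ℚᵘ.mkℚᵘ (ℤ.+ suc n) 0             ≈⟨ ℚᵘ.*≡* (lemma (ℤ.+ suc n)) ⟩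
  toℚᵘ 1ℚ                                               ∎)
  where
  open ℚᵘ.≃-Reasoning
  lemma : ∀ i → ℤ.1ℤ ℤ.* i ℤ.* ℤ.1ℤ ≡ ℤ.1ℤ ℤ.* (i ℤ.* ℤ.1ℤ)
  lemma = ℤ-solve-∀

abstract
  -- The square-wave coefficient 1/(2j + 1). The product is written `j ℕ.* 2` so that replacing j by
  -- `suc j` exposes two successors, and powers of w unfold by two factors.
  κ : ℕ → ℚ
  κ j = ℤ.1ℤ / suc (j ℕ.* 2)

  κ-* : ∀ j → κ j * toℚ (suc (j ℕ.* 2)) ≡ 1ℚ
  κ-* j = 1/suc-* (j ℕ.* 2)

  0≤κ : ∀ j → 0ℚ ≤ κ j
  0≤κ j = nonNegative⁻¹ (κ j) {{normalize-nonNeg 1 (suc (j ℕ.* 2))}}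

  κ-zero : κ 0 ≡ 1ℚ
  κ-zero = refl

  leibnizTerm-κ : ∀ j → leibnizTerm j ≡ toℚ 4 * κ j
  leibnizTerm-κ j = trans (/-cong {q₂ = suc (j ℕ.* 2)} (refl {x = ℤ.+ 4}) (cong suc (ℕ.*-comm 2 j))) (toℚᵘ-injective (begin
    toℚᵘ (ℤ.+ 4 / suc (j ℕ.* 2))                             ≈⟨ toℚᵘ-fromℚᵘ (ℚᵘ.mkℚᵘ (ℤ.+ 4) (j ℕ.* 2)) ⟩
    ℚᵘ.mkℚᵘ (ℤ.+ 4) (j ℕ.* 2)                                ≈⟨ ℚᵘ.*≡* (cong (ℤ.+ 4 ℤ.*_) (cong (ℤ.+_ ∘ suc) (ℕ.+-identityʳ (j ℕ.* 2)))) ⟩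
    ℚᵘ.mkℚᵘ (ℤ.+ 4) 0 ℚᵘ.* ℚᵘ.mkℚᵘ ℤ.1ℤ (j ℕ.* 2)            ≈⟨ ℚᵘ.*-cong (toℚᵘ-toℚ 4) (toℚᵘ-fromℚᵘ (ℚᵘ.mkℚᵘ ℤ.1ℤ (j ℕ.* 2))) ⟨
    toℚᵘ (toℚ 4) ℚᵘ.* toℚᵘ (κ j)                             ≈⟨ toℚᵘ-homo-* (toℚ 4) (κ j) ⟨
    toℚᵘ (toℚ 4 * κ j)                                       ∎))
    where open ℚᵘ.≃-Reasoning

κ-mono : ∀ {i j} → i ℕ.≤ j → κ j ≤ κ i
κ-mono {i} {j} i≤j = cert
  (0≤* (0≤* (0≤κ i) (0≤κ j)) (diff (toℚ-mono-≤ (ℕ.s≤s (ℕ.*-monoˡ-≤ 2 i≤j)))))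
  (trans (trans (lemma (κ i) (κ j) (toℚ (suc (i ℕ.* 2))) (toℚ (suc (j ℕ.* 2))))
         (cong₂ (λ p q → κ i * p - q * κ j) (κ-* j) (κ-* i))) (lemma₁ (κ i) (κ j)))
  where
  lemma : ∀ a b m n → a * b * (n - m) ≡ a * (b * n) - a * m * b
  lemma = solve-∀ ℚ-ring
  lemma₁ : ∀ a b → a * 1ℚ - 1ℚ * b ≡ a - b
  lemma₁ = solve-∀ ℚ-ring

leibnizTerm-decreases : ∀ n → leibnizTerm (suc n) ≤ leibnizTerm n
leibnizTerm-decreases n = subst₂ _≤_ (sym (leibnizTerm-κ (suc n))) (sym (leibnizTerm-κ n))
  (*-monoˡ-≤-nonNeg (toℚ 4) {{nonNegative (0≤toℚ 4)}} (κ-mono (ℕ.n≤1+n n)))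

0≤leibnizTerm : ∀ n → 0ℚ ≤ leibnizTerm n
0≤leibnizTerm n = subst (0ℚ ≤_) (sym (leibnizTerm-κ n)) (4 ·≤ 0≤κ n)

-- The factor ½(1 + sign n) is 1 for even n and 0 for odd n, so the quantity compared is whichever
-- of the partial sums with n and n + 1 terms has an odd number of terms: the upper sums of the
-- alternating series.
leibniz-decreases : ∀ n →
  leibnizSum (suc n) + ½ * (1ℚ + sign (suc n)) * leibnizTerm (suc n) ≤ leibnizSum n + ½ * (1ℚ + sign n) * leibnizTerm n
leibniz-decreases n = begin
  leibnizSum (suc n) + ½ * (1ℚ + sign (suc n)) * leibnizTerm (suc n)
    ≡⟨ cong₂ (λ σ l → l + ½ * (1ℚ + σ) * leibnizTerm (suc n)) (sign-suc n) (leibnizSum-suc n) ⟩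
  leibnizSum n + sign n * leibnizTerm n + ½ * (1ℚ + - sign n) * leibnizTerm (suc n)
    ≤⟨ cert (0≤* (0≤* 0≤½ (diff (sign≤1 n))) (diff (leibnizTerm-decreases n))) (lemma (leibnizSum n) (sign n) (leibnizTerm n) (leibnizTerm (suc n))) ⟩
  leibnizSum n + ½ * (1ℚ + sign n) * leibnizTerm n
    ∎
  where
  open ≤-Reasoning
  lemma : ∀ l σ t t′ → ½ * (1ℚ - σ) * (t - t′) ≡ l + ½ * (1ℚ + σ) * t - (l + σ * t + ½ * (1ℚ + - σ) * t′)
  lemma = solve-∀ ℚ-ring

-- Every partial sum lies below the monotone upper quantity of `leibniz-decreases`, which equals
-- `leibnizUpper k` at the odd index 2k + 1.
leibnizSum-≤ : ∀ k n → leibnizSum (n ℕ.+ suc (2 ℕ.* k)) ≤ leibnizUpper k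
leibnizSum-≤ k n = ≤-trans
  (cert (0≤* (0≤* 0≤½ 0≤1+sign) (0≤leibnizTerm N)) (lemma (leibnizSum N) (½ * (1ℚ + sign N) * leibnizTerm N)))
  (≤-trans (descend n) (≤-reflexive (trans (cong (λ σ → leibnizUpper k + ½ * (1ℚ + σ) * leibnizTerm (suc (2 ℕ.* k))) (sign-odd k)) (lemma₁ (leibnizUpper k) (leibnizTerm (suc (2 ℕ.* k)))))))
  where
  N = n ℕ.+ suc (2 ℕ.* k)
  0≤1+sign : 0ℚ ≤ 1ℚ + sign N
  0≤1+sign = subst (0ℚ ≤_) (trans (cong (λ σ → 1ℚ - σ) (sign-suc N)) (lemma₂ (sign N))) (diff (sign≤1 (suc N)))
    where
    lemma₂ : ∀ σ → 1ℚ - - σ ≡ 1ℚ + σ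
    lemma₂ = solve-∀ ℚ-ring
  lemma : ∀ l d → d ≡ l + d - l
  lemma = solve-∀ ℚ-ring
  lemma₁ : ∀ u t → u + ½ * (1ℚ + - 1ℚ) * t ≡ u
  lemma₁ = solve-∀ ℚ-ring
  descend : ∀ n → leibnizSum (n ℕ.+ suc (2 ℕ.* k)) + ½ * (1ℚ + sign (n ℕ.+ suc (2 ℕ.* k))) * leibnizTerm (n ℕ.+ suc (2 ℕ.* k))
                ≤ leibnizUpper k + ½ * (1ℚ + sign (suc (2 ℕ.* k))) * leibnizTerm (suc (2 ℕ.* k))
  descend zero    = ≤-refl
  descend (suc n) = ≤-trans (leibniz-decreases (n ℕ.+ suc (2 ℕ.* k))) (descend n)

-- The test function

∑ℚ : (ℕ → ℚ) → ℕ → ℚ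
∑ℚ f zero    = 0ℚ
∑ℚ f (suc n) = ∑ℚ f n + f n

∑ℚ-cong : ∀ {f g : ℕ → ℚ} → (∀ i → f i ≡ g i) → ∀ n → ∑ℚ f n ≡ ∑ℚ g n
∑ℚ-cong f≗g zero    = refl
∑ℚ-cong f≗g (suc n) = cong₂ _+_ (∑ℚ-cong f≗g n) (f≗g n)

∑ℚ-mono : ∀ {f g : ℕ → ℚ} → (∀ i → f i ≤ g i) → ∀ n → ∑ℚ f n ≤ ∑ℚ g n
∑ℚ-mono f≤g zero    = ≤-refl
∑ℚ-mono f≤g (suc n) = +-mono-≤ (∑ℚ-mono f≤g n) (f≤g n)

∑ℚ-nonNeg : ∀ {f : ℕ → ℚ} → (∀ i → 0ℚ ≤ f i) → ∀ n → 0ℚ ≤ ∑ℚ f n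
∑ℚ-nonNeg 0≤f zero    = ≤-refl
∑ℚ-nonNeg 0≤f (suc n) = 0≤+ (∑ℚ-nonNeg 0≤f n) (0≤f n)

∑ℚ-linear : ∀ a b (f g : ℕ → ℚ) n → ∑ℚ (λ i → a * f i + b * g i) n ≡ a * ∑ℚ f n + b * ∑ℚ g n
∑ℚ-linear a b f g zero    = lemma a b
  where
  lemma : ∀ a b → 0ℚ ≡ a * 0ℚ + b * 0ℚ
  lemma = solve-∀ ℚ-ring
∑ℚ-linear a b f g (suc n) = trans (cong (_+ (a * f n + b * g n)) (∑ℚ-linear a b f g n)) (lemma a b (∑ℚ f n) (f n) (∑ℚ g n) (g n))
  where
  lemma : ∀ a b p q r s → a * p + b * r + (a * q + b * s) ≡ a * (p + q) + b * (r + s)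
  lemma = solve-∀ ℚ-ring

∑ℚ-const : ∀ a n → ∑ℚ (λ _ → a) n ≡ toℚ n * a
∑ℚ-const a zero    = sym (*-zeroˡ a)
∑ℚ-const a (suc n) = trans (cong (_+ a) (∑ℚ-const a n)) (trans (lemma a (toℚ n)) (cong (_* a) (sym (toℚ-suc n))))
  where
  lemma : ∀ a n → n * a + a ≡ (1ℚ + n) * a
  lemma = solve-∀ ℚ-ring

-- w^{m+2} − w^m = 2i (im w) w^{m+1} on the unit circle
re-^-step : ∀ {w} → Unit w → ∀ m → re (w ^ (2 ℕ.+ m)) ≡ re (w ^ m) - toℚ 2 * im w * im (w ^ suc m)
re-^-step {w} u m = trans (lemma (re w) (im w) (re (w ^ m)) (im (w ^ m)))
  (trans (cong (λ r → r * re (w ^ m) - toℚ 2 * im w * im (w ^ suc m)) (norm≡1 u)) (cong (_- toℚ 2 * im w * im (w ^ suc m)) (*-identityˡ (re (w ^ m)))))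
  where
  lemma : ∀ x y a b → x * (x * a - y * b) - y * (x * b + y * a) ≡ (x * x + y * y) * a - toℚ 2 * y * (x * b + y * a)
  lemma = solve-∀ ℚ-ring

im-^-step : ∀ {w} → Unit w → ∀ m → im (w ^ (2 ℕ.+ m)) ≡ im (w ^ m) + toℚ 2 * im w * re (w ^ suc m)
im-^-step {w} u m = trans (lemma (re w) (im w) (re (w ^ m)) (im (w ^ m)))
  (trans (cong (λ r → r * im (w ^ m) + toℚ 2 * im w * re (w ^ suc m)) (norm≡1 u)) (cong (_+ toℚ 2 * im w * re (w ^ suc m)) (*-identityˡ (im (w ^ m)))))
  where
  lemma : ∀ x y a b → x * (x * b + y * a) + y * (x * a - y * b) ≡ (x * x + y * y) * b + toℚ 2 * y * (x * a - y * b)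
  lemma = solve-∀ ℚ-ring

-- For w = e^{iθ}: squareWave is Σ_{j<J} sin((2j+1)θ)/(2j+1), whose derivative in θ is cosines, and
-- evenPart is Σ_{1≤j≤J} 2 cos(2jθ)/(4j²−1).
squareWave cosines evenPart : 𝔾 → ℕ → ℚ
squareWave w = ∑ℚ (λ j → κ j * im (w ^ suc (j ℕ.* 2)))
cosines    w = ∑ℚ (λ j → re (w ^ suc (j ℕ.* 2)))
evenPart   w = ∑ℚ (λ j → (κ j - κ (suc j)) * re (w ^ (suc j ℕ.* 2)))

-- Summation by parts, using cos((2j+2)θ) - cos(2jθ) = -2 sin θ sin((2j+1)θ). If the square wave had
-- its limit π/4, this would be the series of 1 - (π/2) sin θ.
evenPart-squareWave : ∀ {w} → Unit w → ∀ J →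
  evenPart w J ≡ 1ℚ - κ J * re (w ^ (J ℕ.* 2)) - toℚ 2 * im w * squareWave w J
evenPart-squareWave {w} u zero    = sym (trans (cong (λ r → 1ℚ - r * 1ℚ - toℚ 2 * im w * 0ℚ) κ-zero) (lemma (im w)))
  where
  lemma : ∀ y → 1ℚ - 1ℚ * 1ℚ - toℚ 2 * y * 0ℚ ≡ 0ℚ
  lemma = solve-∀ ℚ-ring
evenPart-squareWave {w} u (suc J) = trans
  (cong₂ (λ e r → e + (κ J - κ (suc J)) * r) (evenPart-squareWave u J) (re-^-step u (J ℕ.* 2)))
  (trans (lemma (κ J) (κ (suc J)) (im w) (re (w ^ (J ℕ.* 2))) (im (w ^ suc (J ℕ.* 2))) (squareWave w J))
         (cong (λ r → 1ℚ - κ (suc J) * r - toℚ 2 * im w * squareWave w (suc J)) (sym (re-^-step u (J ℕ.* 2)))))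
  where
  lemma : ∀ k k′ y a b g → 1ℚ - k * a - toℚ 2 * y * g + (k - k′) * (a - toℚ 2 * y * b)
        ≡ 1ℚ - k′ * (a - toℚ 2 * y * b) - toℚ 2 * y * (g + k * b)
  lemma = solve-∀ ℚ-ring

cosines-closed : ∀ {w} → Unit w → ∀ J → toℚ 2 * im w * cosines w J ≡ im (w ^ (J ℕ.* 2))
cosines-closed {w} u zero    = lemma (im w)
  where
  lemma : ∀ y → toℚ 2 * y * 0ℚ ≡ 0ℚ
  lemma = solve-∀ ℚ-ring
cosines-closed {w} u (suc J) = trans (*-distribˡ-+ (toℚ 2 * im w) (cosines w J) _)
  (trans (cong (_+ toℚ 2 * im w * re (w ^ suc (J ℕ.* 2))) (cosines-closed u J)) (sym (im-^-step u (J ℕ.* 2))))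

module Averaged (P : ℕ) where

  -- For i < P these are P + 1, ..., 2P: large enough for boundary terms O(1/P), small enough to
  -- keep all frequencies at most 4P.
  cutoff : ℕ → ℕ
  cutoff i = suc (i ℕ.+ P)

  -- Not divided by the number of cutoffs: a bounded error is to be compared with P.
  average : (𝔾 → ℕ → ℚ) → 𝔾 → ℕ → ℚ
  average f w = ∑ℚ (λ i → f w (cutoff i))

  -- Averaging over the cutoff makes the derivative of the square wave O(1/sin²θ) uniformly in the cutoffs.
  average-cosines : ∀ {w} → Unit w → ∀ n →
    toℚ 4 * (im w * im w) * average cosines w n ≡ re (w ^ suc (P ℕ.* 2)) - re (w ^ suc ((n ℕ.+ P) ℕ.* 2))
  average-cosines {w} u zero    = lemma (im w) (re (w ^ suc (P ℕ.* 2)))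
    where
    lemma : ∀ y a → toℚ 4 * (y * y) * 0ℚ ≡ a - a
    lemma = solve-∀ ℚ-ring
  average-cosines {w} u (suc n) = begin
    toℚ 4 * (im w * im w) * (average cosines w n + cosines w (cutoff n))
      ≡⟨ lemma₁ (im w) (average cosines w n) (cosines w (cutoff n)) ⟩
    toℚ 4 * (im w * im w) * average cosines w n + toℚ 2 * im w * (toℚ 2 * im w * cosines w (cutoff n))
      ≡⟨ cong₂ (λ p q → p + toℚ 2 * im w * q) (average-cosines u n) (cosines-closed u (cutoff n)) ⟩
    a - b + toℚ 2 * im w * im (w ^ (cutoff n ℕ.* 2))
      ≡⟨ lemma₂ a b (toℚ 2 * im w * im (w ^ (cutoff n ℕ.* 2))) ⟩
    a - (b - toℚ 2 * im w * im (w ^ (cutoff n ℕ.* 2)))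
      ≡⟨ cong (λ r → a - r) (sym (re-^-step u (suc ((n ℕ.+ P) ℕ.* 2)))) ⟩
    a - re (w ^ suc ((suc n ℕ.+ P) ℕ.* 2))
      ∎
    where
    open ≡-Reasoning
    a = re (w ^ suc (P ℕ.* 2))
    b = re (w ^ suc ((n ℕ.+ P) ℕ.* 2))
    lemma₁ : ∀ y p q → toℚ 4 * (y * y) * (p + q) ≡ toℚ 4 * (y * y) * p + toℚ 2 * y * (toℚ 2 * y * q)
    lemma₁ = solve-∀ ℚ-ring
    lemma₂ : ∀ a b c → a - b + c ≡ a - (b - c)
    lemma₂ = solve-∀ ℚ-ring

  average-cosines-≤ : ∀ {w} → Unit w → ∀ n → toℚ 4 * (im w * im w) * average cosines w n ≤ toℚ 2
  average-cosines-≤ {w} u n = ≤-trans (≤-reflexive (average-cosines u n))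
    (+-mono-≤ (re≤ (unit-≼ (unit-^ u (suc (P ℕ.* 2))))) (-re≤ (unit-≼ (unit-^ u (suc ((n ℕ.+ P) ℕ.* 2))))))

  -- Total coefficient of s² in one rotation step: the term of frequency m = 2j + 1 errs by κ m² s²
  -- = m s². It depends on P alone, so z can be chosen afterwards.
  stepError : ℚ
  stepError = ∑ℚ (λ i → ∑ℚ (λ j → toℚ (suc (j ℕ.* 2))) (cutoff i)) P

  0≤stepError : 0ℚ ≤ stepError
  0≤stepError = ∑ℚ-nonNeg (λ i → ∑ℚ-nonNeg (λ j → 0≤toℚ (suc (j ℕ.* 2))) (cutoff i)) P

  -- Each of the P boundary terms is at most `κ P`, and P `κ P` ≤ 1.
  average-evenPart : ∀ {w} → Unit w → toℚ P - 1ℚ - toℚ 2 * im w * average squareWave w P ≤ average evenPart w P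
  average-evenPart {w} u = begin
    toℚ P - 1ℚ - toℚ 2 * im w * Γ
      ≤⟨ cert (diff Pκ≤1) (lemma₁ (toℚ P) (κ P) (toℚ 2 * im w) Γ) ⟩
    toℚ P * (1ℚ - κ P) + - (toℚ 2 * im w) * Γ
      ≡⟨ cong (_+ - (toℚ 2 * im w) * Γ) (trans (sym (∑ℚ-const (1ℚ - κ P) P)) (sym (*-identityˡ (∑ℚ (λ _ → 1ℚ - κ P) P)))) ⟩
    1ℚ * ∑ℚ (λ _ → 1ℚ - κ P) P + - (toℚ 2 * im w) * Γ
      ≡⟨ ∑ℚ-linear 1ℚ (- (toℚ 2 * im w)) (λ _ → 1ℚ - κ P) (λ i → squareWave w (cutoff i)) P ⟨
    ∑ℚ (λ i → 1ℚ * (1ℚ - κ P) + - (toℚ 2 * im w) * squareWave w (cutoff i)) P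
      ≤⟨ ∑ℚ-mono term P ⟩
    average evenPart w P
      ∎
    where
    open ≤-Reasoning
    Γ = average squareWave w P
    lemma₁ : ∀ P k y g → 1ℚ - P * k ≡ P * (1ℚ - k) + - y * g - (P - 1ℚ - y * g)
    lemma₁ = solve-∀ ℚ-ring
    Pκ≤1 : toℚ P * κ P ≤ 1ℚ
    Pκ≤1 = cert (0≤* (0≤κ P) (diff (toℚ-mono-≤ {P} {suc (P ℕ.* 2)} (ℕ.m≤n⇒m≤1+n (ℕ.m≤m*n P 2)))))
      (trans (lemma₂ (κ P) (toℚ (suc (P ℕ.* 2))) (toℚ P)) (cong (_- toℚ P * κ P) (κ-* P)))
      where
      lemma₂ : ∀ k m P → k * (m - P) ≡ k * m - P * k
      lemma₂ = solve-∀ ℚ-ring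
    term : ∀ i → 1ℚ * (1ℚ - κ P) + - (toℚ 2 * im w) * squareWave w (cutoff i) ≤ evenPart w (cutoff i)
    term i = subst (1ℚ * (1ℚ - κ P) + - (toℚ 2 * im w) * squareWave w (cutoff i) ≤_) (sym (evenPart-squareWave u (cutoff i)))
      (cert (0≤+ (diff (κ-mono (ℕ.m≤n⇒m≤1+n (ℕ.m≤n+m P i)))) (0≤* (0≤κ (cutoff i)) (diff (re≤ (unit-≼ (unit-^ u (cutoff i ℕ.* 2)))))))
            (lemma₂ (κ P) (κ (cutoff i)) (re (w ^ (cutoff i ℕ.* 2))) (toℚ 2 * im w) (squareWave w (cutoff i))))
      where
      lemma₂ : ∀ k k′ a y g → k - k′ + k′ * (1ℚ - a) ≡ 1ℚ - k′ * a - y * g - (1ℚ * (1ℚ - k) + - y * g)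
      lemma₂ = solve-∀ ℚ-ring

module TestFunction (z : 𝔾) (z-unit : Unit z) (0≤c : 0ℚ ≤ re z) (0<s : 0ℚ < im z) (8s≤1 : toℚ 8 * im z ≤ 1ℚ) (P : ℕ) where
  open Quadrant z z-unit 0≤c 0<s 8s≤1 public
  open Averaged P public

  -- First-order expansion of sin(m(θ + φ))/m, φ the angle of z, with z^m replaced by 1 + ims; κ
  -- cancels the factor m = 2j + 1.
  wave-term-step : ∀ {w} → Unit w → ∀ j →
    κ j * im ((w ⊗ z) ^ suc (j ℕ.* 2))
      ≤ 1ℚ * (1ℚ * (κ j * im (w ^ suc (j ℕ.* 2))) + s * re (w ^ suc (j ℕ.* 2))) + s * s * toℚ (suc (j ℕ.* 2))
  wave-term-step {w} u j = begin
    κ j * im ((w ⊗ z) ^ m)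
      ≡⟨ cong (λ v → κ j * im v) (^-distrib-* w z m) ⟩
    κ j * (a * q + b * p)
      ≤⟨ cert (0≤* (0≤κ j) (diff error)) (lemma₁ (κ j) a b p q (toℚ m) s) ⟩
    κ j * b + κ j * toℚ m * (s * a + s * s * toℚ m)
      ≡⟨ cong (λ r → κ j * b + r * (s * a + s * s * toℚ m)) (κ-* j) ⟩
    κ j * b + 1ℚ * (s * a + s * s * toℚ m)
      ≡⟨ lemma₂ (κ j * b) (s * a) (s * s * toℚ m) ⟩
    1ℚ * (1ℚ * (κ j * b) + s * a) + s * s * toℚ m
      ∎
    where
    open ≤-Reasoning
    m = suc (j ℕ.* 2)
    a = re (w ^ m)
    b = im (w ^ m)
    p = re (z ^ m)
    q = im (z ^ m)
    error : a * (q + - (toℚ m * s)) + b * (p + - 1ℚ) ≤ 1ℚ * (toℚ m * toℚ m * (s * s))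
    error = im≤ (≼-⊗ {w ^ m} {z ^ m ⊖ tangent m} (unit-≼ (unit-^ u m)) (z^-tangent m))
    lemma₁ : ∀ k a b p q m s → k * (1ℚ * (m * m * (s * s)) - (a * (q + - (m * s)) + b * (p + - 1ℚ)))
           ≡ k * b + k * m * (s * a + s * s * m) - k * (a * q + b * p)
    lemma₁ = solve-∀ ℚ-ring
    lemma₂ : ∀ x y z → x + 1ℚ * (y + z) ≡ 1ℚ * (1ℚ * x + y) + z
    lemma₂ = solve-∀ ℚ-ring

  -- The factors `1ℚ` fit `∑ℚ-linear` and make the shape stable under summation, so the lemma
  -- applies both to the sum within one cutoff and to the sum over cutoffs.
  ∑ℚ-step : ∀ {f′ f g h : ℕ → ℚ} → (∀ i → f′ i ≤ 1ℚ * (1ℚ * f i + s * g i) + s * s * h i) → ∀ n →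
    ∑ℚ f′ n ≤ 1ℚ * (1ℚ * ∑ℚ f n + s * ∑ℚ g n) + s * s * ∑ℚ h n
  ∑ℚ-step {f′} {f} {g} {h} f′≤ n = begin
    ∑ℚ f′ n
      ≤⟨ ∑ℚ-mono f′≤ n ⟩
    ∑ℚ (λ i → 1ℚ * (1ℚ * f i + s * g i) + s * s * h i) n
      ≡⟨ ∑ℚ-linear 1ℚ (s * s) (λ i → 1ℚ * f i + s * g i) h n ⟩
    1ℚ * ∑ℚ (λ i → 1ℚ * f i + s * g i) n + s * s * ∑ℚ h n
      ≡⟨ cong (λ r → 1ℚ * r + s * s * ∑ℚ h n) (∑ℚ-linear 1ℚ s f g n) ⟩
    1ℚ * (1ℚ * ∑ℚ f n + s * ∑ℚ g n) + s * s * ∑ℚ h n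
      ∎
    where open ≤-Reasoning

  wave-step : ∀ {w} → Unit w →
    average squareWave (w ⊗ z) P ≤ 1ℚ * (1ℚ * average squareWave w P + s * average cosines w P) + s * s * stepError
  wave-step u = ∑ℚ-step (λ i → ∑ℚ-step (wave-term-step u) (cutoff i)) P

  -- The angle θ = π/2 + ψ after l steps away from the top of the circle; sin θ = cos ψ is `C l`.
  W : ℕ → 𝔾
  W l = 𝕚 ⊗ z ^ l

  W-unit : ∀ l → Unit (W l)
  W-unit l = unit-⊗ {𝕚} {z ^ l} (unit refl) (z^-unit l)

  W-suc : ∀ l → W (suc l) ≡ W l ⊗ z
  W-suc l = lemma 𝕚 z (z ^ l)
    where
    lemma : ∀ i z w → i ⊗ (z ⊗ w) ≡ i ⊗ w ⊗ z
    lemma = solve-∀ 𝔾-ring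

  im-W : ∀ l → im (W l) ≡ C l
  im-W l = lemma (C l) (S l)
    where
    lemma : ∀ a b → 0ℚ * b + 1ℚ * a ≡ a
    lemma = solve-∀ ℚ-ring

  Γ : ℕ → ℚ
  Γ l = average squareWave (W l) P

  E : ℚ
  E = s * s * stepError

  0≤E : 0ℚ ≤ E
  0≤E = 0≤* (0≤sq s) 0≤stepError

  -- Telescoping tan ψ over the steps: its increment from ψ to ψ′ is sin(ψ′ − ψ)/(cos ψ cos ψ′).
  wave-deviation : ∀ l → l ℕ.≤ M → toℚ 2 * C l * (Γ l - Γ 0) ≤ S l + toℚ 2 * toℚ l * E * C l
  wave-deviation zero    _     = ≤-reflexive (lemma (Γ 0) E)
    where
    lemma : ∀ g e → toℚ 2 * 1ℚ * (g - g) ≡ 0ℚ + toℚ 2 * 0ℚ * e * 1ℚ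
    lemma = solve-∀ ℚ-ring
  wave-deviation (suc l) 1+l≤M = *-cancelˡ-≤ {r = toℚ 2 * (C l * C l)} (0<* (0<toℚ 1) (0<* 0<Cl 0<Cl)) (cert
    (0≤+ (0≤+ (0≤+ (0≤+ (2 ·≤ 0≤* (0≤* 0≤Cl 0≤C′) (diff (wave-deviation l l≤M)))
                        (4 ·≤ 0≤* (0≤* (0≤* 0≤Cl 0≤Cl) 0≤C′) (diff step)))
                   (2 ·≤ 0≤* 0≤s (0≤+ (0≤* (diff c≤1) 0≤Cl) (0≤* 0≤s (0≤S-M l≤M)))))
              (0≤* (0≤* 0≤s 0≤C′) (diff flat)))
         (2 ·≤ 0≤* (0≤* 0≤s 0≤Cl) (unit-≤ (z^-unit l))))
    (trans (lemma c s (C l) (S l) (toℚ l) E (Γ l) (Γ (suc l)) (Γ 0) (average cosines (W l) P))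
      (cong (λ r → toℚ 2 * (C l * C l) * (S (suc l) + toℚ 2 * r * E * C (suc l)) - toℚ 2 * (C l * C l) * (toℚ 2 * C (suc l) * (Γ (suc l) - Γ 0)))
            (sym (toℚ-suc l)))))
    where
    l≤M : l ℕ.≤ M
    l≤M = ℕ.<⇒≤ 1+l≤M
    0<Cl : 0ℚ < C l
    0<Cl = 0<C l≤M
    0≤Cl : 0ℚ ≤ C l
    0≤Cl = <⇒≤ 0<Cl
    0≤C′ : 0ℚ ≤ C (suc l)
    0≤C′ = 0≤C 1+l≤M
    step : Γ (suc l) ≤ 1ℚ * (1ℚ * Γ l + s * average cosines (W l) P) + E
    step = ≤-trans (≤-reflexive (cong (λ w → average squareWave w P) (W-suc l))) (wave-step (W-unit l))
    -- The slope is at most 1/(2C²). As C decreases along the quadrant, s times this is at most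
    -- s/(2CC′), half the increment of the tangent.
    flat : toℚ 4 * (C l * C l) * average cosines (W l) P ≤ toℚ 2
    flat = subst (λ r → toℚ 4 * (r * r) * average cosines (W l) P ≤ toℚ 2) (im-W l) (average-cosines-≤ (W-unit l) P)
    lemma : ∀ c s C S l E g g′ g₀ η →
      toℚ 2 * (C * (c * C - s * S) * (S + toℚ 2 * l * E * C - toℚ 2 * C * (g - g₀)))
      + toℚ 4 * (C * C * (c * C - s * S) * (1ℚ * (1ℚ * g + s * η) + E - g′))
      + toℚ 2 * (s * ((1ℚ - c) * C + s * S))
      + s * (c * C - s * S) * (toℚ 2 - toℚ 4 * (C * C) * η)
      + toℚ 2 * (s * C * (C * C + S * S - 1ℚ))
      ≡ toℚ 2 * (C * C) * (c * S + s * C + toℚ 2 * (1ℚ + l) * E * (c * C - s * S))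
        - toℚ 2 * (C * C) * (toℚ 2 * (c * C - s * S) * (g′ - g₀))
    lemma = solve-∀ ℚ-ring

  -- S contributes at most 1, and since ls ≤ 4 the accumulated second-order error is at most 8
  -- `stepError` s ≤ 1.
  wave-deviation-≤ : toℚ 8 * stepError * s ≤ 1ℚ → ∀ {l} → l ℕ.≤ M → toℚ 2 * C l * (Γ l - Γ 0) ≤ toℚ 2
  wave-deviation-≤ 8Ks≤1 {l} l≤M = ≤-trans (wave-deviation l l≤M) (cert
    (0≤+ (0≤+ (0≤+ (diff (S≤1 l)) (2 ·≤ 0≤* (0≤* (0≤* (0≤toℚ l) 0≤E) (0≤toℚ 1)) (diff (C≤1 l))))
              (2 ·≤ 0≤* (0≤* 0≤s 0≤stepError) (diff (≤-trans (*-monoʳ-≤-nonNeg s {{nonNegative 0≤s}} (toℚ-mono-≤ l≤M)) Ms≤4))))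
         (diff 8Ks≤1))
    (lemma (S l) (C l) (toℚ l) s stepError))
    where
    lemma : ∀ S C l s K → 1ℚ - S + toℚ 2 * (l * (s * s * K) * 1ℚ * (1ℚ - C)) + toℚ 2 * (s * K * (toℚ 4 - l * s)) + (1ℚ - toℚ 8 * K * s)
          ≡ toℚ 2 - (S + toℚ 2 * l * (s * s * K) * C)
    lemma = solve-∀ ℚ-ring

  leibniz-squareWave : ∀ J → toℚ 4 * squareWave (W 0) J ≡ leibnizSum J
  leibniz-squareWave zero    = refl
  leibniz-squareWave (suc J) = begin
    toℚ 4 * (squareWave (W 0) J + κ J * im (W 0 ^ suc (J ℕ.* 2)))
      ≡⟨ cong (λ r → toℚ 4 * (squareWave (W 0) J + κ J * r)) (im-𝕚^ J) ⟩
    toℚ 4 * (squareWave (W 0) J + κ J * sign J)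
      ≡⟨ lemma (squareWave (W 0) J) (κ J) (sign J) ⟩
    toℚ 4 * squareWave (W 0) J + sign J * (toℚ 4 * κ J)
      ≡⟨ cong₂ (λ p q → p + sign J * q) (leibniz-squareWave J) (sym (leibnizTerm-κ J)) ⟩
    leibnizSum J + sign J * leibnizTerm J
      ≡⟨ sym (leibnizSum-suc J) ⟩
    leibnizSum (suc J)
      ∎
    where
    open ≡-Reasoning
    lemma : ∀ g k σ → toℚ 4 * (g + k * σ) ≡ toℚ 4 * g + σ * (toℚ 4 * k)
    lemma = solve-∀ ℚ-ring
    im-𝕚^ : ∀ J → im (𝕚 ^ suc (J ℕ.* 2)) ≡ sign J
    im-𝕚^ zero    = refl
    im-𝕚^ (suc J) = trans (cong im (𝕚² (𝕚 ^ suc (J ℕ.* 2)))) (trans (cong -_ (im-𝕚^ J)) (sym (sign-suc J)))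
      where
      𝕚² : ∀ w → 𝕚 ⊗ (𝕚 ⊗ w) ≡ ⊝ w
      𝕚² w = trans (assoc 𝕚 w) (negate w)
        where
        assoc : ∀ i w → i ⊗ (i ⊗ w) ≡ i ⊗ i ⊗ w
        assoc = solve-∀ 𝔾-ring
        negate : ∀ w → (⊝ 1𝔾) ⊗ w ≡ ⊝ w
        negate = solve-∀ 𝔾-ring

  module _ (k : ℕ) (2k<P : 2 ℕ.* k ℕ.≤ P) where

    Γ₀-≤ : toℚ 4 * Γ 0 ≤ toℚ P * leibnizUpper k
    Γ₀-≤ = begin
      toℚ 4 * Γ 0                                                              ≡⟨ lemma (toℚ 4) (Γ 0) ⟩
      -- The zero summand only brings the expression into the two-term form of `∑ℚ-linear`.
      toℚ 4 * Γ 0 + 0ℚ * Γ 0                                                   ≡⟨ ∑ℚ-linear (toℚ 4) 0ℚ (λ i → squareWave (W 0) (cutoff i)) (λ i → squareWave (W 0) (cutoff i)) P ⟨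
      ∑ℚ (λ i → toℚ 4 * squareWave (W 0) (cutoff i) + 0ℚ * squareWave (W 0) (cutoff i)) P
                                                                               ≤⟨ ∑ℚ-mono term P ⟩
      ∑ℚ (λ _ → leibnizUpper k) P                                              ≡⟨ ∑ℚ-const (leibnizUpper k) P ⟩
      toℚ P * leibnizUpper k                                                   ∎
      where
      open ≤-Reasoning
      lemma : ∀ a b → a * b ≡ a * b + 0ℚ * b
      lemma = solve-∀ ℚ-ring
      term : ∀ i → toℚ 4 * squareWave (W 0) (cutoff i) + 0ℚ * squareWave (W 0) (cutoff i) ≤ leibnizUpper k
      term i = ≤-trans (≤-reflexive (trans (sym (lemma (toℚ 4) (squareWave (W 0) (cutoff i))))
          (trans (leibniz-squareWave (cutoff i)) (cong leibnizSum cutoff-≡))))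
        (leibnizSum-≤ k (i ℕ.+ (P ℕ.∸ 2 ℕ.* k)))
        where
        cutoff-≡ : cutoff i ≡ i ℕ.+ (P ℕ.∸ 2 ℕ.* k) ℕ.+ suc (2 ℕ.* k)
        cutoff-≡ = trans (cong (λ p → suc (i ℕ.+ p)) (sym (ℕ.m∸n+n≡m 2k<P))) (rearrange i (P ℕ.∸ 2 ℕ.* k) (2 ℕ.* k))
          where
          rearrange : ∀ i p k → suc (i ℕ.+ (p ℕ.+ k)) ≡ i ℕ.+ p ℕ.+ suc k
          rearrange = ℕ-solve-∀

    -- Of the loss 3, the boundary terms of the even part take 1 and the deviation of the wave from
    -- its value at π/2 takes 2.
    test-lower : toℚ 8 * stepError * s ≤ 1ℚ → ∀ {l} → l ℕ.≤ M →
      toℚ P - toℚ 3 ≤ toℚ P * (½ * leibnizUpper k) * C l + average evenPart (W l) P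
    test-lower 8Ks≤1 {l} l≤M = cert
      (0≤+ (0≤+ (diff even) (diff (wave-deviation-≤ 8Ks≤1 l≤M))) (0≤* (0≤* 0≤½ (0≤C l≤M)) (diff Γ₀-≤)))
      (lemma (toℚ P) (C l) (Γ l) (Γ 0) (leibnizUpper k) (average evenPart (W l) P))
      where
      even : toℚ P - 1ℚ - toℚ 2 * C l * Γ l ≤ average evenPart (W l) P
      even = subst (λ r → toℚ P - 1ℚ - toℚ 2 * r * Γ l ≤ average evenPart (W l) P) (im-W l) (average-evenPart (W-unit l))
      lemma : ∀ P C g g₀ u B → B - (P - 1ℚ - toℚ 2 * C * g) + (toℚ 2 - toℚ 2 * C * (g - g₀)) + ½ * C * (P * u - toℚ 4 * g₀)
            ≡ P * (½ * u) * C + B - (P - toℚ 3)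
      lemma = solve-∀ ℚ-ring

-- Mirror image of `leibniz-decreases`: the correction selects the partial sum with an even number
-- of terms, and these lower sums rise from 0.
leibniz-increases : ∀ n →
  leibnizSum n + ½ * (sign n - 1ℚ) * leibnizTerm n ≤ leibnizSum (suc n) + ½ * (sign (suc n) - 1ℚ) * leibnizTerm (suc n)
leibniz-increases n = begin
  leibnizSum n + ½ * (sign n - 1ℚ) * leibnizTerm n
    ≤⟨ cert (0≤* (0≤* 0≤½ (diff (sign≤1 (suc n)))) (diff (leibnizTerm-decreases n)))
         (trans (cong (λ σ → ½ * (1ℚ - σ) * (leibnizTerm n - leibnizTerm (suc n))) (sign-suc n)) (lemma (leibnizSum n) (sign n) (leibnizTerm n) (leibnizTerm (suc n)))) ⟩
  leibnizSum n + sign n * leibnizTerm n + ½ * (- sign n - 1ℚ) * leibnizTerm (suc n)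
    ≡⟨ cong₂ (λ σ l → l + ½ * (σ - 1ℚ) * leibnizTerm (suc n)) (sign-suc n) (leibnizSum-suc n) ⟨
  leibnizSum (suc n) + ½ * (sign (suc n) - 1ℚ) * leibnizTerm (suc n)
    ∎
  where
  open ≤-Reasoning
  lemma : ∀ l σ t t′ → ½ * (1ℚ - - σ) * (t - t′) ≡ l + σ * t + ½ * (- σ - 1ℚ) * t′ - (l + ½ * (σ - 1ℚ) * t)
  lemma = solve-∀ ℚ-ring

0≤leibnizSum : ∀ n → 0ℚ ≤ leibnizSum n
0≤leibnizSum n = ≤-trans (ascend n)
  (cert (0≤* (0≤* 0≤½ (diff (sign≤1 n))) (0≤leibnizTerm n)) (lemma (leibnizSum n) (sign n) (leibnizTerm n)))
  where
  lemma : ∀ l σ t → ½ * (1ℚ - σ) * t ≡ l - (l + ½ * (σ - 1ℚ) * t)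
  lemma = solve-∀ ℚ-ring
  ascend : ∀ n → 0ℚ ≤ leibnizSum n + ½ * (sign n - 1ℚ) * leibnizTerm n
  ascend zero    = ≤-refl
  ascend (suc n) = ≤-trans (ascend n) (leibniz-increases n)

-- Sums of rationals over lists

∑ˡ : (X → ℚ) → List X → ℚ
∑ˡ f []       = 0ℚ
∑ˡ f (x ∷ xs) = f x + ∑ˡ f xs

∑ˡ-cong : ∀ {f g : X → ℚ} → (∀ x → f x ≡ g x) → ∀ xs → ∑ˡ f xs ≡ ∑ˡ g xs
∑ˡ-cong f≗g []       = refl
∑ˡ-cong f≗g (x ∷ xs) = cong₂ _+_ (f≗g x) (∑ˡ-cong f≗g xs)

∑ˡ-≥ : ∀ {f : X → ℚ} {b} xs → (∀ {x} → x ∈ xs → b ≤ f x) → toℚ (length xs) * b ≤ ∑ˡ f xs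
∑ˡ-≥ {b = b} []       b≤f = ≤-reflexive (*-zeroˡ b)
∑ˡ-≥ {b = b} (x ∷ xs) b≤f = ≤-trans (≤-reflexive (trans (cong (_* b) (toℚ-suc (length xs))) (lemma b (toℚ (length xs)))))
  (+-mono-≤ (b≤f (here refl)) (∑ˡ-≥ xs (b≤f ∘ there)))
  where
  lemma : ∀ b n → (1ℚ + n) * b ≡ b + n * b
  lemma = solve-∀ ℚ-ring

∑ˡ-linear-≤ : ∀ {f g : X → ℚ} {a b p q} xs → 0ℚ ≤ a → 0ℚ ≤ b → ∑ˡ f xs ≤ p → ∑ˡ g xs ≤ q →
  ∑ˡ (λ x → a * f x + b * g x) xs ≤ a * p + b * q
∑ˡ-linear-≤ {f = f} {g} {a} {b} {p} {q} xs 0≤a 0≤b f≤p g≤q = ≤-trans (≤-reflexive (linear xs))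
  (cert (0≤+ (0≤* 0≤a (diff f≤p)) (0≤* 0≤b (diff g≤q))) (lemma a b p q (∑ˡ f xs) (∑ˡ g xs)))
  where
  lemma : ∀ a b p q F G → a * (p - F) + b * (q - G) ≡ a * p + b * q - (a * F + b * G)
  lemma = solve-∀ ℚ-ring
  lemma₀ : ∀ a b → 0ℚ ≡ a * 0ℚ + b * 0ℚ
  lemma₀ = solve-∀ ℚ-ring
  lemma₁ : ∀ a b u v F G → a * u + b * v + (a * F + b * G) ≡ a * (u + F) + b * (v + G)
  lemma₁ = solve-∀ ℚ-ring
  linear : ∀ xs → ∑ˡ (λ x → a * f x + b * g x) xs ≡ a * ∑ˡ f xs + b * ∑ˡ g xs
  linear []       = lemma₀ a b
  linear (x ∷ xs) = trans (cong (a * f x + b * g x +_) (linear xs)) (lemma₁ a b (f x) (g x) (∑ˡ f xs) (∑ˡ g xs))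

∑ˡ-∑ℚ-≤ : ∀ {f : ℕ → X → ℚ} {B : ℕ → ℚ} xs n → (∀ {i} → i ℕ.< n → ∑ˡ (f i) xs ≤ B i) →
  ∑ˡ (λ x → ∑ℚ (λ i → f i x) n) xs ≤ ∑ℚ B n
∑ˡ-∑ℚ-≤ {f = f} {B} xs zero    f≤B = ≤-reflexive (vanish xs)
  where
  vanish : ∀ {A : Set} (xs : List A) → ∑ˡ (λ _ → 0ℚ) xs ≡ 0ℚ
  vanish []       = refl
  vanish (x ∷ xs) = cong (0ℚ +_) (vanish xs)
∑ˡ-∑ℚ-≤ {f = f} {B} xs (suc n) f≤B = begin
  ∑ˡ (λ x → ∑ℚ (λ i → f i x) n + f n x) xs
    ≡⟨ ∑ˡ-cong (λ x → lemma (∑ℚ (λ i → f i x) n) (f n x)) xs ⟩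
  ∑ˡ (λ x → 1ℚ * ∑ℚ (λ i → f i x) n + 1ℚ * f n x) xs
    ≤⟨ ∑ˡ-linear-≤ xs (0≤toℚ 1) (0≤toℚ 1) (∑ˡ-∑ℚ-≤ xs n (λ i<n → f≤B (ℕ.m<n⇒m<1+n i<n))) (f≤B ℕ.≤-refl) ⟩
  1ℚ * ∑ℚ B n + 1ℚ * B n
    ≡⟨ lemma (∑ℚ B n) (B n) ⟨
  ∑ℚ B n + B n
    ∎
  where
  open ≤-Reasoning
  lemma : ∀ a b → a + b ≡ 1ℚ * a + 1ℚ * b
  lemma = solve-∀ ℚ-ring

re-∑ : ∀ (f : X → 𝔾) xs → re (∑ f xs) ≡ ∑ˡ (λ x → re (f x)) xs
re-∑ f []       = refl
re-∑ f (x ∷ xs) = cong (re (f x) +_) (re-∑ f xs)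

im-∑ : ∀ (f : X → 𝔾) xs → im (∑ f xs) ≡ ∑ˡ (λ x → im (f x)) xs
im-∑ f []       = refl
im-∑ f (x ∷ xs) = cong (im (f x) +_) (im-∑ f xs)

-- ∣w∣² = ∣w²∣ ≤ b ≤ h²; a rational h above the square root of b stands in for the root.
sqrt-≼ : ∀ {w b h} → 0ℚ ≤ h → w ⊗ w ≼ b → b ≤ h * h → w ≼ h
sqrt-≼ {w} {b} {h} 0≤h w²≼b b≤h² = bounded 0≤h (≤-trans
  (sq-cancel-≤ (0≤bound w²≼b) (≤-trans (≤-reflexive (sym (∥∥²-⊗ w w))) (norm≤ w²≼b))) b≤h²)

-- Some character sum is large

module Concentration (z : 𝔾) (z-unit : Unit z) (0≤c : 0ℚ ≤ re z) (0<s : 0ℚ < im z) (8s≤1 : toℚ 8 * im z ≤ 1ℚ) (P : ℕ) where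
  open TestFunction z z-unit 0≤c 0<s 8s≤1 P public

  -- Turns the circle so that the middle block M sits at i; the blocks 0, ..., 2M then spread
  -- symmetrically over the upper half circle.
  centre : 𝔾
  centre = 𝕚 ⊗ conj z ^ M

  centre-unit : Unit centre
  centre-unit = unit-⊗ {𝕚} {conj z ^ M} (unit refl) (unit-^ (unit-conj z-unit) M)

  point : ℕ → 𝔾
  point b = centre ⊗ z ^ b

  conj^-cancel : ∀ l → conj z ^ l ⊗ z ^ l ≡ 1𝔾
  conj^-cancel l = trans (sym (^-distrib-* (conj z) z l)) (trans (cong (_^ l) (conj-inverse z-unit)) (1^ l))

  point-right : ∀ l → point (M ℕ.+ l) ≡ W l
  point-right l = begin
    𝕚 ⊗ conj z ^ M ⊗ z ^ (M ℕ.+ l)           ≡⟨ cong (centre ⊗_) (^-homo-* z M l) ⟩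
    𝕚 ⊗ conj z ^ M ⊗ (z ^ M ⊗ z ^ l)         ≡⟨ lemma 𝕚 (conj z ^ M) (z ^ M) (z ^ l) ⟩
    conj z ^ M ⊗ z ^ M ⊗ (𝕚 ⊗ z ^ l)         ≡⟨ cong (_⊗ W l) (conj^-cancel M) ⟩
    1𝔾 ⊗ W l                                 ≡⟨ lemma₁ (W l) ⟩
    W l                                      ∎
    where
    open ≡-Reasoning
    lemma : ∀ i x y w → i ⊗ x ⊗ (y ⊗ w) ≡ x ⊗ y ⊗ (i ⊗ w)
    lemma = solve-∀ 𝔾-ring
    lemma₁ : ∀ w → 1𝔾 ⊗ w ≡ w
    lemma₁ = solve-∀ 𝔾-ring

  point-left : ∀ {l b} → l ℕ.+ b ≡ M → point b ≡ ⊝ conj (W l)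
  point-left {l} {b} l+b≡M = begin
    𝕚 ⊗ conj z ^ M ⊗ z ^ b                          ≡⟨ cong (λ m → 𝕚 ⊗ conj z ^ m ⊗ z ^ b) (sym l+b≡M) ⟩
    𝕚 ⊗ conj z ^ (l ℕ.+ b) ⊗ z ^ b                  ≡⟨ cong (λ w → 𝕚 ⊗ w ⊗ z ^ b) (^-homo-* (conj z) l b) ⟩
    𝕚 ⊗ (conj z ^ l ⊗ conj z ^ b) ⊗ z ^ b           ≡⟨ lemma 𝕚 (conj z ^ l) (conj z ^ b) (z ^ b) ⟩
    conj z ^ b ⊗ z ^ b ⊗ (𝕚 ⊗ conj z ^ l)           ≡⟨ cong₂ _⊗_ (conj^-cancel b) (cong (𝕚 ⊗_) (sym (conj-^ z l))) ⟩
    1𝔾 ⊗ (𝕚 ⊗ conj (z ^ l))                         ≡⟨ lemma₁ (𝕚 ⊗ conj (z ^ l)) ⟩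
    𝕚 ⊗ conj (z ^ l)                                ≡⟨ lemma₂ (conj 𝕚) (conj (z ^ l)) ⟩
    ⊝ (conj 𝕚 ⊗ conj (z ^ l))                       ≡⟨ cong ⊝_ (sym (conj-⊗ 𝕚 (z ^ l))) ⟩
    ⊝ conj (W l)                                    ∎
    where
    open ≡-Reasoning
    lemma : ∀ i x y w → i ⊗ (x ⊗ y) ⊗ w ≡ y ⊗ w ⊗ (i ⊗ x)
    lemma = solve-∀ 𝔾-ring
    lemma₁ : ∀ w → 1𝔾 ⊗ w ≡ w
    lemma₁ = solve-∀ 𝔾-ring
    lemma₂ : ∀ i w → (⊝ i) ⊗ w ≡ ⊝ (i ⊗ w)
    lemma₂ = solve-∀ 𝔾-ring

  -- -conj w is the reflection θ ↦ π - θ, which preserves cos 2jθ because (-conj w)² = conj(w²).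
  -- Together with `im-reflect` it reduces the left half of the blocks to the right half.
  re-even-reflect : ∀ w j → re ((⊝ conj w) ^ (j ℕ.* 2)) ≡ re (w ^ (j ℕ.* 2))
  re-even-reflect w j = cong re (begin
    (⊝ conj w) ^ (j ℕ.* 2)          ≡⟨ even (⊝ conj w) ⟩
    ((⊝ conj w) ^ 2) ^ j            ≡⟨ cong (_^ j) (trans (lemma (conj w)) (sym (conj-^ w 2))) ⟩
    conj (w ^ 2) ^ j                ≡⟨ sym (conj-^ (w ^ 2) j) ⟩
    conj ((w ^ 2) ^ j)              ≡⟨ cong conj (sym (even w)) ⟩
    conj (w ^ (j ℕ.* 2))            ∎)
    where
    open ≡-Reasoning
    even : ∀ v → v ^ (j ℕ.* 2) ≡ (v ^ 2) ^ j
    even v = trans (cong (v ^_) (ℕ.*-comm j 2)) (sym (^-assocʳ v 2 j))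
    lemma : ∀ v → ⊝ v ⊗ (⊝ v ⊗ 1𝔾) ≡ v ⊗ (v ⊗ 1𝔾)
    lemma = solve-∀ 𝔾-ring

  average-evenPart-reflect : ∀ w → average evenPart (⊝ conj w) P ≡ average evenPart w P
  average-evenPart-reflect w = ∑ℚ-cong (λ i → ∑ℚ-cong (λ j → cong ((κ j - κ (suc j)) *_) (re-even-reflect w (suc j))) (cutoff i)) P

  im-reflect : ∀ w → im (⊝ conj w) ≡ im w
  im-reflect w = lemma (im w)
    where
    lemma : ∀ b → - - b ≡ b
    lemma = solve-∀ ℚ-ring

  module _ (k : ℕ) (2k≤P : 2 ℕ.* k ℕ.≤ P) (8Ks≤1 : toℚ 8 * stepError * s ≤ 1ℚ) where

    α : ℚ
    α = toℚ P * (½ * leibnizUpper k)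

    point-lower : ∀ {b} → b ℕ.≤ M ℕ.+ M → toℚ P - toℚ 3 ≤ α * im (point b) + 1ℚ * average evenPart (point b) P
    point-lower {b} b≤2M = ≤-trans (cases (ℕ.≤-total M b)) (≤-reflexive (cong (α * im (point b) +_) (sym (*-identityˡ (average evenPart (point b) P)))))
      where
      at : ∀ {w} l → l ℕ.≤ M → im w ≡ im (W l) → average evenPart w P ≡ average evenPart (W l) P →
           toℚ P - toℚ 3 ≤ α * im w + average evenPart w P
      at l l≤M im≡ even≡ = ≤-trans (test-lower k 2k≤P 8Ks≤1 l≤M)
        (≤-reflexive (cong₂ (λ y e → α * y + e) (sym (trans im≡ (im-W l))) (sym even≡)))
      cases : M ℕ.≤ b ⊎ b ℕ.≤ M → toℚ P - toℚ 3 ≤ α * im (point b) + average evenPart (point b) P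
      cases (inj₁ M≤b) = at {point b} (b ℕ.∸ M) (ℕ.≤-trans (ℕ.∸-monoˡ-≤ M b≤2M) (ℕ.≤-reflexive (ℕ.m+n∸n≡m M M))) (cong im eq) (cong (λ w → average evenPart w P) eq)
        where
        eq : point b ≡ W (b ℕ.∸ M)
        eq = trans (cong point (sym (ℕ.m+[n∸m]≡n M≤b))) (point-right (b ℕ.∸ M))
      cases (inj₂ b≤M) = at {point b} (M ℕ.∸ b) (ℕ.m∸n≤m M b)
        (trans (cong im eq) (im-reflect (W (M ℕ.∸ b))))
        (trans (cong (λ w → average evenPart w P) eq) (average-evenPart-reflect (W (M ℕ.∸ b))))
        where
        eq : point b ≡ ⊝ conj (W (M ℕ.∸ b))
        eq = point-left {M ℕ.∸ b} {b} (ℕ.m∸n+n≡m b≤M)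

    module _ (A : List ℕ) (block : ℕ → ℕ) (block≤2M : ∀ {a} → a ∈ A → block a ℕ.≤ M ℕ.+ M)
             {h : ℚ} (sum≼h : ∀ j → 1 ℕ.≤ j → j ℕ.≤ P ℕ.* 4 → ∑ (λ a → (z ^ j) ^ block a) A ≼ h) where

      -- Recentring multiplies the j-th character sum by a unit, so bounds on its modulus carry
      -- over.
      point-sum : ∀ j → ∑ (λ a → point (block a) ^ j) A ≡ centre ^ j ⊗ ∑ (λ a → (z ^ j) ^ block a) A
      point-sum j = trans (∑-cong (λ a → trans (^-distrib-* centre (z ^ block a) j) (cong (centre ^ j ⊗_) (swap-powers (block a)))) A)
                          (∑-⊗ˡ (centre ^ j) (λ a → (z ^ j) ^ block a) A)
        where
        swap-powers : ∀ b → (z ^ b) ^ j ≡ (z ^ j) ^ b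
        swap-powers b = trans (^-assocʳ z b j) (trans (cong (z ^_) (ℕ.*-comm b j)) (sym (^-assocʳ z j b)))

      point-sum-≼ : ∀ j → 1 ℕ.≤ j → j ℕ.≤ P ℕ.* 4 → ∑ (λ a → point (block a) ^ j) A ≼ 1ℚ * h
      point-sum-≼ j 1≤j j≤4P = subst (_≼ 1ℚ * h) (sym (point-sum j)) (≼-⊗ (unit-≼ (unit-^ centre-unit j)) (sum≼h j 1≤j j≤4P))

      0≤bound-h : 1 ℕ.≤ P → 0ℚ ≤ h
      0≤bound-h 1≤P = 0≤bound (sum≼h 1 ℕ.≤-refl (ℕ.≤-trans 1≤P (ℕ.m≤m*n P 4)))

      im-sum-≤ : 1 ℕ.≤ P → ∑ˡ (λ a → im (point (block a))) A ≤ h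
      im-sum-≤ 1≤P = begin
        ∑ˡ (λ a → im (point (block a))) A       ≡⟨ sym (im-∑ (λ a → point (block a)) A) ⟩
        im (∑ (λ a → point (block a)) A)        ≡⟨ cong im (∑-cong (λ a → lemma (point (block a))) A) ⟩
        im (∑ (λ a → point (block a) ^ 1) A)    ≤⟨ im≤ (point-sum-≼ 1 ℕ.≤-refl (ℕ.≤-trans 1≤P (ℕ.m≤m*n P 4))) ⟩
        1ℚ * h                                  ≡⟨ *-identityˡ h ⟩
        h                                       ∎
        where
        open ≤-Reasoning
        lemma : ∀ w → w ≡ w ⊗ 1𝔾
        lemma = solve-∀ 𝔾-ring

      -- The weights κ(j) - κ(j+1) are nonnegative and telescope to 1 - κ(J) ≤ 1.
      evenPart-sum-≤ : 1 ℕ.≤ P → ∀ {J} → J ℕ.≤ P ℕ.* 2 → ∑ˡ (λ a → evenPart (point (block a)) J) A ≤ h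
      evenPart-sum-≤ 1≤P {J} J≤2P = ≤-trans (∑ˡ-∑ℚ-≤ A J term) (≤-trans (≤-reflexive (telescope J))
        (cert (0≤* (0≤κ J) (0≤bound-h 1≤P)) (lemma₂ (κ J) h)))
        where
        lemma₂ : ∀ k h → k * h ≡ h - (1ℚ - k) * h
        lemma₂ = solve-∀ ℚ-ring
        telescope : ∀ J → ∑ℚ (λ j → (κ j - κ (suc j)) * h + 0ℚ * h) J ≡ (1ℚ - κ J) * h
        telescope zero    = trans (lemma h) (cong (λ k → (1ℚ - k) * h) (sym κ-zero))
          where
          lemma : ∀ h → 0ℚ ≡ (1ℚ - 1ℚ) * h
          lemma = solve-∀ ℚ-ring
        telescope (suc J) = trans (cong (_+ ((κ J - κ (suc J)) * h + 0ℚ * h)) (telescope J)) (lemma (κ J) (κ (suc J)) h)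
          where
          lemma : ∀ k k′ h → (1ℚ - k) * h + ((k - k′) * h + 0ℚ * h) ≡ (1ℚ - k′) * h
          lemma = solve-∀ ℚ-ring
        term : ∀ {j} → j ℕ.< J → ∑ˡ (λ a → (κ j - κ (suc j)) * re (point (block a) ^ (suc j ℕ.* 2))) A ≤ (κ j - κ (suc j)) * h + 0ℚ * h
        term {j} j<J = ≤-trans (≤-reflexive (∑ˡ-cong (λ a → lemma (κ j - κ (suc j)) (re (point (block a) ^ (suc j ℕ.* 2)))) A))
          (∑ˡ-linear-≤ A (diff (κ-mono (ℕ.n≤1+n j))) ≤-refl re-sum re-sum)
          where
          lemma : ∀ k x → k * x ≡ k * x + 0ℚ * x
          lemma = solve-∀ ℚ-ring
          2j+2≤4P : suc j ℕ.* 2 ℕ.≤ P ℕ.* 4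
          2j+2≤4P = ℕ.≤-trans (ℕ.*-monoˡ-≤ 2 (ℕ.≤-trans j<J J≤2P)) (ℕ.≤-reflexive (ℕ.*-assoc P 2 2))
          re-sum : ∑ˡ (λ a → re (point (block a) ^ (suc j ℕ.* 2))) A ≤ h
          re-sum = ≤-trans (≤-reflexive (sym (re-∑ (λ a → point (block a) ^ (suc j ℕ.* 2)) A)))
            (≤-trans (re≤ (point-sum-≼ (suc j ℕ.* 2) (ℕ.s≤s ℕ.z≤n) 2j+2≤4P)) (≤-reflexive (*-identityˡ h)))

      -- The pointwise bound `point-lower` is summed over A. The total weight α + P = P(u/2 + 1), u
      -- = `leibnizUpper k`, is the finite form of P(π/2 + 1).
      concentration : 1 ℕ.≤ P → toℚ (length A) * (toℚ P - toℚ 3) ≤ α * h + 1ℚ * (toℚ P * h)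
      concentration 1≤P = ≤-trans (∑ˡ-≥ A (λ a∈ → point-lower (block≤2M a∈)))
        (∑ˡ-linear-≤ A 0≤α (0≤toℚ 1) (im-sum-≤ 1≤P)
          (≤-trans (∑ˡ-∑ℚ-≤ A P (λ {i} i<P → evenPart-sum-≤ 1≤P (cutoff≤2P i<P))) (≤-reflexive (∑ℚ-const h P))))
        where
        0≤α : 0ℚ ≤ α
        0≤α = 0≤* (0≤toℚ P) (0≤* 0≤½ (0≤leibnizSum (suc (2 ℕ.* k))))
        cutoff≤2P : ∀ {i} → i ℕ.< P → cutoff i ℕ.≤ P ℕ.* 2
        cutoff≤2P {i} i<P = ℕ.≤-trans (ℕ.+-monoˡ-≤ P i<P) (ℕ.≤-reflexive (lemma P))
          where
          lemma : ∀ P → P ℕ.+ P ≡ P ℕ.* 2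
          lemma = ℕ-solve-∀

-- Choice of the constants

p≤∣p∣ : ∀ p → p ≤ ∣ p ∣
p≤∣p∣ p = [ (λ eq → ≤-reflexive (sym eq))
          , (λ eq → cert (2 ·≤ 0≤∣p∣ p) (trans (cong (λ r → toℚ 2 * r) eq) (trans (lemma p) (cong (_- p) (sym eq))))) ]′ (∣p∣≡p∨∣p∣≡-p p)
  where
  lemma : ∀ p → toℚ 2 * - p ≡ - p - p
  lemma = solve-∀ ℚ-ring

choose-2 : ∀ k → toℚ (k C 2) ≡ ½ * (toℚ k * toℚ k - toℚ k)
choose-2 zero    = refl
choose-2 (suc k) = begin
  toℚ (suc k C 2)                                                 ≡⟨ cong toℚ (nCk+nC[k+1]≡[n+1]C[k+1] k 1) ⟨
  toℚ (k C 1 ℕ.+ k C 2)                                           ≡⟨ toℚ-+ (k C 1) (k C 2) ⟩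
  toℚ (k C 1) + toℚ (k C 2)                                       ≡⟨ cong₂ _+_ (cong toℚ (nC1≡n k)) (choose-2 k) ⟩
  toℚ k + ½ * (toℚ k * toℚ k - toℚ k)                             ≡⟨ lemma (toℚ k) ⟩
  ½ * ((1ℚ + toℚ k) * (1ℚ + toℚ k) - (1ℚ + toℚ k))                ≡⟨ cong (λ r → ½ * (r * r - r)) (toℚ-suc k) ⟨
  ½ * (toℚ (suc k) * toℚ (suc k) - toℚ (suc k))                   ∎
  where
  open ≡-Reasoning
  lemma : ∀ k → k + ½ * (k * k - k) ≡ ½ * ((1ℚ + k) * (1ℚ + k) - (1ℚ + k))
  lemma = solve-∀ ℚ-ring

-- ((τ² − 1) + 2τ i)/(τ² + 1) with τ = 2(t + 1)
small-rotation : ∀ X → ∃ λ z → Unit z × 0ℚ ≤ re z × 0ℚ < im z × X * im z ≤ 1ℚ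
small-rotation X with t , X≤t ← ≤-toℚ X = build t X≤t (ℤ.1ℤ / suc (τ t ℕ.* τ t)) (1/suc-* (τ t ℕ.* τ t))
    (positive⁻¹ (ℤ.1ℤ / suc (τ t ℕ.* τ t)) {{normalize-pos 1 (suc (τ t ℕ.* τ t))}})
  where
  τ : ℕ → ℕ
  τ t = 2 ℕ.* suc t
  build : ∀ t → X ≤ toℚ t → ∀ r → r * toℚ (suc (τ t ℕ.* τ t)) ≡ 1ℚ → 0ℚ < r →
          ∃ λ z → Unit z × 0ℚ ≤ re z × 0ℚ < im z × X * im z ≤ 1ℚ
  build t X≤t r r-inverse 0<r = ((T * T - 1ℚ) * r) +i (toℚ 2 * T * r)
    , unit (trans (lemma₁ T r) (cong₂ _*_ rD≡1 rD≡1))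
    , 0≤* (diff 1≤T²) (<⇒≤ 0<r)
    , 0<* (0<* (0<toℚ 1) 0<T) 0<r
    , ≤-trans (*-monoʳ-≤-nonNeg (toℚ 2 * T * r) {{nonNegative 0≤s}} X≤t) (≤-trans ts≤ (≤-reflexive rD≡1))
    where
    T = toℚ (τ t)
    T≡ : T ≡ toℚ 2 * (1ℚ + toℚ t)
    T≡ = trans (toℚ-* 2 (suc t)) (cong (toℚ 2 *_) (toℚ-suc t))
    rD≡1 : r * (1ℚ + T * T) ≡ 1ℚ
    rD≡1 = trans (cong (r *_) (trans (cong (1ℚ +_) (sym (toℚ-* (τ t) (τ t)))) (sym (toℚ-suc (τ t ℕ.* τ t))))) r-inverse
    0<T : 0ℚ < T
    0<T = 0<toℚ (t ℕ.+ suc (t ℕ.+ 0))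
    1≤T : 1ℚ ≤ T
    1≤T = toℚ-mono-≤ {1} {τ t} (ℕ.s≤s ℕ.z≤n)
    1≤T² : 1ℚ ≤ T * T
    1≤T² = ≤-trans (≤-reflexive (sym (*-identityʳ 1ℚ))) (*-mono-≤ (0≤toℚ 1) (<⇒≤ 0<T) 1≤T 1≤T)
    0≤s : 0ℚ ≤ toℚ 2 * T * r
    0≤s = 0≤* (2 ·≤ <⇒≤ 0<T) (<⇒≤ 0<r)
    lemma₁ : ∀ T r → (T * T - 1ℚ) * r * ((T * T - 1ℚ) * r) + toℚ 2 * T * r * (toℚ 2 * T * r) ≡ r * (1ℚ + T * T) * (r * (1ℚ + T * T))
    lemma₁ = solve-∀ ℚ-ring
    ts≤ : toℚ t * (toℚ 2 * T * r) ≤ r * (1ℚ + T * T)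
    ts≤ = cert (0≤* (<⇒≤ 0<r) (0≤+ (0≤toℚ 1) (2 ·≤ <⇒≤ 0<T)))
      (trans (lemma₂ r (toℚ t) T) (cong (λ y → r * (1ℚ + T * y) - toℚ t * (toℚ 2 * T * r)) (sym T≡)))
      where
      lemma₂ : ∀ r t T → r * (1ℚ + toℚ 2 * T) ≡ r * (1ℚ + T * (toℚ 2 * (1ℚ + t))) - t * (toℚ 2 * T * r)
      lemma₂ = solve-∀ ℚ-ring

-- Five errors, each at most k²/(5P), which explains the constants: carries (8Psk²), rounding n up
-- to whole blocks (4N), missing sums (4 times the binomial coefficient minus σ), lower-order terms
-- (4k), and the geometric sum (64m).
energy-≤ : ∀ {P k n σ N m s} → 0ℚ ≤ P → 0ℚ ≤ k →
  toℚ 40 * P * P * s ≤ 1ℚ → toℚ 20 * P * N ≤ k * k → toℚ 20 * P ≤ k → toℚ 320 * P * m ≤ k * k → N * m ≤ n + N →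
  toℚ 10 * P * (½ * (k * k - k) - σ) ≤ ½ * (k * k - k) →
  P * (k * (k * (toℚ 8 * P * s)) + (toℚ 2 * (toℚ 2 * (N * m)) - toℚ 4 * σ + k * k + toℚ 2 * k) + toℚ 2 * (m * toℚ 32)
       - toℚ 4 * n + k * k) ≤ k * k
energy-≤ {P} {k} {n} {σ} {N} {m} {s} 0≤P 0≤k h₁ h₂ h₃ h₄ h₅ h₆ = *-cancelˡ-≤ (0<toℚ 4) (cert
  (0≤+ (0≤+ (0≤+ (0≤+ (0≤* (0≤sq k) (diff h₁)) (diff h₂)) (0≤+ (0≤* 0≤k (diff h₃)) (diff h₄)))
            (20 ·≤ 0≤* 0≤P (diff h₅)))
       (0≤+ (2 ·≤ diff h₆) 0≤k))
  (lemma P k n σ N m s))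
  where
  lemma : ∀ P k n σ N m s →
    k * k * (1ℚ - toℚ 40 * P * P * s) + (k * k - toℚ 20 * P * N) + (k * (k - toℚ 20 * P) + (k * k - toℚ 320 * P * m))
    + toℚ 20 * (P * (n + N - N * m)) + (toℚ 2 * (½ * (k * k - k) - toℚ 10 * P * (½ * (k * k - k) - σ)) + k)
    ≡ toℚ 5 * (k * k) - toℚ 5 * (P * (k * (k * (toℚ 8 * P * s)) + (toℚ 2 * (toℚ 2 * (N * m)) - toℚ 4 * σ + k * k + toℚ 2 * k) + toℚ 2 * (m * toℚ 32)
       - toℚ 4 * n + k * k))
  lemma = solve-∀ ℚ-ring

-- After division by k² the claim follows from 4/q² - 1 + 1/P ≤ 4(1 - 4/P)²/w². The hypothesis with
-- 32 says that the left side is at most 4/w² - 32/(Pw²), and expanding the square adds a further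
-- 64/(P²w²). Multiplying by (qPw)² clears the denominators.
energy-≤-square : ∀ {e P k n q w r} → 0ℚ < q → 0ℚ < P → 0ℚ < w → P * w * r ≡ 1ℚ →
  q * q * (w * w + toℚ 32) ≤ P * (q * q * (w * w + toℚ 4) - toℚ 4 * (w * w)) →
  q * q * n ≤ k * k → P * (e - toℚ 4 * n + k * k) ≤ k * k →
  e ≤ toℚ 2 * (P - toℚ 4) * k * r * (toℚ 2 * (P - toℚ 4) * k * r)
energy-≤-square {e} {P} {k} {n} {q} {w} {r} 0<q 0<P 0<w Pwr≡1 gap q²n≤k² h =
  *-cancelˡ-≤ {r = q * P * w * (q * P * w)} (0<* 0<qPw 0<qPw) (begin
    q * P * w * (q * P * w) * e
      ≤⟨ cert (0≤+ (0≤+ (0≤+ (0≤* (0≤* (0≤sq k) 0≤P) (diff gap)) (4 ·≤ 0≤* (0≤* (0≤sq P) (0≤sq w)) (diff q²n≤k²)))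
                        (0≤* (0≤* (0≤* (0≤sq q) (0≤sq w)) 0≤P) (diff h)))
                   (64 ·≤ 0≤* (0≤sq q) (0≤sq k)))
              (lemma₁ e P k n q w) ⟩
    q * q * (toℚ 2 * (P - toℚ 4) * k * (toℚ 2 * (P - toℚ 4) * k)) * (1ℚ * 1ℚ)
      ≡⟨ cong (λ x → q * q * (toℚ 2 * (P - toℚ 4) * k * (toℚ 2 * (P - toℚ 4) * k)) * (x * x)) Pwr≡1 ⟨
    q * q * (toℚ 2 * (P - toℚ 4) * k * (toℚ 2 * (P - toℚ 4) * k)) * (P * w * r * (P * w * r))
      ≡⟨ lemma₂ P q w r (toℚ 2 * (P - toℚ 4) * k) ⟩
    q * P * w * (q * P * w) * (toℚ 2 * (P - toℚ 4) * k * r * (toℚ 2 * (P - toℚ 4) * k * r))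
      ∎)
  where
  open ≤-Reasoning
  0≤P = <⇒≤ 0<P
  0<qPw : 0ℚ < q * P * w
  0<qPw = 0<* (0<* 0<q 0<P) 0<w
  lemma₁ : ∀ e P k n q w →
    k * k * P * (P * (q * q * (w * w + toℚ 4) - toℚ 4 * (w * w)) - q * q * (w * w + toℚ 32))
    + toℚ 4 * (P * P * (w * w) * (k * k - q * q * n))
    + q * q * (w * w) * P * (k * k - P * (e - toℚ 4 * n + k * k))
    + toℚ 64 * (q * q * (k * k))
    ≡ q * q * (toℚ 2 * (P - toℚ 4) * k * (toℚ 2 * (P - toℚ 4) * k)) * (1ℚ * 1ℚ) - q * P * w * (q * P * w) * e
  lemma₁ = solve-∀ ℚ-ring
  lemma₂ : ∀ P q w r x → q * q * (x * x) * (P * w * r * (P * w * r)) ≡ q * P * w * (q * P * w) * (x * r * (x * r))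
  lemma₂ = solve-∀ ℚ-ring

-- Contradiction for a set above the bound

module LargeSet
  (z : 𝔾) (z-unit : Unit z) (0≤c : 0ℚ ≤ re z) (0<s : 0ℚ < im z) (8s≤1 : toℚ 8 * im z ≤ 1ℚ)
  (P : ℕ) (5≤P : 5 ℕ.≤ P) (k₀ : ℕ) (2k₀≤P : 2 ℕ.* k₀ ℕ.≤ P)
  (8Ks≤1 : toℚ 8 * Averaged.stepError P * im z ≤ 1ℚ) (8Ps≤1 : toℚ 8 * toℚ P * im z ≤ 1ℚ)
  (40P²s≤1 : toℚ 40 * toℚ P * toℚ P * im z ≤ 1ℚ)
  {q : ℚ} (0<q : 0ℚ < q) (640Ps≤q² : toℚ 640 * toℚ P * im z ≤ q * q)
  where
  open Concentration z z-unit 0≤c 0<s 8s≤1 P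

  N : ℕ
  N = suc (M ℕ.+ M)

  w : ℚ
  w = leibnizUpper k₀ + toℚ 2

  0≤P : 0ℚ ≤ toℚ P
  0≤P = 0≤toℚ P

  0<P : 0ℚ < toℚ P
  0<P = <-≤-trans (0<toℚ 4) (toℚ-mono-≤ 5≤P)

  0<w : 0ℚ < w
  0<w = <-≤-trans (0<toℚ 1) (cert (0≤leibnizSum (suc (2 ℕ.* k₀))) (lemma (leibnizUpper k₀)))
    where
    lemma : ∀ u → u ≡ u + toℚ 2 - toℚ 2
    lemma = solve-∀ ℚ-ring

  -- Ns ≥ 2Ms ≥ 1 turns the smallness of s into largeness of N.
  640P≤q²N : toℚ 640 * toℚ P ≤ q * q * toℚ N
  640P≤q²N = *-cancelˡ-≤ 0<s (cert
    (0≤+ (0≤+ (diff 640Ps≤q²) (0≤* (0≤sq q) (diff 1≤2Ms))) (0≤* (0≤sq q) 0≤s))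
    (trans (lemma s (toℚ P) q (toℚ M)) (cong (λ r → s * (q * q * r) - s * (toℚ 640 * toℚ P)) (sym N≡))))
    where
    N≡ : toℚ N ≡ 1ℚ + (toℚ M + toℚ M)
    N≡ = trans (toℚ-suc (M ℕ.+ M)) (cong (1ℚ +_) (toℚ-+ M M))
    lemma : ∀ s P q M → q * q - toℚ 640 * P * s + q * q * (toℚ 2 * (M * s) - 1ℚ) + q * q * s
          ≡ s * (q * q * (1ℚ + (M + M))) - s * (toℚ 640 * P)
    lemma = solve-∀ ℚ-ring

  module _ (n : ℕ) (A : List ℕ) (A⊆ : ∀ {a} → a ∈ A → a ℕ.≤ n)
    (sparse : toℚ 10 * toℚ P * (½ * (toℚ (length A) * toℚ (length A) - toℚ (length A)) - toℚ (sumsetCard A))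
              ≤ ½ * (toℚ (length A) * toℚ (length A) - toℚ (length A)))
    (n-large : toℚ 20 * toℚ P * toℚ N + q * q * toℚ N + toℚ 400 * toℚ P * toℚ P ≤ q * q * toℚ n)
    (q²n≤k² : q * q * toℚ n ≤ toℚ (length A) * toℚ (length A))
    (gap : q * q * (w * w + toℚ 32) ≤ toℚ P * (q * q * (w * w + toℚ 4) - toℚ 4 * (w * w)))
    where

    -- The least block length with Nm > n, so that every a ≤ n lies in one of the blocks 0, ..., 2M.
    m : ℕ
    m = suc (n ℕ./ N)

    open Blocks m

    -- `e` is the bound of `square-sum-≼` with δ = 8Ps, τ = 32 and an interval of length 2Nm. `h` is
    -- 2k/w shrunk by the factor (P - 4)/P, just below what `concentration` allows.
    k σ e r h : ℚ
    k = toℚ (length A)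
    σ = toℚ (sumsetCard A)
    e = k * (k * (toℚ 8 * toℚ P * s)) + (toℚ 2 * (toℚ 2 * (toℚ N * toℚ m)) - toℚ 4 * σ + k * k + toℚ 2 * k) + toℚ 2 * (toℚ m * toℚ 32)
    r = (1/ (toℚ P * w)) {{>-nonZero (0<* 0<P 0<w)}}
    h = toℚ 2 * (toℚ P - toℚ 4) * k * r

    Pwr≡1 : toℚ P * w * r ≡ 1ℚ
    Pwr≡1 = *-inverseʳ (toℚ P * w) {{>-nonZero (0<* 0<P 0<w)}}

    0≤k : 0ℚ ≤ k
    0≤k = 0≤toℚ (length A)

    0≤N : 0ℚ ≤ toℚ N
    0≤N = 0≤toℚ N

    -- All three summands are nonnegative, so k² dominates each of them separately: 20PN, q²N and
    -- (20P)².
    n-large≤k² : toℚ 20 * toℚ P * toℚ N + q * q * toℚ N + toℚ 400 * toℚ P * toℚ P ≤ k * k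
    n-large≤k² = ≤-trans n-large q²n≤k²

    20PN≤k² : toℚ 20 * toℚ P * toℚ N ≤ k * k
    20PN≤k² = ≤-trans (cert (0≤+ (0≤* (0≤sq q) 0≤N) (0≤* (400 ·≤ 0≤P) 0≤P)) (lemma (toℚ 20 * toℚ P * toℚ N) (q * q * toℚ N) (toℚ 400 * toℚ P * toℚ P))) n-large≤k²
      where
      lemma : ∀ a b c → b + c ≡ a + b + c - a
      lemma = solve-∀ ℚ-ring

    q²N≤k² : q * q * toℚ N ≤ k * k
    q²N≤k² = ≤-trans (cert (0≤+ (0≤* (20 ·≤ 0≤P) 0≤N) (0≤* (400 ·≤ 0≤P) 0≤P)) (lemma (toℚ 20 * toℚ P * toℚ N) (q * q * toℚ N) (toℚ 400 * toℚ P * toℚ P))) n-large≤k²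
      where
      lemma : ∀ a b c → a + c ≡ a + b + c - b
      lemma = solve-∀ ℚ-ring

    20P≤k : toℚ 20 * toℚ P ≤ k
    20P≤k = sq-cancel-≤ 0≤k (≤-trans (cert (0≤+ (0≤* (20 ·≤ 0≤P) 0≤N) (0≤* (0≤sq q) 0≤N)) (lemma (toℚ 20 * toℚ P * toℚ N) (q * q * toℚ N) (toℚ P))) n-large≤k²)
      where
      lemma : ∀ a b P → a + b ≡ a + b + toℚ 400 * P * P - toℚ 20 * P * (toℚ 20 * P)
      lemma = solve-∀ ℚ-ring

    n<Nm : n ℕ.< N ℕ.* m
    n<Nm = ℕ.<-≤-trans (ℕ.≤-<-trans (ℕ.≤-reflexive (m≡m%n+[m/n]*n n N)) (ℕ.+-monoˡ-< (n ℕ./ N ℕ.* N) (m%n<n n N))) (ℕ.≤-reflexive (ℕ.*-comm m N))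

    Nm≤n+N : toℚ N * toℚ m ≤ toℚ n + toℚ N
    Nm≤n+N = ≤-trans (≤-reflexive (sym (toℚ-* N m))) (≤-trans (toℚ-mono-≤ (begin
      N ℕ.* m                   ≡⟨ ℕ.*-comm N m ⟩
      N ℕ.+ n ℕ./ N ℕ.* N       ≤⟨ ℕ.+-monoʳ-≤ N (m/n*n≤m n N) ⟩
      N ℕ.+ n                   ≡⟨ ℕ.+-comm N n ⟩
      n ℕ.+ N                   ∎)) (≤-reflexive (toℚ-+ n N)))
      where open ℕ.≤-Reasoning

    -- 640Pm ≤ q²Nm ≤ q²(n + N) ≤ 2k².
    320Pm≤k² : toℚ 320 * toℚ P * toℚ m ≤ k * k
    320Pm≤k² = *-cancelˡ-≤ (0<toℚ 1) (cert
      (0≤+ (0≤+ (0≤* (0≤toℚ m) (diff 640P≤q²N)) (0≤* (0≤sq q) (diff Nm≤n+N))) (0≤+ (diff q²n≤k²) (diff q²N≤k²)))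
      (lemma (toℚ P) q (toℚ N) (toℚ m) (toℚ n) k))
      where
      lemma : ∀ P q N m n k → m * (q * q * N - toℚ 640 * P) + q * q * (n + N - N * m) + (k * k - q * q * n + (k * k - q * q * N))
            ≡ toℚ 2 * (k * k) - toℚ 2 * (toℚ 320 * P * m)
      lemma = solve-∀ ℚ-ring

    Lm≡ : L ℕ.* m ≡ 2 ℕ.* (N ℕ.* m)
    Lm≡ = lemma M m
      where
      lemma : ∀ M m → (2 ℕ.+ M ℕ.* 4) ℕ.* m ≡ 2 ℕ.* (suc (M ℕ.+ M) ℕ.* m)
      lemma = ℕ-solve-∀

    toℚ-Lm : toℚ (L ℕ.* m) ≡ toℚ 2 * (toℚ N * toℚ m)
    toℚ-Lm = trans (cong toℚ Lm≡) (trans (toℚ-* 2 (N ℕ.* m)) (cong (toℚ 2 *_) (toℚ-* N m)))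

    sums-< : ∀ {a b} → a ∈ A → b ∈ A → a ℕ.+ b ℕ.< L ℕ.* m
    sums-< a∈ b∈ = ℕ.<-≤-trans (ℕ.+-mono-< (ℕ.≤-<-trans (A⊆ a∈) n<Nm) (ℕ.≤-<-trans (A⊆ b∈) n<Nm))
      (ℕ.≤-reflexive (trans (lemma (N ℕ.* m)) (sym Lm≡)))
      where
      lemma : ∀ x → x ℕ.+ x ≡ 2 ℕ.* x
      lemma = ℕ-solve-∀

    block≤2M : ∀ {a} → a ∈ A → block a ℕ.≤ M ℕ.+ M
    block≤2M a∈ = ℕ.s≤s⁻¹ (m<n*o⇒m/o<n (ℕ.≤-<-trans (A⊆ a∈) n<Nm))

    e≤h² : e ≤ h * h
    e≤h² = energy-≤-square {e} {toℚ P} {k} {toℚ n} {q} {w} {r} 0<q 0<P 0<w Pwr≡1 gap q²n≤k²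
      (energy-≤ {toℚ P} {k} {toℚ n} {σ} {toℚ N} {toℚ m} {s} 0≤P 0≤k 40P²s≤1 20PN≤k² 20P≤k 320Pm≤k² Nm≤n+N sparse)

    0≤P-4 : 0ℚ ≤ toℚ P - toℚ 4
    0≤P-4 = diff (toℚ-mono-≤ {4} (ℕ.≤-trans (ℕ.n≤1+n 4) 5≤P))

    0≤h : 0ℚ ≤ h
    0≤h = 0≤* (0≤* (2 ·≤ 0≤P-4) 0≤k) 0≤r
      where
      0≤r : 0ℚ ≤ r
      0≤r = nonNegative⁻¹ r {{pos⇒nonNeg r {{1/pos⇒pos (toℚ P * w) {{positive (0<* 0<P 0<w)}}}}}}

    -- For j ≤ 4P the quantity 8Ps serves twice: it bounds ∣z^j - 1∣, and being at most 1 it gives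
    -- the condition 2js ≤ 1 of `character-sum-≼`.
    sum≼h : ∀ j → 1 ℕ.≤ j → j ℕ.≤ P ℕ.* 4 → ∑ (λ a → (z ^ j) ^ block a) A ≼ h
    sum≼h j 1≤j j≤4P = sqrt-≼ 0≤h (subst (λ x → ∑ (λ a → (z ^ j) ^ block a) A ⊗ ∑ (λ a → (z ^ j) ^ block a) A ≼ k * (k * (toℚ 8 * toℚ P * s)) + (toℚ 2 * x - toℚ 4 * σ + k * k + toℚ 2 * k) + toℚ 2 * (toℚ m * toℚ 32)) toℚ-Lm
      (square-sum-≼ (z^-unit j) (≼-weaken (z^-near-1 j) 2js≤8Ps) L (character-sum-≼ j 0<j (≤-trans 2js≤ 8Ps≤1)) A sums-<)) e≤h²
      where
      0<j : 0ℚ < toℚ j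
      0<j = <-≤-trans (0<toℚ 0) (toℚ-mono-≤ 1≤j)
      j≤ : toℚ j ≤ toℚ P * toℚ 4
      j≤ = ≤-trans (toℚ-mono-≤ j≤4P) (≤-reflexive (toℚ-* P 4))
      2js≤ : toℚ 2 * (toℚ j * s) ≤ toℚ 8 * toℚ P * s
      2js≤ = cert (2 ·≤ 0≤* 0≤s (diff j≤)) (lemma (toℚ j) (toℚ P) s)
        where
        lemma : ∀ j P s → toℚ 2 * (s * (P * toℚ 4 - j)) ≡ toℚ 8 * P * s - toℚ 2 * (j * s)
        lemma = solve-∀ ℚ-ring
      2js≤8Ps : toℚ j * (toℚ 2 * s) ≤ toℚ 8 * toℚ P * s
      2js≤8Ps = ≤-trans (≤-reflexive (lemma (toℚ j) s)) 2js≤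
        where
        lemma : ∀ j s → j * (toℚ 2 * s) ≡ toℚ 2 * (j * s)
        lemma = solve-∀ ℚ-ring

    -- For this `h` the right side of `concentration` is P h w/2 = (P - 4)k, against (P - 3)k on the
    -- left.
    k≤0 : k ≤ 0ℚ
    k≤0 = cert (diff (concentration k₀ 2k₀≤P 8Ks≤1 A block block≤2M sum≼h (ℕ.≤-trans (ℕ.s≤s ℕ.z≤n) 5≤P)))
      (trans (lemma₁ k (toℚ P) (leibnizUpper k₀) r) (trans (cong (λ x → (toℚ P - toℚ 4) * k * x - k * (toℚ P - toℚ 3)) Pwr≡1) (lemma₂ k (toℚ P))))
      where
      lemma₁ : ∀ k P u r → P * (½ * u) * (toℚ 2 * (P - toℚ 4) * k * r) + 1ℚ * (P * (toℚ 2 * (P - toℚ 4) * k * r)) - k * (P - toℚ 3)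
             ≡ (P - toℚ 4) * k * (P * (u + toℚ 2) * r) - k * (P - toℚ 3)
      lemma₁ = solve-∀ ℚ-ring
      lemma₂ : ∀ k P → (P - toℚ 4) * k * 1ℚ - k * (P - toℚ 3) ≡ 0ℚ - k
      lemma₂ = solve-∀ ℚ-ring

    impossible : ⊥
    impossible = <-irrefl refl (<-≤-trans (0<* (0<toℚ 19) 0<P) (≤-trans 20P≤k k≤0))

-- Continuation-passing keeps the chosen witnesses opaque, where projections of an existential would unfold.
choose-P : ∀ {q} k₀ → let w = leibnizUpper k₀ + toℚ 2 in toℚ 4 * (w * w) < (q * q) * (w * w + toℚ 4) → ∀ {R : Set} →
  (∀ P → 5 ℕ.≤ P → 2 ℕ.* k₀ ℕ.≤ P → q * q * (w * w + toℚ 32) ≤ toℚ P * (q * q * (w * w + toℚ 4) - toℚ 4 * (w * w)) → R) → R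
choose-P {q} k₀ above {R} return = build (archimedean (q * q * (w * w + toℚ 32)) 0<Δ)
  where
  w Δ : ℚ
  w = leibnizUpper k₀ + toℚ 2
  Δ = q * q * (w * w + toℚ 4) - toℚ 4 * (w * w)
  0<Δ : 0ℚ < Δ
  0<Δ = subst (_< Δ) (+-inverseʳ (toℚ 4 * (w * w))) (+-monoˡ-< (- (toℚ 4 * (w * w))) above)
  build : (∃ λ n → q * q * (w * w + toℚ 32) ≤ toℚ n * Δ) → R
  build (n , gap) = return (5 ℕ.+ 2 ℕ.* k₀ ℕ.+ n)
    (ℕ.≤-trans (ℕ.m≤m+n 5 (2 ℕ.* k₀)) (ℕ.m≤m+n (5 ℕ.+ 2 ℕ.* k₀) n))
    (ℕ.≤-trans (ℕ.m≤n+m (2 ℕ.* k₀) 5) (ℕ.m≤m+n (5 ℕ.+ 2 ℕ.* k₀) n))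
    (≤-trans gap (*-monoʳ-≤-nonNeg Δ {{nonNegative (<⇒≤ 0<Δ)}} (toℚ-mono-≤ (ℕ.m≤n+m n (5 ℕ.+ 2 ℕ.* k₀)))))

-- One condition X · im z ≤ 1 covers all five, X being the sum of five nonnegative coefficients; the
-- last is divided by q² beforehand to bring its bound to 1.
choose-rotation : ∀ {q} P {K} → 0ℚ < q → 0ℚ ≤ P → 0ℚ ≤ K → ∀ {R : Set} →
  (∀ z → Unit z → 0ℚ ≤ re z → 0ℚ < im z → toℚ 8 * im z ≤ 1ℚ → toℚ 8 * K * im z ≤ 1ℚ → toℚ 8 * P * im z ≤ 1ℚ →
    toℚ 40 * P * P * im z ≤ 1ℚ → toℚ 640 * P * im z ≤ q * q → R) → R
choose-rotation {q} P {K} 0<q 0≤P 0≤K {R} return = build (small-rotation (a₁ + a₂ + a₃ + a₄ + a₅))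
  where
  0<q² : 0ℚ < q * q
  0<q² = 0<* 0<q 0<q
  y a₁ a₂ a₃ a₄ a₅ : ℚ
  y = (1/ (q * q)) {{>-nonZero 0<q²}}
  a₁ = toℚ 8
  a₂ = toℚ 8 * K
  a₃ = toℚ 8 * P
  a₄ = toℚ 40 * P * P
  a₅ = toℚ 640 * P * y
  0≤y : 0ℚ ≤ y
  0≤y = nonNegative⁻¹ y {{pos⇒nonNeg y {{1/pos⇒pos (q * q) {{positive 0<q²}}}}}}
  0≤a₂ = 8 ·≤ 0≤K
  0≤a₃ = 8 ·≤ 0≤P
  0≤a₄ = 0≤* (40 ·≤ 0≤P) 0≤P
  0≤a₅ = 0≤* (640 ·≤ 0≤P) 0≤y
  lemma₁ : ∀ s a b c d e → (b + c + (d + e)) * s + (1ℚ - (a + b + c + d + e) * s) ≡ 1ℚ - a * s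
  lemma₁ = solve-∀ ℚ-ring
  lemma₂ : ∀ s a b c d e → (a + c + (d + e)) * s + (1ℚ - (a + b + c + d + e) * s) ≡ 1ℚ - b * s
  lemma₂ = solve-∀ ℚ-ring
  lemma₃ : ∀ s a b c d e → (a + b + (d + e)) * s + (1ℚ - (a + b + c + d + e) * s) ≡ 1ℚ - c * s
  lemma₃ = solve-∀ ℚ-ring
  lemma₄ : ∀ s a b c d e → (a + b + (c + e)) * s + (1ℚ - (a + b + c + d + e) * s) ≡ 1ℚ - d * s
  lemma₄ = solve-∀ ℚ-ring
  lemma₅ : ∀ s a b c d e → (a + b + (c + d)) * s + (1ℚ - (a + b + c + d + e) * s) ≡ 1ℚ - e * s
  lemma₅ = solve-∀ ℚ-ring
  build : (∃ λ z → Unit z × 0ℚ ≤ re z × 0ℚ < im z × (a₁ + a₂ + a₃ + a₄ + a₅) * im z ≤ 1ℚ) → R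
  build (z , u , 0≤c , 0<s , Xs≤1) = return z u 0≤c 0<s
    (cert (0≤+ (0≤* (0≤+ (0≤+ 0≤a₂ 0≤a₃) (0≤+ 0≤a₄ 0≤a₅)) 0≤s) (diff Xs≤1)) (lemma₁ s a₁ a₂ a₃ a₄ a₅))
    (cert (0≤+ (0≤* (0≤+ (0≤+ (0≤toℚ 8) 0≤a₃) (0≤+ 0≤a₄ 0≤a₅)) 0≤s) (diff Xs≤1)) (lemma₂ s a₁ a₂ a₃ a₄ a₅))
    (cert (0≤+ (0≤* (0≤+ (0≤+ (0≤toℚ 8) 0≤a₂) (0≤+ 0≤a₄ 0≤a₅)) 0≤s) (diff Xs≤1)) (lemma₃ s a₁ a₂ a₃ a₄ a₅))
    (cert (0≤+ (0≤* (0≤+ (0≤+ (0≤toℚ 8) 0≤a₂) (0≤+ 0≤a₃ 0≤a₅)) 0≤s) (diff Xs≤1)) (lemma₄ s a₁ a₂ a₃ a₄ a₅))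
    (cert (0≤* (<⇒≤ 0<q²) (diff a₅s≤1))
        (trans (lemma (q * q) y P s) (trans (cong (λ x → q * q * 1ℚ - x * (toℚ 640 * P * s)) (*-inverseʳ (q * q) {{>-nonZero 0<q²}})) (lemma′ (q * q) (toℚ 640 * P * s)))))
    where
    s = im z
    0≤s = <⇒≤ 0<s
    a₅s≤1 : a₅ * s ≤ 1ℚ
    a₅s≤1 = cert (0≤+ (0≤* (0≤+ (0≤+ (0≤toℚ 8) 0≤a₂) (0≤+ 0≤a₃ 0≤a₄)) 0≤s) (diff Xs≤1)) (lemma₅ s a₁ a₂ a₃ a₄ a₅)
    lemma : ∀ Q y P s → Q * (1ℚ - toℚ 640 * P * y * s) ≡ Q * 1ℚ - Q * y * (toℚ 640 * P * s)
    lemma = solve-∀ ℚ-ring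
    lemma′ : ∀ Q x → Q * 1ℚ - 1ℚ * x ≡ Q - x
    lemma′ = solve-∀ ℚ-ring

-- With ε = 1/(1 + 10P), 10P(c - σ) ≤ 10Pεc = (1 - ε)c ≤ c.
sparse-≤ : ∀ {ε P k σ c} → 0ℚ ≤ P → 0ℚ ≤ c → ε * (1ℚ + toℚ 10 * P) ≡ 1ℚ → 0ℚ ≤ ε → c ≡ ½ * (k * k - k) → ∣ σ - c ∣ ≤ ε * c →
  toℚ 10 * P * (½ * (k * k - k) - σ) ≤ ½ * (k * k - k)
sparse-≤ {ε} {P} {k} {σ} {c} 0≤P 0≤c ε-inverse 0≤ε refl close = cert
  (0≤+ (0≤* (10 ·≤ 0≤P) (diff c-σ≤εc)) (0≤* 0≤ε 0≤c))
  (trans (lemma₂ ε P σ c) (trans (cong (λ x → x * c - toℚ 10 * P * (c - σ)) ε-inverse) (lemma₃ P σ c)))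
  where
  lemma₁ : ∀ σ c → c - σ ≡ - (σ - c)
  lemma₁ = solve-∀ ℚ-ring
  lemma₂ : ∀ ε P σ c → toℚ 10 * P * (ε * c - (c - σ)) + ε * c ≡ ε * (1ℚ + toℚ 10 * P) * c - toℚ 10 * P * (c - σ)
  lemma₂ = solve-∀ ℚ-ring
  lemma₃ : ∀ P σ c → 1ℚ * c - toℚ 10 * P * (c - σ) ≡ c - toℚ 10 * P * (c - σ)
  lemma₃ = solve-∀ ℚ-ring
  c-σ≤εc : c - σ ≤ ε * c
  c-σ≤εc = ≤-trans (≤-reflexive (lemma₁ σ c)) (≤-trans (p≤∣p∣ (- (σ - c))) (≤-trans (≤-reflexive (∣-p∣≡∣p∣ (σ - c))) close))

-- Passage to all large j

strictly-increasing⇒≥ : ∀ (n : ℕ → ℕ) → (∀ j → n j ℕ.< n (suc j)) → ∀ j → j ℕ.≤ n j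
strictly-increasing⇒≥ n n< zero    = ℕ.z≤n
strictly-increasing⇒≥ n n< (suc j) = ℕ.≤-trans (ℕ.s≤s (strictly-increasing⇒≥ n n< j)) (n< j)

module Eventually
  (n : ℕ → ℕ) (A : ℕ → List ℕ) (n< : ∀ j → n j ℕ.< n (suc j)) (A⊆ : ∀ j → IsSubsetOfRange (n j) (A j)) (quasiSidon : QuasiSidon A)
  {q : ℚ} (0<q : 0ℚ < q) (k₀ : ℕ)
  where

  Bounded : Set
  Bounded = ∃ λ J → ∀ j → J ℕ.≤ j → toℚ (length (A j) ℕ.* length (A j)) ≤ (q * q) * toℚ (n j)

  w : ℚ
  w = leibnizUpper k₀ + toℚ 2

  bounded-from : ∀ P → 5 ℕ.≤ P → 2 ℕ.* k₀ ℕ.≤ P →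
    q * q * (w * w + toℚ 32) ≤ toℚ P * (q * q * (w * w + toℚ 4) - toℚ 4 * (w * w)) →
    ∀ z → Unit z → 0ℚ ≤ re z → 0ℚ < im z → toℚ 8 * im z ≤ 1ℚ → toℚ 8 * Averaged.stepError P * im z ≤ 1ℚ →
    toℚ 8 * toℚ P * im z ≤ 1ℚ → toℚ 40 * toℚ P * toℚ P * im z ≤ 1ℚ → toℚ 640 * toℚ P * im z ≤ q * q →
    Bounded
  bounded-from P 5≤P 2k₀≤P gap z u 0≤c 0<s 8s≤1 8Ks≤1 8Ps≤1 40P²s≤1 640Ps≤q² =
    eventually (quasiSidon ε 0<ε) (archimedean threshold (0<* 0<q 0<q))
    where
    open LargeSet z u 0≤c 0<s 8s≤1 P 5≤P k₀ 2k₀≤P 8Ks≤1 8Ps≤1 40P²s≤1 0<q 640Ps≤q² using (N; impossible)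
    ε : ℚ
    ε = ℤ.1ℤ / suc (10 ℕ.* P)
    0<ε : 0ℚ < ε
    0<ε = positive⁻¹ ε {{normalize-pos 1 (suc (10 ℕ.* P))}}
    ε-inverse : ε * (1ℚ + toℚ 10 * toℚ P) ≡ 1ℚ
    ε-inverse = trans (cong (ε *_) (sym (trans (toℚ-suc (10 ℕ.* P)) (cong (1ℚ +_) (toℚ-* 10 P))))) (1/suc-* (10 ℕ.* P))
    -- Depends on P, q and N, hence on z, but not on j.
    threshold : ℚ
    threshold = toℚ 20 * toℚ P * toℚ N + q * q * toℚ N + toℚ 400 * toℚ P * toℚ P
    Close : ℕ → Set
    Close j = ∣ toℚ (sumsetCard (A j)) - toℚ (length (A j) C 2) ∣ ≤ ε * toℚ (length (A j) C 2)
    not-large : ∀ {n₀} → threshold ≤ toℚ n₀ * (q * q) → ∀ j → n₀ ℕ.≤ j → Close j →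
      ¬ (q * q) * toℚ (n j) < toℚ (length (A j)) * toℚ (length (A j))
    not-large {n₀} threshold≤ j n₀≤j close q²n<k² = impossible (n j) (A j) (λ a∈ → proj₂ (All.lookup (proj₂ (A⊆ j)) a∈))
      (sparse-≤ {ε} {toℚ P} {toℚ (length (A j))} {toℚ (sumsetCard (A j))} {toℚ (length (A j) C 2)}
        (0≤toℚ P) (0≤toℚ (length (A j) C 2)) ε-inverse (<⇒≤ 0<ε) (choose-2 (length (A j))) close)
      (≤-trans threshold≤ (≤-trans (≤-reflexive (*-comm (toℚ n₀) (q * q)))
        (*-monoˡ-≤-nonNeg (q * q) {{nonNegative (0≤sq q)}} (toℚ-mono-≤ (ℕ.≤-trans n₀≤j (strictly-increasing⇒≥ n n< j))))))
      (<⇒≤ q²n<k²) gap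
    eventually : (∃ λ J → ∀ j → J ℕ.≤ j → Close j) → (∃ λ n₀ → threshold ≤ toℚ n₀ * (q * q)) → Bounded
    -- From J on the sumset is close enough to quasi-Sidon; from n₀ on, n j ≥ j ≥ n₀ puts q² n j
    -- above the threshold.
    eventually (J , close) (n₀ , threshold≤) = J ℕ.⊔ n₀ , λ j J⊔n₀≤j →
      ≤-trans (≤-reflexive (toℚ-* (length (A j)) (length (A j))))
        (≮⇒≥ (not-large threshold≤ j (ℕ.≤-trans (ℕ.m≤n⊔m J n₀) J⊔n₀≤j) (close j (ℕ.≤-trans (ℕ.m≤m⊔n J n₀) J⊔n₀≤j))))

theorem3 : (n : ℕ → ℕ) → (A : ℕ → List ℕ) →
    (∀ j → 1 ℕ.≤ n j) → (∀ j → n j ℕ.< n (suc j)) →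
    (∀ j → IsSubsetOfRange (n j) (A j)) →
    QuasiSidon A →
    ∀ (q : ℚ) → 0ℚ < q → AboveConstant q →
    ∃ λ J → ∀ j → J ℕ.≤ j →
    toℚ (length (A j) ℕ.* length (A j)) ≤ (q * q) * toℚ (n j)
theorem3 n A _ n< A⊆ quasiSidon q 0<q (k₀ , above) = choose-P {q} k₀ above λ P 5≤P 2k₀≤P gap →
  choose-rotation {q} (toℚ P) 0<q (0≤toℚ P) (Averaged.0≤stepError P)
    (Eventually.bounded-from n A n< A⊆ quasiSidon 0<q k₀ P 5≤P 2k₀≤P gap)
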